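{- Let $S$ be a sidigraph with $n$ vertices and $a=a^++a^-$ arcs, and let $z_1,z_2,\dots,z_n$ be its eigenvalues. Then $$E(S)\le\sqrt{\tfrac12\,n\,(a+c_2^+-c_2^-)}.$$
   Context: A sidigraph (signed digraph) is a pair $S=(D,\sigma)$, where $D=(V,\mathscr{A})$ is a digraph and $\sigma:\mathscr{A}\to\{ -1,1\}$. $a^+$ and $a^-$ are the numbers of positive and negative arcs of $S$. Its adjacency matrix $A(S)=(a_{ij})$ has $a_{ij}=\sigma(v_i,v_j)$ if there is an arc from $v_i$ to $v_j$ and $0$ otherwise; the eigenvalues of $S$ are those of $A(S)$ (with multiplicity), and the energy is $E(S)=\sum_{j=1}^n|\Re z_j|$. The sign of a walk is the product of the signs of its arcs. $c_2^+$ and $c_2^-$ denote the numbers of positive and negative closed walks of length $2$ in $S$, closed walks being counted with their starting vertex (i.e. summed over all vertices $v_i$ of walks from $v_i$ to $v_i$). -}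

module Defs where

open import Algebra.Bundles.Raw using (RawRing)
import Algebra.Definitions.RawMonoid as RawMonoidDefs
import Algebra.Definitions.RawSemiring as RawSemiringDefs
open import Data.Bool.Base using (Bool; T)
open import Data.Bool.Properties using (T?)
open import Data.Fin.Base using (Fin; zero; suc; toℕ; punchIn)
import Data.Fin.Properties as Fin
open import Data.Integer.Base as ℤ using (ℤ; +_; 0ℤ; _◃_)
import Data.Integer.Properties as ℤ
open import Data.List.Base using (List; []; _∷_; length; filter; map; concatMap; allFin)
open import Data.Nat.Base as ℕ using (ℕ; zero; suc)
import Data.Nat.DivMod as ℕ
import Data.Nat.Properties as ℕ
import Data.Nat.Tactic.RingSolver as ℕ-Ring
open import Data.Product.Base using (∃; _×_; _,_)
open import Data.Rational.Base as ℚ using (ℚ; mkℚ; 0ℚ; 1ℚ; ½; toℚᵘ)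
import Data.Rational.Properties as ℚ
open import Data.Rational.Solver using (module +-*-Solver)
import Data.Rational.Unnormalised.Base as ℚᵘ
import Data.Rational.Unnormalised.Properties as ℚᵘ
open import Data.Sign.Base as Sign using (Sign)
import Data.Sign.Properties as Sign
open import Data.Sum.Base using (inj₁; inj₂)
open import Data.Vec.Functional using (Vector)
open import Level as Level using (0ℓ)
open import Relation.Binary.PropositionalEquality
  using (_≡_; refl; sym; trans; cong; cong₂; subst; subst₂)
open import Relation.Nullary.Decidable.Core using (yes; no)
open import Relation.Nullary.Negation.Core using (contradiction)

IsCauchy : (ℕ → ℚ) → Set
IsCauchy s = ∀ ε → 0ℚ ℚ.< ε →
  ∃ λ N → ∀ m n → N ℕ.≤ m → N ℕ.≤ n → ℚ.∣ s m ℚ.- s n ∣ ℚ.< ε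

-- Real numbers as Cauchy sequences of rationals; equality is _≈_ below.
record ℝ : Set where
  constructor mkℝ
  field
    seq    : ℕ → ℚ
    cauchy : IsCauchy seq

open ℝ public

infix 4 _≈_ _≤_

_≈_ : ℝ → ℝ → Set
x ≈ y = ∀ ε → 0ℚ ℚ.< ε →
  ∃ λ N → ∀ n → N ℕ.≤ n → ℚ.∣ seq x n ℚ.- seq y n ∣ ℚ.< ε

_≤_ : ℝ → ℝ → Set
x ≤ y = ∀ ε → 0ℚ ℚ.< ε →
  ∃ λ N → ∀ n → N ℕ.≤ n → seq x n ℚ.< seq y n ℚ.+ ε

half-pos : ∀ {ε} → 0ℚ ℚ.< ε → 0ℚ ℚ.< ½ ℚ.* ε
half-pos {ε} 0<ε =
  subst (ℚ._< ½ ℚ.* ε) (ℚ.*-zeroʳ ½) (ℚ.*-monoʳ-<-pos ½ 0<ε)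

half+half : ∀ ε → ½ ℚ.* ε ℚ.+ ½ ℚ.* ε ≡ ε
half+half ε = trans (sym (ℚ.*-distribʳ-+ ε ½ ½)) (ℚ.*-identityˡ ε)

<-halves : ∀ {p q} ε → p ℚ.< ½ ℚ.* ε → q ℚ.< ½ ℚ.* ε → p ℚ.+ q ℚ.< ε
<-halves ε p< q< = subst (_ ℚ.<_) (half+half ε) (ℚ.+-mono-< p< q<)

∣∣-bound : ∀ p {ε} → p ℚ.< ε → ℚ.- p ℚ.< ε → ℚ.∣ p ∣ ℚ.< ε
∣∣-bound p p<ε -p<ε with ℚ.∣p∣≡p∨∣p∣≡-p p
... | inj₁ eq = subst (ℚ._< _) (sym eq) p<ε
... | inj₂ eq = subst (ℚ._< _) (sym eq) -p<ε

p≤∣p∣ : ∀ p → p ℚ.≤ ℚ.∣ p ∣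
p≤∣p∣ p with ℚ.≤-total 0ℚ p
... | inj₁ 0≤p = ℚ.≤-reflexive (sym (ℚ.0≤p⇒∣p∣≡p 0≤p))
... | inj₂ p≤0 = ℚ.≤-trans p≤0 (ℚ.0≤∣p∣ p)

∣∣-shift : ∀ p q → ℚ.∣ p ∣ ℚ.≤ ℚ.∣ q ∣ ℚ.+ ℚ.∣ p ℚ.- q ∣
∣∣-shift p q = subst (λ r → ℚ.∣ r ∣ ℚ.≤ ℚ.∣ q ∣ ℚ.+ ℚ.∣ p ℚ.- q ∣)
  (solve 2 (λ a b → b :+ (a :- b) := a) refl p q)
  (ℚ.∣p+q∣≤∣p∣+∣q∣ q (p ℚ.- q))
  where open +-*-Solver

∣-∣-bound : ∀ p q {ε} → p ℚ.- q ℚ.< ε → q ℚ.- p ℚ.< ε → ℚ.∣ p ℚ.- q ∣ ℚ.< ε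
∣-∣-bound p q {ε} p-q<ε q-p<ε = ∣∣-bound (p ℚ.- q) p-q<ε
  (subst (ℚ._< ε) (solve 2 (λ a b → b :- a := :- (a :- b)) refl p q) q-p<ε)
  where open +-*-Solver

<-move : ∀ p q r → p ℚ.< q ℚ.+ r → p ℚ.- q ℚ.< r
<-move p q r p< = subst (p ℚ.- q ℚ.<_)
  (solve 2 (λ a b → (a :+ b) :- a := b) refl q r)
  (ℚ.+-monoˡ-< (ℚ.- q) p<)
  where open +-*-Solver

<-unmove : ∀ p q r → p ℚ.- q ℚ.< r → p ℚ.< q ℚ.+ r
<-unmove p q r p< = subst (ℚ._< q ℚ.+ r)
  (solve 2 (λ a b → b :+ (a :- b) := a) refl p q)
  (ℚ.+-monoʳ-< q p<)
  where open +-*-Solver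

abstract
  const-cauchy : ∀ q → IsCauchy (λ _ → q)
  const-cauchy q ε 0<ε = 0 , λ _ _ _ _ →
    subst (ℚ._< ε) (sym (cong ℚ.∣_∣ (ℚ.+-inverseʳ q))) 0<ε

  +-cauchy : ∀ x y → IsCauchy (λ n → seq x n ℚ.+ seq y n)
  +-cauchy x y ε 0<ε with cauchy x (½ ℚ.* ε) (half-pos 0<ε) | cauchy y (½ ℚ.* ε) (half-pos 0<ε)
  ... | N , hx | M , hy = N ℕ.⊔ M , λ m n N≤m N≤n →
    let xm = seq x m ; xn = seq x n ; ym = seq y m ; yn = seq y n in
    ℚ.≤-<-trans
      (subst (λ r → ℚ.∣ r ∣ ℚ.≤ ℚ.∣ xm ℚ.- xn ∣ ℚ.+ ℚ.∣ ym ℚ.- yn ∣)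
        (solve 4 (λ a b c d → (a :- b) :+ (c :- d) := (a :+ c) :- (b :+ d)) refl xm xn ym yn)
        (ℚ.∣p+q∣≤∣p∣+∣q∣ (xm ℚ.- xn) (ym ℚ.- yn)))
      (<-halves ε
        (hx m n (ℕ.m⊔n≤o⇒m≤o N M N≤m) (ℕ.m⊔n≤o⇒m≤o N M N≤n))
        (hy m n (ℕ.m⊔n≤o⇒n≤o N M N≤m) (ℕ.m⊔n≤o⇒n≤o N M N≤n)))
    where open +-*-Solver

  neg-cauchy : ∀ x → IsCauchy (λ n → ℚ.- seq x n)
  neg-cauchy x ε 0<ε with cauchy x ε 0<ε
  ... | N , h = N , λ m n N≤m N≤n →
    subst (ℚ._< ε)
      (cong ℚ.∣_∣ (solve 2 (λ a b → b :- a := (:- a) :- (:- b)) refl (seq x m) (seq x n)))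
      (h n m N≤n N≤m)
    where open +-*-Solver

  abs-cauchy : ∀ x → IsCauchy (λ n → ℚ.∣ seq x n ∣)
  abs-cauchy x ε 0<ε with cauchy x ε 0<ε
  ... | N , h = N , λ m n N≤m N≤n →
    let xm = seq x m ; xn = seq x n in
    ∣-∣-bound ℚ.∣ xm ∣ ℚ.∣ xn ∣
      (<-move ℚ.∣ xm ∣ ℚ.∣ xn ∣ ε
        (ℚ.≤-<-trans (∣∣-shift xm xn) (ℚ.+-monoʳ-< ℚ.∣ xn ∣ (h m n N≤m N≤n))))
      (<-move ℚ.∣ xn ∣ ℚ.∣ xm ∣ ε
        (ℚ.≤-<-trans (∣∣-shift xn xm) (ℚ.+-monoʳ-< ℚ.∣ xm ∣ (h n m N≤n N≤m))))

eventually-bounded : ∀ x → ∃ λ B → 0ℚ ℚ.< B ×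
  ∃ λ N → ∀ n → N ℕ.≤ n → ℚ.∣ seq x n ∣ ℚ.≤ B
eventually-bounded x with cauchy x 1ℚ (ℚ.positive⁻¹ 1ℚ)
... | N , h =
    ℚ.∣ seq x N ∣ ℚ.+ 1ℚ
  , ℚ.+-mono-≤-< (ℚ.0≤∣p∣ (seq x N)) (ℚ.positive⁻¹ 1ℚ)
  , N
  , λ n N≤n → ℚ.≤-trans (∣∣-shift (seq x n) (seq x N))
      (ℚ.+-monoʳ-≤ ℚ.∣ seq x N ∣ (ℚ.<⇒≤ (h n N N≤n ℕ.≤-refl)))

-- A tolerance δ with B·δ = ε
scaled : ∀ B ε → 0ℚ ℚ.< B → 0ℚ ℚ.< ε → ∃ λ δ → 0ℚ ℚ.< δ × B ℚ.* δ ≡ ε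
scaled B ε 0<B 0<ε = ℚ.1/ B ℚ.* ε , 0<δ , eq
  where
  instance
    B-pos : ℚ.Positive B
    B-pos = ℚ.positive 0<B
    B-nonZero : ℚ.NonZero B
    B-nonZero = ℚ.pos⇒nonZero B
    1/B-pos : ℚ.Positive (ℚ.1/ B)
    1/B-pos = ℚ.1/pos⇒pos B
  0<δ : 0ℚ ℚ.< ℚ.1/ B ℚ.* ε
  0<δ = subst (ℚ._< ℚ.1/ B ℚ.* ε) (ℚ.*-zeroʳ (ℚ.1/ B)) (ℚ.*-monoʳ-<-pos (ℚ.1/ B) 0<ε)
  eq : B ℚ.* (ℚ.1/ B ℚ.* ε) ≡ ε
  eq = trans (sym (ℚ.*-assoc B (ℚ.1/ B) ε))
         (trans (cong (ℚ._* ε) (ℚ.*-inverseʳ B)) (ℚ.*-identityˡ ε))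

product-bound : ∀ {B} a d {δ} → 0ℚ ℚ.< B → ℚ.∣ a ∣ ℚ.≤ B → ℚ.∣ d ∣ ℚ.< δ →
                ℚ.∣ a ℚ.* d ∣ ℚ.< B ℚ.* δ
product-bound {B} a d {δ} 0<B a≤B d<δ = subst (ℚ._< B ℚ.* δ) (sym (ℚ.∣p*q∣≡∣p∣*∣q∣ a d))
  (ℚ.≤-<-trans
    (ℚ.*-monoʳ-≤-nonNeg ℚ.∣ d ∣ {{ℚ.∣-∣-nonNeg d}} a≤B)
    (ℚ.*-monoʳ-<-pos B {{ℚ.positive 0<B}} d<δ))

*-difference : ∀ a b c d → a ℚ.* (c ℚ.- d) ℚ.+ d ℚ.* (a ℚ.- b) ≡ a ℚ.* c ℚ.- b ℚ.* d
*-difference = solve 4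
  (λ a b c d → a :* (c :- d) :+ d :* (a :- b) := a :* c :- b :* d) refl
  where open +-*-Solver

∣*-difference∣ : ∀ {B C δ η ε} a b c d →
  0ℚ ℚ.< B → 0ℚ ℚ.< C → B ℚ.* δ ≡ ½ ℚ.* ε → C ℚ.* η ≡ ½ ℚ.* ε →
  ℚ.∣ a ∣ ℚ.≤ B → ℚ.∣ d ∣ ℚ.≤ C → ℚ.∣ c ℚ.- d ∣ ℚ.< δ → ℚ.∣ a ℚ.- b ∣ ℚ.< η →
  ℚ.∣ a ℚ.* c ℚ.- b ℚ.* d ∣ ℚ.< ε
∣*-difference∣ {ε = ε} a b c d 0<B 0<C Bδ Cη a≤B d≤C c-d a-b = ℚ.≤-<-trans
  (subst (λ r → ℚ.∣ r ∣ ℚ.≤ ℚ.∣ a ℚ.* (c ℚ.- d) ∣ ℚ.+ ℚ.∣ d ℚ.* (a ℚ.- b) ∣)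
    (*-difference a b c d)
    (ℚ.∣p+q∣≤∣p∣+∣q∣ (a ℚ.* (c ℚ.- d)) (d ℚ.* (a ℚ.- b))))
  (<-halves ε
    (subst (ℚ.∣ a ℚ.* (c ℚ.- d) ∣ ℚ.<_) Bδ (product-bound a (c ℚ.- d) 0<B a≤B c-d))
    (subst (ℚ.∣ d ℚ.* (a ℚ.- b) ∣ ℚ.<_) Cη (product-bound d (a ℚ.- b) 0<C d≤C a-b)))

abstract
  *-cauchy : ∀ x y → IsCauchy (λ n → seq x n ℚ.* seq y n)
  *-cauchy x y ε 0<ε =
    let B , 0<B , K , hB = eventually-bounded x
        C , 0<C , L , hC = eventually-bounded y
        δ , 0<δ , Bδ     = scaled B (½ ℚ.* ε) 0<B (half-pos 0<ε)
        η , 0<η , Cη     = scaled C (½ ℚ.* ε) 0<C (half-pos 0<ε)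
        M , hy           = cauchy y δ 0<δ
        N , hx           = cauchy x η 0<η
    in (K ℕ.⊔ L) ℕ.⊔ (M ℕ.⊔ N) , λ m n ≤m ≤n →
    let KL≤m = ℕ.m⊔n≤o⇒m≤o (K ℕ.⊔ L) (M ℕ.⊔ N) ≤m
        KL≤n = ℕ.m⊔n≤o⇒m≤o (K ℕ.⊔ L) (M ℕ.⊔ N) ≤n
        MN≤m = ℕ.m⊔n≤o⇒n≤o (K ℕ.⊔ L) (M ℕ.⊔ N) ≤m
        MN≤n = ℕ.m⊔n≤o⇒n≤o (K ℕ.⊔ L) (M ℕ.⊔ N) ≤n
    in ∣*-difference∣ (seq x m) (seq x n) (seq y m) (seq y n) 0<B 0<C Bδ Cη
      (hB m (ℕ.m⊔n≤o⇒m≤o K L KL≤m))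
      (hC n (ℕ.m⊔n≤o⇒n≤o K L KL≤n))
      (hy m n (ℕ.m⊔n≤o⇒m≤o M N MN≤m) (ℕ.m⊔n≤o⇒m≤o M N MN≤n))
      (hx m n (ℕ.m⊔n≤o⇒n≤o M N MN≤m) (ℕ.m⊔n≤o⇒n≤o M N MN≤n))

infixl 7 _*_
infixl 6 _+_ _-_
infix  8 -_

fromℚ : ℚ → ℝ
fromℚ q = mkℝ (λ _ → q) (const-cauchy q)

fromℤ : ℤ → ℝ
fromℤ i = fromℚ (i ℚ./ 1)

fromℕ : ℕ → ℝ
fromℕ n = fromℤ (+ n)

_+_ : ℝ → ℝ → ℝ
x + y = mkℝ (λ n → seq x n ℚ.+ seq y n) (+-cauchy x y)

-_ : ℝ → ℝ
- x = mkℝ (λ n → ℚ.- seq x n) (neg-cauchy x)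

_-_ : ℝ → ℝ → ℝ
x - y = x + (- y)

_*_ : ℝ → ℝ → ℝ
x * y = mkℝ (λ n → seq x n ℚ.* seq y n) (*-cauchy x y)

∣_∣ : ℝ → ℝ
∣ x ∣ = mkℝ (λ n → ℚ.∣ seq x n ∣) (abs-cauchy x)

ℝ-rawRing : RawRing 0ℓ 0ℓ
ℝ-rawRing = record
  { Carrier = ℝ ; _≈_ = _≈_ ; _+_ = _+_ ; _*_ = _*_ ; -_ = -_
  ; 0# = fromℚ 0ℚ ; 1# = fromℚ 1ℚ }

-- ⌊√ m ⌋
isqrt : ℕ → ℕ
isqrt zero = zero
isqrt (suc m) with suc (isqrt m) ℕ.* suc (isqrt m) ℕ.≤? suc m
... | yes _ = suc (isqrt m)
... | no  _ = isqrt m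

-- For q ≥ 0 this is ⌊ √q · (k + 1) ⌋ / (k + 1), the largest multiple of
-- 1 / (k + 1) not exceeding √q.
sqrtApprox : ℕ → ℚ → ℚ
sqrtApprox k q = + isqrt ((ℤ.∣ ℚ.↥ q ∣ ℕ.* (suc k ℕ.* suc k)) ℕ./ ℚ.↧ₙ q) ℚ./ suc k

isqrt-lower : ∀ m → isqrt m ℕ.* isqrt m ℕ.≤ m
isqrt-lower zero = ℕ.z≤n
isqrt-lower (suc m) with suc (isqrt m) ℕ.* suc (isqrt m) ℕ.≤? suc m
... | yes le = le
... | no  _  = ℕ.m≤n⇒m≤1+n (isqrt-lower m)

isqrt-upper : ∀ m → m ℕ.< suc (isqrt m) ℕ.* suc (isqrt m)
isqrt-upper zero = ℕ.s≤s ℕ.z≤n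
isqrt-upper (suc m) with suc (isqrt m) ℕ.* suc (isqrt m) ℕ.≤? suc m
... | yes _  = ℕ.≤-<-trans (isqrt-upper m)
                 (ℕ.*-mono-< (ℕ.n<1+n (suc (isqrt m))) (ℕ.n<1+n (suc (isqrt m))))
... | no  ¬≤ = ℕ.≰⇒> ¬≤

toℚᵘ-square : ∀ r k → toℚᵘ ((+ r ℚ./ suc k) ℚ.* (+ r ℚ./ suc k)) ℚᵘ.≃ ℚᵘ.mkℚᵘ (+ r) k ℚᵘ.* ℚᵘ.mkℚᵘ (+ r) k
toℚᵘ-square r k = ℚᵘ.≃-trans (ℚ.toℚᵘ-homo-* (+ r ℚ./ suc k) (+ r ℚ./ suc k))
  (ℚᵘ.*-cong (ℚ.toℚᵘ-fromℚᵘ (ℚᵘ.mkℚᵘ (+ r) k)) (ℚ.toℚᵘ-fromℚᵘ (ℚᵘ.mkℚᵘ (+ r) k)))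

square-≤ : ∀ r k p d-1 q → toℚᵘ q ≡ ℚᵘ.mkℚᵘ (+ p) d-1 → r ℕ.* r ℕ.* suc d-1 ℕ.≤ p ℕ.* (suc k ℕ.* suc k) →
           (+ r ℚ./ suc k) ℚ.* (+ r ℚ./ suc k) ℚ.≤ q
square-≤ r k p d-1 q@record{} refl h = ℚ.toℚᵘ-cancel-≤ (ℚᵘ.≤-respˡ-≃ (ℚᵘ.≃-sym (toℚᵘ-square r k))
  (ℚᵘ.*≤* (subst₂ ℤ._≤_
    (trans (ℤ.pos-* (r ℕ.* r) (suc d-1)) (cong (ℤ._* (+ suc d-1)) (ℤ.pos-* r r)))
    (ℤ.pos-* p (suc k ℕ.* suc k))
    (ℤ.+≤+ h))))

square-> : ∀ r k p d-1 q → toℚᵘ q ≡ ℚᵘ.mkℚᵘ (+ p) d-1 → p ℕ.* (suc k ℕ.* suc k) ℕ.< r ℕ.* r ℕ.* suc d-1 →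
           q ℚ.< (+ r ℚ./ suc k) ℚ.* (+ r ℚ./ suc k)
square-> r k p d-1 q@record{} refl h = ℚ.toℚᵘ-cancel-< (ℚᵘ.<-respʳ-≃ (ℚᵘ.≃-sym (toℚᵘ-square r k))
  (ℚᵘ.*<* (subst₂ ℤ._<_
    (ℤ.pos-* p (suc k ℕ.* suc k))
    (trans (ℤ.pos-* (r ℕ.* r) (suc d-1)) (cong (ℤ._* (+ suc d-1)) (ℤ.pos-* r r)))
    (ℤ.+<+ h))))

+suc/ : ∀ r k → + suc r ℚ./ suc k ≡ (+ r ℚ./ suc k) ℚ.+ (+ 1 ℚ./ suc k)
+suc/ r k = ℚ.toℚᵘ-injective
  (ℚᵘ.≃-trans (ℚ.toℚᵘ-fromℚᵘ (ℚᵘ.mkℚᵘ (+ suc r) k))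
  (ℚᵘ.≃-trans (ℚᵘ.*≡* eq)
  (ℚᵘ.≃-sym (ℚᵘ.≃-trans (ℚ.toℚᵘ-homo-+ (+ r ℚ./ suc k) (+ 1 ℚ./ suc k))
    (ℚᵘ.+-cong (ℚ.toℚᵘ-fromℚᵘ (ℚᵘ.mkℚᵘ (+ r) k)) (ℚ.toℚᵘ-fromℚᵘ (ℚᵘ.mkℚᵘ (+ 1) k)))))))
  where
  nat : ∀ r k → suc r ℕ.* (suc k ℕ.* suc k) ≡ (r ℕ.* suc k ℕ.+ 1 ℕ.* suc k) ℕ.* suc k
  nat = ℕ-Ring.solve-∀
  eq : + suc r ℤ.* + (suc k ℕ.* suc k) ≡ (+ r ℤ.* + suc k ℤ.+ + 1 ℤ.* + suc k) ℤ.* + suc k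
  eq = trans (sym (ℤ.pos-* (suc r) (suc k ℕ.* suc k)))
     (trans (cong +_ (nat r k))
     (trans (ℤ.pos-* (r ℕ.* suc k ℕ.+ 1 ℕ.* suc k) (suc k))
       (cong (ℤ._* + suc k)
         (cong₂ ℤ._+_ (ℤ.pos-* r (suc k)) (ℤ.pos-* 1 (suc k))))))

nonNeg-/ : ∀ r k → 0ℚ ℚ.≤ + r ℚ./ suc k
nonNeg-/ r k = ℚ.nonNegative⁻¹ (+ r ℚ./ suc k) {{ℚ.normalize-nonNeg r (suc k)}}

sqrtApprox-nonNeg : ∀ k q → 0ℚ ℚ.≤ sqrtApprox k q
sqrtApprox-nonNeg k q = nonNeg-/ (isqrt ((ℤ.∣ ℚ.↥ q ∣ ℕ.* (suc k ℕ.* suc k)) ℕ./ ℚ.↧ₙ q)) k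

sqrtApprox-lower : ∀ k q → 0ℚ ℚ.≤ q → sqrtApprox k q ℚ.* sqrtApprox k q ℚ.≤ q
sqrtApprox-lower k q@(mkℚ (+ p) d-1 c) _ =
  square-≤ r k p d-1 q refl
    (ℕ.≤-trans (ℕ.*-monoˡ-≤ (suc d-1) (isqrt-lower m)) (ℕ.m/n*n≤m (p ℕ.* (suc k ℕ.* suc k)) (suc d-1)))
  where
  m = (p ℕ.* (suc k ℕ.* suc k)) ℕ./ suc d-1
  r = isqrt m
sqrtApprox-lower k (mkℚ ℤ.-[1+ _ ] _ _) (ℚ.*≤* ())

sqrtApprox-upper : ∀ k q → 0ℚ ℚ.≤ q →
  q ℚ.< (sqrtApprox k q ℚ.+ + 1 ℚ./ suc k) ℚ.* (sqrtApprox k q ℚ.+ + 1 ℚ./ suc k)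
sqrtApprox-upper k q@(mkℚ (+ p) d-1 c) _ =
  subst (λ t → q ℚ.< t ℚ.* t) (+suc/ r k) (square-> (suc r) k p d-1 q refl bound)
  where
  A = p ℕ.* (suc k ℕ.* suc k)
  m = A ℕ./ suc d-1
  r = isqrt m
  A< : A ℕ.< suc m ℕ.* suc d-1
  A< = subst (ℕ._< suc m ℕ.* suc d-1) (sym (ℕ.m≡m%n+[m/n]*n A (suc d-1)))
         (ℕ.+-monoˡ-< (m ℕ.* suc d-1) (ℕ.m%n<n A (suc d-1)))
  bound : A ℕ.< suc r ℕ.* suc r ℕ.* suc d-1
  bound = ℕ.<-≤-trans A< (ℕ.*-monoˡ-≤ (suc d-1) (isqrt-upper m))
sqrtApprox-upper k (mkℚ ℤ.-[1+ _ ] _ _) (ℚ.*≤* ())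

archimedean : ∀ ε → 0ℚ ℚ.< ε → ∃ λ N → ∀ n → N ℕ.≤ n → + 1 ℚ./ suc n ℚ.≤ ε
archimedean ε@(mkℚ (+ suc p) d-1 c) _ = suc d-1 , λ n d≤n →
  ℚ.toℚᵘ-cancel-≤ (ℚᵘ.≤-respˡ-≃ (ℚᵘ.≃-sym (ℚ.toℚᵘ-fromℚᵘ (ℚᵘ.mkℚᵘ (+ 1) n)))
    (ℚᵘ.*≤* (subst₂ ℤ._≤_ (ℤ.pos-* 1 (suc d-1)) (ℤ.pos-* (suc p) (suc n))
      (ℤ.+≤+ (ℕ.*-mono-≤ {1} {suc p} (ℕ.s≤s ℕ.z≤n) (ℕ.m≤n⇒m≤1+n d≤n))))))
archimedean (mkℚ (+ 0) _ _) (ℚ.*<* (ℤ.+<+ ()))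
archimedean (mkℚ ℤ.-[1+ _ ] _ _) (ℚ.*<* ())

square-cancel-< : ∀ {s t} → 0ℚ ℚ.≤ t → s ℚ.* s ℚ.< t ℚ.* t → s ℚ.< t
square-cancel-< {s} {t} 0≤t s²<t² with s ℚ.<? t
... | yes s<t = s<t
... | no  s≮t = contradiction (ℚ.<-≤-trans s²<t² t²≤s²) (ℚ.<-irrefl refl)
  where
  t≤s : t ℚ.≤ s
  t≤s = ℚ.≮⇒≥ s≮t
  t²≤s² : t ℚ.* t ℚ.≤ s ℚ.* s
  t²≤s² = ℚ.≤-trans
    (ℚ.*-monoʳ-≤-nonNeg t {{ℚ.nonNegative 0≤t}} t≤s)
    (ℚ.*-monoˡ-≤-nonNeg s {{ℚ.nonNegative (ℚ.≤-trans 0≤t t≤s)}} t≤s)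

positivePart-< : ∀ p q ε → 0ℚ ℚ.< ε → p ℚ.< q ℚ.+ ε → p ℚ.⊔ 0ℚ ℚ.< (q ℚ.⊔ 0ℚ) ℚ.+ ε
positivePart-< p q ε 0<ε p<q+ε with ℚ.⊔-sel p 0ℚ
... | inj₁ eq = subst (ℚ._< _) (sym eq) (ℚ.<-≤-trans p<q+ε (ℚ.+-monoˡ-≤ ε (ℚ.p≤p⊔q q 0ℚ)))
... | inj₂ eq = subst (ℚ._< _) (sym eq)
                  (ℚ.+-mono-≤-< (ℚ.p≤q⊔p q 0ℚ) 0<ε)

-- If q ≤ q′ + δ², then the approximations satisfy s < s′ + δ + 1/(k+1).
sqrtApprox-close : ∀ j k q q′ δ → 0ℚ ℚ.≤ q → 0ℚ ℚ.≤ q′ → 0ℚ ℚ.< δ →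
  q ℚ.< q′ ℚ.+ δ ℚ.* δ →
  sqrtApprox j q ℚ.< sqrtApprox k q′ ℚ.+ (+ 1 ℚ./ suc k ℚ.+ δ)
sqrtApprox-close j k q q′ δ 0≤q 0≤q′ 0<δ q<q′+δ² =
  subst (s ℚ.<_) (ℚ.+-assoc s′ e δ)
    (square-cancel-< (ℚ.+-mono-≤ 0≤t (ℚ.<⇒≤ 0<δ))
      (ℚ.≤-<-trans (sqrtApprox-lower j q 0≤q)
      (ℚ.<-trans q<q′+δ²
      (ℚ.<-≤-trans (ℚ.+-monoˡ-< (δ ℚ.* δ) (sqrtApprox-upper k q′ 0≤q′)) expand))))
  where
  open +-*-Solver
  s  = sqrtApprox j q
  s′ = sqrtApprox k q′
  e  = + 1 ℚ./ suc k
  t  = s′ ℚ.+ e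
  0≤t : 0ℚ ℚ.≤ t
  0≤t = ℚ.+-mono-≤ (sqrtApprox-nonNeg k q′) (nonNeg-/ 1 k)
  0≤tδ : 0ℚ ℚ.≤ t ℚ.* δ
  0≤tδ = subst (ℚ._≤ t ℚ.* δ) (ℚ.*-zeroˡ δ)
           (ℚ.*-monoʳ-≤-nonNeg δ {{ℚ.nonNegative (ℚ.<⇒≤ 0<δ)}} 0≤t)
  expand : t ℚ.* t ℚ.+ δ ℚ.* δ ℚ.≤ (t ℚ.+ δ) ℚ.* (t ℚ.+ δ)
  expand = subst₂ ℚ._≤_
    (ℚ.+-identityʳ (t ℚ.* t ℚ.+ δ ℚ.* δ))
    (solve 2 (λ a b → (a :* a :+ b :* b) :+ (a :* b :+ a :* b) := (a :+ b) :* (a :+ b))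
      refl t δ)
    (ℚ.+-monoʳ-≤ (t ℚ.* t ℚ.+ δ ℚ.* δ) (ℚ.+-mono-≤ 0≤tδ 0≤tδ))

square-pos : ∀ δ → 0ℚ ℚ.< δ → 0ℚ ℚ.< δ ℚ.* δ
square-pos δ 0<δ = subst (ℚ._< δ ℚ.* δ) (ℚ.*-zeroʳ δ)
  (ℚ.*-monoʳ-<-pos δ {{ℚ.positive 0<δ}} 0<δ)

sqrtApprox-close⁺ : ∀ j k p q δ → 0ℚ ℚ.< δ → ℚ.∣ p ℚ.- q ∣ ℚ.< δ ℚ.* δ → + 1 ℚ./ suc k ℚ.≤ δ →
  sqrtApprox j (p ℚ.⊔ 0ℚ) ℚ.- sqrtApprox k (q ℚ.⊔ 0ℚ) ℚ.< δ ℚ.+ δ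
sqrtApprox-close⁺ j k p q δ 0<δ p-q<δ² 1/k≤δ =
  <-move (sqrtApprox j p⁺) (sqrtApprox k q⁺) (δ ℚ.+ δ)
    (ℚ.<-≤-trans
      (sqrtApprox-close j k p⁺ q⁺ δ (ℚ.p≤q⊔p p 0ℚ) (ℚ.p≤q⊔p q 0ℚ) 0<δ
        (positivePart-< p q (δ ℚ.* δ) (square-pos δ 0<δ)
          (<-unmove p q (δ ℚ.* δ) (ℚ.≤-<-trans (p≤∣p∣ (p ℚ.- q)) p-q<δ²))))
      (ℚ.+-monoʳ-≤ (sqrtApprox k q⁺) (ℚ.+-monoˡ-≤ δ 1/k≤δ)))
  where
  p⁺ = p ℚ.⊔ 0ℚ
  q⁺ = q ℚ.⊔ 0ℚ

abstract
  sqrt-cauchy : ∀ x → IsCauchy (λ k → sqrtApprox k (seq x k ℚ.⊔ 0ℚ))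
  sqrt-cauchy x ε 0<ε = tail (cauchy x (δ ℚ.* δ) (square-pos δ 0<δ)) (archimedean δ 0<δ)
    where
    δ : ℚ
    δ = ½ ℚ.* ε
    0<δ : 0ℚ ℚ.< δ
    0<δ = half-pos 0<ε
    s : ℕ → ℚ
    s k = sqrtApprox k (seq x k ℚ.⊔ 0ℚ)
    tail : (∃ λ N → ∀ m n → N ℕ.≤ m → N ℕ.≤ n → ℚ.∣ seq x m ℚ.- seq x n ∣ ℚ.< δ ℚ.* δ) →
           (∃ λ M → ∀ n → M ℕ.≤ n → + 1 ℚ./ suc n ℚ.≤ δ) →
           ∃ λ K → ∀ m n → K ℕ.≤ m → K ℕ.≤ n → ℚ.∣ s m ℚ.- s n ∣ ℚ.< ε
    tail (N , h) (M , hM) = N ℕ.⊔ M , λ m n ≤m ≤n →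
      ∣-∣-bound (s m) (s n) (one-sided m n ≤m ≤n) (one-sided n m ≤n ≤m)
      where
      one-sided : ∀ m n → N ℕ.⊔ M ℕ.≤ m → N ℕ.⊔ M ℕ.≤ n → s m ℚ.- s n ℚ.< ε
      one-sided m n ≤m ≤n = subst (s m ℚ.- s n ℚ.<_) (half+half ε)
        (sqrtApprox-close⁺ m n (seq x m) (seq x n) δ 0<δ
          (h m n (ℕ.m⊔n≤o⇒m≤o N M ≤m) (ℕ.m⊔n≤o⇒m≤o N M ≤n))
          (hM n (ℕ.m⊔n≤o⇒n≤o N M ≤n)))

-- Total: this is the square root of max x 0.
√_ : ℝ → ℝ
√ x = mkℝ (λ k → sqrtApprox k (seq x k ℚ.⊔ 0ℚ)) (sqrt-cauchy x)

record ℂ : Set where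
  constructor _+i_
  field
    Re : ℝ
    Im : ℝ

open ℂ public

ℂ-rawRing : RawRing 0ℓ 0ℓ
ℂ-rawRing = record
  { Carrier = ℂ
  ; _≈_ = λ z w → Re z ≈ Re w × Im z ≈ Im w
  ; _+_ = λ z w → (Re z + Re w) +i (Im z + Im w)
  ; _*_ = λ z w → (Re z * Re w - Im z * Im w) +i (Re z * Im w + Im z * Re w)
  ; -_  = λ z → (- Re z) +i (- Im z)
  ; 0#  = fromℚ 0ℚ +i fromℚ 0ℚ
  ; 1#  = fromℚ 1ℚ +i fromℚ 0ℚ
  }

ℤ→ℂ : ℤ → ℂ
ℤ→ℂ i = fromℤ i +i fromℚ 0ℚ

module Matrices {c ℓ} (R : RawRing c ℓ) where

  open RawRing R using (Carrier; 0#; 1#; rawSemiring)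
    renaming (_+_ to _⊕_; _*_ to _⊗_; -_ to ⊖_; _≈_ to _≋_)
  open RawSemiringDefs rawSemiring using (sum; product; _^_)

  Matrix : ℕ → Set c
  Matrix n = Fin n → Fin n → Carrier

  det : ∀ {n} → Matrix n → Carrier
  det {zero}  M = 1#
  det {suc n} M = sum λ j →
    ((⊖ 1#) ^ toℕ j) ⊗ (M zero j ⊗ det (λ i k → M (suc i) (punchIn j k)))

  scalar : ∀ {n} → Carrier → Matrix n
  scalar x i j with i Fin.≟ j
  ... | yes _ = x
  ... | no  _ = 0#

  -- The value at x of the characteristic polynomial det (x I - M).
  charPoly : ∀ {n} → Matrix n → Carrier → Carrier
  charPoly M x = det λ i j → scalar x i j ⊕ (⊖ M i j)

  -- The family z lists the eigenvalues of M with multiplicity: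
  -- det (x I - M) = (x - z₁) ⋯ (x - zₙ) for all x.  Over ℂ, where this is used,
  -- agreement at all x is equality of polynomials.
  AreEigenvalues : ∀ {n} → Matrix n → Vector Carrier n → Set (c Level.⊔ ℓ)
  AreEigenvalues M z = ∀ x → charPoly M x ≋ product (λ j → x ⊕ (⊖ z j))

-- Loops are permitted; parallel arcs are not.
record Digraph (n : ℕ) : Set where
  field
    isArc : Fin n → Fin n → Bool

  Arc : Fin n → Fin n → Set
  Arc u v = T (isArc u v)

record Sidigraph (n : ℕ) : Set where
  field
    digraph : Digraph n
  open Digraph digraph public
  field
    σ : ∀ {u v} → Arc u v → Sign

module _ {n} (S : Sidigraph n) where

  open Sidigraph S
  open RawMonoidDefs ℕ.+-0-rawMonoid using (sum)

  adjacency : Fin n → Fin n → ℤ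
  adjacency u v with T? (isArc u v)
  ... | yes e = σ e ◃ 1
  ... | no  _ = 0ℤ

  arcs : ∀ u v → List (Arc u v)
  arcs u v with T? (isArc u v)
  ... | yes e = e ∷ []
  ... | no  _ = []

  #arcs : Sign → ℕ
  #arcs s = sum λ u → sum λ v → length (filter (λ e → σ e Sign.≟ s) (arcs u v))

  a⁺ a⁻ a : ℕ
  a⁺ = #arcs Sign.+
  a⁻ = #arcs Sign.-
  a  = a⁺ ℕ.+ a⁻

  data Walk : ℕ → Fin n → Fin n → Set where
    []  : ∀ {u} → Walk 0 u u
    _∷_ : ∀ {k u v w} → Arc u v → Walk k v w → Walk (suc k) u w

  sign : ∀ {k u v} → Walk k u v → Sign
  sign []      = Sign.+
  sign (e ∷ p) = σ e Sign.* sign p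

  -- Every walk of length k from u to w occurs exactly once.
  walks : ∀ k u w → List (Walk k u w)
  walks zero u w with u Fin.≟ w
  ... | yes refl = [] ∷ []
  ... | no  _    = []
  walks (suc k) u w =
    concatMap (λ v → concatMap (λ e → map (e ∷_) (walks k v w)) (arcs u v)) (allFin n)

  -- Closed walks are counted with their starting vertex.
  #closedWalks : ℕ → Sign → ℕ
  #closedWalks k s = sum λ v → length (filter (λ p → sign p Sign.≟ s) (walks k v v))

  c₂⁺ c₂⁻ : ℕ
  c₂⁺ = #closedWalks 2 Sign.+
  c₂⁻ = #closedWalks 2 Sign.-

  Eigenvalues : Vector ℂ n → Set
  Eigenvalues = AreEigenvalues λ u v → ℤ→ℂ (adjacency u v)
    where open Matrices ℂ-rawRing

-- The energy depends on S only through its eigenvalues z₁, …, zₙ, so it is a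
-- function of them.
energy : ∀ {n} → Vector ℂ n → ℝ
energy z = sum λ j → ∣ Re (z j) ∣
  where open RawMonoidDefs (RawRing.+-rawMonoid ℝ-rawRing) using (sum)

{-# OPTIONS --safe #-}

-- Write H = (A + A*)/2 for the Hermitian part of the adjacency matrix A.  Since
-- A is a real matrix, ‖H‖² = (tr AAᵀ + tr A²)/2 = (a + c₂⁺ - c₂⁻)/2, so by the
-- Cauchy–Schwarz inequality it suffices that Σ (Re zⱼ)² ≤ ‖H‖².  This holds for
-- every complex matrix, by induction on its size: a unitary similarity, which
-- leaves ‖H‖ and the characteristic polynomial unchanged, moves an eigenvector
-- for z₁ to the first basis vector; deleting the first row and column then
-- removes the root z₁ and lowers ‖H‖² by at least (Re z₁)².
--
-- Whether a real number vanishes is undecidable, but ≤ is stable under double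
-- negation, so the induction may decide it.
module Submission where

open import Algebra.Bundles using (CommutativeRing; RawRing; Semiring)
import Algebra.Definitions.RawMonoid as RawMonoidDefs
import Algebra.Definitions.RawSemiring as RawSemiringDefs
import Algebra.Properties.Ring as RingProperties
import Algebra.Properties.Semiring.Mult as SemiringMult
import Algebra.Properties.Semiring.Sum as SemiringSum
import Algebra.Solver.Ring as RingSolver
import Algebra.Solver.Ring.AlmostCommutativeRing as ACR
open import Data.Bool.Properties using (T?)
import Data.Empty as Empty
open import Data.Fin.Base using (Fin; zero; suc; toℕ; punchIn)
import Data.Fin.Properties as Fin
open import Data.Fin.Subset using (Subset; inside; outside; ⊤; ⊥) renaming (∣_∣ to card)
open import Data.Fin.Subset.Properties using (∣p∣≤n; ∣⊤∣≡n)
open import Data.Integer.Base as ℤ using (ℤ; +_; -[1+_]; 0ℤ; 1ℤ; _◃_)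
import Data.Integer.Properties as ℤ
import Data.Integer.Solver as ℤ
open import Data.List.Base using (List; []; _∷_; _++_; length; filter; map; concatMap; tabulate)
open import Data.Maybe.Base using (Maybe; just; nothing)
open import Data.Nat.Base as ℕ using (ℕ; zero; suc)
import Data.Nat.Properties as ℕ
open import Data.Product.Base using (∃; _×_; _,_; proj₁; proj₂)
open import Data.Rational.Base as ℚ using (ℚ; 0ℚ; 1ℚ; ½)
import Data.Rational.Properties as ℚ
open import Data.Rational.Solver using (module +-*-Solver)
import Data.Rational.Unnormalised.Base as ℚᵘ
import Data.Rational.Unnormalised.Properties as ℚᵘ
open import Data.Sign.Base as Sign using (Sign)
import Data.Sign.Properties as Sign
open import Data.Sum.Base using (_⊎_; inj₁; inj₂)
open import Data.Vec.Base using ([]; _∷_; insertAt)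
open import Data.Vec.Functional using (Vector; tail)
open import Function.Base using (_∘_; id)
open import Level using (_⊔_; 0ℓ) renaming (suc to lsuc)
open import Relation.Binary.Bundles using (Setoid)
open import Relation.Binary.PropositionalEquality as ≡ using (_≡_; _≢_)
import Relation.Binary.Reasoning.Setoid as SetoidReasoning
open import Relation.Nullary.Decidable.Core using (yes; no)
open import Relation.Nullary.Negation.Core using (¬_; contradiction)
open import Defs using (module Matrices)

-- Two difficulties shape the proof. Eigenvalues are given through the values of det (x I - M), a
-- function and not a formal polynomial, so the factor x - z₁ cannot simply be cancelled at x = z₁.
-- The two remaining functions are therefore recognised as polynomial by their vanishing iterated
-- differences and compared at z₁ + 1, z₁ + 2, ..., where x - z₁ is invertible. Moreover, an
-- eigenvector has to be extracted from a vanishing determinant without row reduction. It is read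
-- off from the coordinates of an exterior product; the same coordinates yield det (AB) = det A det
-- B, on which invariance under similarity rests. The similarity is a Householder reflection since
-- such a matrix is its own adjoint and its own inverse: neither an inverse nor an orthonormal basis
-- has to be constructed. Halves are avoided by working with A + A* and z + z̄, so that all squares
-- carry a factor 4 until the final estimate over the reals.

-- The ring solver needs coefficients with decidable equality, which an
-- arbitrary commutative ring does not supply; ℤ does.
module IntegerSolver {c ℓ} (R : CommutativeRing c ℓ) where

  open CommutativeRing R
  open RingProperties ring
  open SemiringMult semiring renaming (_×_ to _·_)
  open import Relation.Binary.Reasoning.Setoid setoid

  fromInteger : ℤ → Carrier
  fromInteger (+ n)    = n · 1#
  fromInteger -[1+ n ] = - (suc n · 1#)

  cancel-1 : ∀ x y → (1# + x) - (1# + y) ≈ x - y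
  cancel-1 x y = begin
    (1# + x) - (1# + y)       ≈⟨ +-congˡ (-‿+-comm 1# y) ⟨
    (1# + x) + (- 1# + - y)   ≈⟨ +-congʳ (+-comm 1# x) ⟩
    (x + 1#) + (- 1# + - y)   ≈⟨ +-assoc x 1# _ ⟩
    x + (1# + (- 1# + - y))   ≈⟨ +-congˡ (+-assoc 1# (- 1#) (- y)) ⟨
    x + ((1# - 1#) + - y)     ≈⟨ +-congˡ (+-congʳ (-‿inverseʳ 1#)) ⟩
    x + (0# + - y)            ≈⟨ +-congˡ (+-identityˡ (- y)) ⟩
    x - y                     ∎

  -- Integer addition with mixed signs is defined through `⊖` on the naturals, so this case carries
  -- the additivity of `fromInteger`.
  fromInteger-⊖ : ∀ m n → fromInteger (m ℤ.⊖ n) ≈ m · 1# - n · 1#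
  fromInteger-⊖ m zero = begin
    m · 1#         ≈⟨ +-identityʳ _ ⟨
    m · 1# + 0#    ≈⟨ +-congˡ -0#≈0# ⟨
    m · 1# + - 0#  ∎
  fromInteger-⊖ zero (suc n) = sym (+-identityˡ _)
  fromInteger-⊖ (suc m) (suc n) = begin
    fromInteger (suc m ℤ.⊖ suc n)         ≡⟨ ≡.cong fromInteger (ℤ.[1+m]⊖[1+n]≡m⊖n m n) ⟩
    fromInteger (m ℤ.⊖ n)                 ≈⟨ fromInteger-⊖ m n ⟩
    m · 1# - n · 1#                       ≈⟨ cancel-1 _ _ ⟨
    suc m · 1# - suc n · 1#               ∎

  fromInteger-+ : ∀ i j → fromInteger (i ℤ.+ j) ≈ fromInteger i + fromInteger j
  fromInteger-+ (+ m)    (+ n)    = ×-homo-+ 1# m n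
  fromInteger-+ (+ m)    -[1+ n ] = fromInteger-⊖ m (suc n)
  fromInteger-+ -[1+ m ] (+ n)    = trans (fromInteger-⊖ n (suc m)) (+-comm _ _)
  fromInteger-+ -[1+ m ] -[1+ n ] = begin
    - (suc (suc (m ℕ.+ n)) · 1#)        ≡⟨ ≡.cong (λ k → - (suc k · 1#)) (ℕ.+-suc m n) ⟨
    - ((suc m ℕ.+ suc n) · 1#)          ≈⟨ -‿cong (×-homo-+ 1# (suc m) (suc n)) ⟩
    - (suc m · 1# + suc n · 1#)         ≈⟨ -‿+-comm _ _ ⟨
    - (suc m · 1#) + - (suc n · 1#)     ∎

  fromInteger-neg : ∀ i → fromInteger (ℤ.- i) ≈ - fromInteger i
  fromInteger-neg (+ zero)    = sym -0#≈0#
  fromInteger-neg (+ suc n)   = refl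
  fromInteger-neg -[1+ n ]    = sym (-‿involutive _)

  fromInteger-+◃ : ∀ n → fromInteger (Sign.+ ℤ.◃ n) ≈ n · 1#
  fromInteger-+◃ n = reflexive (≡.cong fromInteger (ℤ.+◃n≡+n n))

  fromInteger--◃ : ∀ n → fromInteger (Sign.- ℤ.◃ n) ≈ - (n · 1#)
  fromInteger--◃ n = trans (reflexive (≡.cong fromInteger (ℤ.-◃n≡-n n))) (fromInteger-neg (+ n))

  fromInteger-* : ∀ i j → fromInteger (i ℤ.* j) ≈ fromInteger i * fromInteger j
  fromInteger-* (+ m) (+ n) = trans (fromInteger-+◃ (m ℕ.* n)) (×1-homo-* m n)
  fromInteger-* (+ m) -[1+ n ] = begin
    fromInteger (Sign.- ℤ.◃ m ℕ.* suc n)  ≈⟨ fromInteger--◃ (m ℕ.* suc n) ⟩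
    - ((m ℕ.* suc n) · 1#)                ≈⟨ -‿cong (×1-homo-* m (suc n)) ⟩
    - ((m · 1#) * (suc n · 1#))           ≈⟨ -‿distribʳ-* _ _ ⟩
    (m · 1#) * - (suc n · 1#)             ∎
  fromInteger-* -[1+ m ] (+ n) = begin
    fromInteger (Sign.- ℤ.◃ suc m ℕ.* n)  ≈⟨ fromInteger--◃ (suc m ℕ.* n) ⟩
    - ((suc m ℕ.* n) · 1#)                ≈⟨ -‿cong (×1-homo-* (suc m) n) ⟩
    - ((suc m · 1#) * (n · 1#))           ≈⟨ -‿distribˡ-* _ _ ⟩
    - (suc m · 1#) * (n · 1#)             ∎
  fromInteger-* -[1+ m ] -[1+ n ] = begin
    fromInteger (Sign.+ ℤ.◃ suc m ℕ.* suc n)  ≈⟨ fromInteger-+◃ (suc m ℕ.* suc n) ⟩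
    (suc m ℕ.* suc n) · 1#                    ≈⟨ ×1-homo-* (suc m) (suc n) ⟩
    (suc m · 1#) * (suc n · 1#)               ≈⟨ -‿involutive _ ⟨
    - - ((suc m · 1#) * (suc n · 1#))         ≈⟨ -‿cong (-‿distribˡ-* _ _) ⟩
    - (- (suc m · 1#) * (suc n · 1#))         ≈⟨ -‿distribʳ-* _ _ ⟩
    - (suc m · 1#) * - (suc n · 1#)           ∎

  private
    morphism : ℤ.+-*-rawRing ACR.-Raw-AlmostCommutative⟶ ACR.fromCommutativeRing R
    morphism = record
      { ⟦_⟧    = fromInteger
      ; +-homo = fromInteger-+
      ; *-homo = fromInteger-*
      ; -‿homo = fromInteger-neg
      ; 0-homo = refl
      ; 1-homo = +-identityʳ 1#
      }

    fromInteger-≟ : ∀ i j → Maybe (fromInteger i ≈ fromInteger j)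
    fromInteger-≟ i j with i ℤ.≟ j
    ... | yes i≡j = just (reflexive (≡.cong fromInteger i≡j))
    ... | no  _   = nothing

  open RingSolver ℤ.+-*-rawRing (ACR.fromCommutativeRing R) morphism fromInteger-≟ public
    using (solve; _:=_; _:+_; _:*_; _:-_; :-_; con)

-- Exterior algebra in coordinates and Laplace expansion

-- Elements of the exterior algebra of Rⁿ are given by their coordinates, which
-- are indexed by the subsets of Fin n; the first basis vector stands leftmost.
module Exterior {c ℓ} (R : CommutativeRing c ℓ) where

  open CommutativeRing R hiding (zero)
  open RingProperties ring
  open SemiringSum semiring
  open RawSemiringDefs (Semiring.rawSemiring semiring) using (_^_)
  open IntegerSolver R
  open import Relation.Binary.Reasoning.Setoid setoid

  open Matrices rawRing using (Matrix; det; scalar)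

  Λ : ℕ → Set c
  Λ n = Subset n → Carrier

  infixr 6 _∧_
  infix 4 _≋_

  _≋_ : ∀ {n} → Λ n → Λ n → Set ℓ
  ω ≋ η = ∀ s → ω s ≈ η s

  -- Write ω = ω₀ + e₀ ∧ ω₁ with ω₀ and ω₁ free of e₀, and v = v₀ e₀ + v′. Then v ∧ ω = v′ ∧ ω₀ + e₀
  -- ∧ (v₀ ω₀ - v′ ∧ ω₁); the minus sign comes from moving e₀ to the left of v′.
  _∧_ : ∀ {n} → Vector Carrier n → Λ n → Λ n
  (v ∧ ω) []            = 0#
  (v ∧ ω) (outside ∷ s) = (tail v ∧ ω ∘ (outside ∷_)) s
  (v ∧ ω) (inside ∷ s)  = v zero * ω (outside ∷ s) - (tail v ∧ ω ∘ (inside ∷_)) s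

  unit : ∀ {n} → Λ n
  unit []            = 1#
  unit (outside ∷ s) = unit s
  unit (inside ∷ s)  = 0#

  wedge : ∀ {k n} → (Fin k → Vector Carrier n) → Λ n
  wedge {zero}  r = unit
  wedge {suc k} r = r zero ∧ wedge (tail r)

  minus-cong : ∀ {x y u v} → x ≈ y → u ≈ v → x - u ≈ y - v
  minus-cong p q = +-cong p (-‿cong q)

  ∧-cong : ∀ {n} {u v : Vector Carrier n} {ω η} → (∀ i → u i ≈ v i) → ω ≋ η → u ∧ ω ≋ v ∧ η
  ∧-cong p q []            = refl
  ∧-cong p q (outside ∷ s) = ∧-cong (p ∘ suc) (q ∘ (outside ∷_)) s
  ∧-cong p q (inside ∷ s)  =
    minus-cong (*-cong (p zero) (q _)) (∧-cong (p ∘ suc) (q ∘ (inside ∷_)) s)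

  wedge-cong : ∀ {k n} {r r′ : Fin k → Vector Carrier n} → (∀ i j → r i j ≈ r′ i j) → wedge r ≋ wedge r′
  wedge-cong {zero}  p = λ _ → refl
  wedge-cong {suc k} p = ∧-cong (p zero) (wedge-cong (p ∘ suc))

  ∧-linearˡ : ∀ {n} x (u v : Vector Carrier n) ω s →
    ((λ i → x * u i + v i) ∧ ω) s ≈ x * (u ∧ ω) s + (v ∧ ω) s
  ∧-linearˡ x u v ω []            = sym (trans (+-identityʳ _) (zeroʳ x))
  ∧-linearˡ x u v ω (outside ∷ s) = ∧-linearˡ x (tail u) (tail v) _ s
  ∧-linearˡ x u v ω (inside ∷ s)  = trans
    (minus-cong refl (∧-linearˡ x (tail u) (tail v) _ s))
    (solve 6 (λ x a b w p q → (x :* a :+ b) :* w :- (x :* p :+ q) := x :* (a :* w :- p) :+ (b :* w :- q))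
      refl x (u zero) (v zero) _ _ _)

  ∧-distribˡ : ∀ {n} (v : Vector Carrier n) ω η s → (v ∧ λ t → ω t + η t) s ≈ (v ∧ ω) s + (v ∧ η) s
  ∧-distribˡ v ω η []            = sym (+-identityʳ _)
  ∧-distribˡ v ω η (outside ∷ s) = ∧-distribˡ (tail v) _ _ s
  ∧-distribˡ v ω η (inside ∷ s)  = trans (minus-cong refl (∧-distribˡ (tail v) _ _ s))
    (solve 5 (λ a x y p q → a :* (x :+ y) :- (p :+ q) := (a :* x :- p) :+ (a :* y :- q)) refl (v zero) _ _ _ _)

  ∧-zeroʳ : ∀ {n} (v : Vector Carrier n) {ω} → (∀ s → ω s ≈ 0#) → ∀ s → (v ∧ ω) s ≈ 0#
  ∧-zeroʳ v ω≈0 []            = refl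
  ∧-zeroʳ v ω≈0 (outside ∷ s) = ∧-zeroʳ (tail v) (ω≈0 ∘ (outside ∷_)) s
  ∧-zeroʳ v ω≈0 (inside ∷ s)  = trans
    (minus-cong (trans (*-congˡ (ω≈0 _)) (zeroʳ _)) (∧-zeroʳ (tail v) (ω≈0 ∘ (inside ∷_)) s))
    (-‿inverseʳ 0#)

  ∧-zeroˡ : ∀ {n} {v : Vector Carrier n} ω → (∀ i → v i ≈ 0#) → ∀ s → (v ∧ ω) s ≈ 0#
  ∧-zeroˡ ω v≈0 []            = refl
  ∧-zeroˡ ω v≈0 (outside ∷ s) = ∧-zeroˡ _ (v≈0 ∘ suc) s
  ∧-zeroˡ ω v≈0 (inside ∷ s)  = trans
    (minus-cong (trans (*-congʳ (v≈0 _)) (zeroˡ _)) (∧-zeroˡ _ (v≈0 ∘ suc) s))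
    (-‿inverseʳ 0#)

  ∧-scaleʳ : ∀ {n} x (v : Vector Carrier n) ω s → (v ∧ λ t → x * ω t) s ≈ x * (v ∧ ω) s
  ∧-scaleʳ x v ω []            = sym (zeroʳ x)
  ∧-scaleʳ x v ω (outside ∷ s) = ∧-scaleʳ x (tail v) _ s
  ∧-scaleʳ x v ω (inside ∷ s)  = trans
    (minus-cong refl (∧-scaleʳ x (tail v) _ s))
    (solve 4 (λ x a w p → a :* (x :* w) :- x :* p := x :* (a :* w :- p)) refl x (v zero) _ _)

  -- The combination x ω - η is the shape that the `inside` clause of `_∧_` produces, so this lemma
  -- expands nested products.
  ∧-minusʳ : ∀ {n} x (v : Vector Carrier n) ω η s →
    (v ∧ λ t → x * ω t - η t) s ≈ x * (v ∧ ω) s - (v ∧ η) s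
  ∧-minusʳ x v ω η []            = sym (trans (minus-cong (zeroʳ x) refl) (-‿inverseʳ 0#))
  ∧-minusʳ x v ω η (outside ∷ s) = ∧-minusʳ x (tail v) _ _ s
  ∧-minusʳ x v ω η (inside ∷ s)  = trans
    (minus-cong refl (∧-minusʳ x (tail v) _ _ s))
    (solve 6 (λ x a w e p q → a :* (x :* w :- e) :- (x :* p :- q) := x :* (a :* w :- p) :- (a :* e :- q))
      refl x (v zero) _ _ _ _)

  -- This is proved directly: `∧-anticomm` would only give that twice the coordinate is zero, and 2
  -- may be a zero divisor in R.
  ∧-alternating : ∀ {n} (v : Vector Carrier n) ω s → (v ∧ v ∧ ω) s ≈ 0#
  ∧-alternating v ω []            = refl
  ∧-alternating v ω (outside ∷ s) = ∧-alternating (tail v) _ s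
  ∧-alternating v ω (inside ∷ s)  = trans
    (minus-cong refl (trans (∧-minusʳ (v zero) (tail v) _ _ s) (minus-cong refl (∧-alternating (tail v) _ s))))
    (trans (minus-cong refl (trans (+-congˡ -0#≈0#) (+-identityʳ _))) (-‿inverseʳ _))

  ∧-anticomm : ∀ {n} (u v : Vector Carrier n) ω s → (u ∧ v ∧ ω) s ≈ - (v ∧ u ∧ ω) s
  ∧-anticomm u v ω []            = sym -0#≈0#
  ∧-anticomm u v ω (outside ∷ s) = ∧-anticomm (tail u) (tail v) _ s
  ∧-anticomm u v ω (inside ∷ s)  = begin
    a * p - (tail u ∧ λ t → b * ω (outside ∷ t) - (tail v ∧ ω ∘ (inside ∷_)) t) s
      ≈⟨ minus-cong refl (∧-minusʳ b (tail u) _ _ s) ⟩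
    a * p - (b * q - w)
      ≈⟨ minus-cong refl (minus-cong refl (∧-anticomm (tail u) (tail v) _ s)) ⟩
    a * p - (b * q - - w′)
      ≈⟨ solve 5 (λ a b p q w → a :* p :- (b :* q :- :- w) := :- (b :* q :- (a :* p :- w))) refl a b p q w′ ⟩
    - (b * q - (a * p - w′))
      ≈⟨ -‿cong (minus-cong refl (∧-minusʳ a (tail v) _ _ s)) ⟨
    - (b * q - (tail v ∧ λ t → a * ω (outside ∷ t) - (tail u ∧ ω ∘ (inside ∷_)) t) s)  ∎
    where
    a = u zero
    b = v zero
    p = (tail v ∧ ω ∘ (outside ∷_)) s
    q = (tail u ∧ ω ∘ (outside ∷_)) s
    w = (tail u ∧ tail v ∧ ω ∘ (inside ∷_)) s
    w′ = (tail v ∧ tail u ∧ ω ∘ (inside ∷_)) s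

  -- Keeping only the coordinates that avoid j is the algebra homomorphism induced by the projection
  -- that kills the j-th basis vector. On a wedge of rows it deletes a column, which produces the
  -- minors of the Laplace expansion.
  ∧-delete : ∀ {n} (j : Fin (suc n)) (v : Vector Carrier (suc n)) ω s →
    (v ∧ ω) (insertAt s j outside) ≈ (v ∘ punchIn j ∧ λ t → ω (insertAt t j outside)) s
  ∧-delete zero    v ω s             = refl
  ∧-delete (suc j) v ω (outside ∷ s) = ∧-delete j (tail v) _ s
  ∧-delete (suc j) v ω (inside ∷ s)  = minus-cong refl (∧-delete j (tail v) _ s)

  unit-delete : ∀ {n} (j : Fin (suc n)) s → unit (insertAt s j outside) ≈ unit s
  unit-delete zero    s             = refl
  unit-delete (suc j) (outside ∷ s) = unit-delete j s
  unit-delete (suc j) (inside ∷ s)  = refl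

  wedge-delete : ∀ {k n} (j : Fin (suc n)) (r : Fin k → Vector Carrier (suc n)) s →
    wedge r (insertAt s j outside) ≈ wedge (λ i → r i ∘ punchIn j) s
  wedge-delete {zero}  j r s = unit-delete j s
  wedge-delete {suc k} j r s = trans (∧-delete j (r zero) _ s)
    (∧-cong (λ _ → refl) (wedge-delete j (tail r)) s)

  sum-cong : ∀ n {f g : Vector Carrier n} → (∀ i → f i ≈ g i) → sum f ≈ sum g
  sum-cong n = sum-cong-≋ {n}

  sum-neg : ∀ n (f : Vector Carrier n) → sum (λ i → - f i) ≈ - sum f
  sum-neg zero    f = sym -0#≈0#
  sum-neg (suc n) f = trans (+-congˡ (sum-neg n (tail f)))
    (solve 2 (λ x y → :- x :+ :- y := :- (x :+ y)) refl _ _)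

  -- The j-th basis vector has to pass j earlier ones to reach its place, hence the sign. The
  -- right-hand side has the form of the recursive clause of `det`.
  ∧-⊤ : ∀ {n} (v : Vector Carrier (suc n)) ω →
    (v ∧ ω) ⊤ ≈ sum λ j → (- 1#) ^ toℕ j * (v j * ω (insertAt ⊤ j outside))
  ∧-⊤ {zero}  v ω = trans (+-congˡ -0#≈0#) (+-congʳ (sym (*-identityˡ _)))
  ∧-⊤ {suc n} v ω = +-cong (sym (*-identityˡ _)) (begin
    - (tail v ∧ ω ∘ (inside ∷_)) ⊤                 ≈⟨ -‿cong (∧-⊤ (tail v) (ω ∘ (inside ∷_))) ⟩
    - sum (λ j → (- 1#) ^ toℕ j * x j)              ≈⟨ sum-neg (suc n) (λ j → (- 1#) ^ toℕ j * x j) ⟨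
    sum (λ j → - ((- 1#) ^ toℕ j * x j))            ≈⟨ sum-cong (suc n) (λ j →
                                                         trans (sym (-1*x≈-x _)) (sym (*-assoc (- 1#) ((- 1#) ^ toℕ j) (x j)))) ⟩
    sum (λ j → (- 1#) ^ suc (toℕ j) * x j)          ∎)
    where
    x : Vector Carrier (suc n)
    x j = v (suc j) * ω (inside ∷ insertAt ⊤ j outside)

  det≈wedge : ∀ {n} (M : Matrix n) → det M ≈ wedge M ⊤
  det≈wedge {zero}  M = refl
  det≈wedge {suc n} M = sym (trans (∧-⊤ (M zero) (wedge (tail M))) (sum-cong (suc n) λ j →
    *-congˡ {(- 1#) ^ toℕ j} (*-congˡ {M zero j}
      (trans (wedge-delete j (tail M) ⊤) (sym (det≈wedge λ i → M (suc i) ∘ punchIn j))))))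

  det-cong : ∀ {n} {M N : Matrix n} → (∀ i j → M i j ≈ N i j) → det M ≈ det N
  det-cong {M = M} {N} p = trans (det≈wedge M) (trans (wedge-cong p ⊤) (sym (det≈wedge N)))

  -- Grading, induced homomorphisms and multiplicativity of the determinant

  Homogeneous : ∀ {n} → ℕ → Λ n → Set ℓ
  Homogeneous d ω = ∀ s → card s ≢ d → ω s ≈ 0#

  -- The offset makes the coordinates containing the first basis vector fall
  -- under the induction hypothesis.
  ∧-degree : ∀ k {n d} (v : Vector Carrier n) ω → (∀ s → k ℕ.+ card s ≢ d → ω s ≈ 0#) →
    ∀ s → k ℕ.+ card s ≢ suc d → (v ∧ ω) s ≈ 0#
  ∧-degree k v ω h []            ne = refl
  ∧-degree k v ω h (outside ∷ s) ne = ∧-degree k (tail v) _ (h ∘ (outside ∷_)) s ne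
  ∧-degree k v ω h (inside ∷ s)  ne = trans
    (minus-cong
      (trans (*-congˡ (h (outside ∷ s) λ eq → ne (≡.trans (ℕ.+-suc k (card s)) (≡.cong suc eq)))) (zeroʳ _))
      (∧-degree (suc k) (tail v) _
        (λ t ne′ → h (inside ∷ t) (λ eq → ne′ (≡.trans (≡.sym (ℕ.+-suc k (card t))) eq))) s
        (λ eq → ne (≡.trans (ℕ.+-suc k (card s)) eq))))
    (-‿inverseʳ 0#)

  ∧-homogeneous : ∀ {n d} (v : Vector Carrier n) {ω} → Homogeneous d ω → Homogeneous (suc d) (v ∧ ω)
  ∧-homogeneous v = ∧-degree 0 v _

  unit-homogeneous : ∀ {n} → Homogeneous {n} 0 unit
  unit-homogeneous []            ne = contradiction ≡.refl ne
  unit-homogeneous (outside ∷ s) ne = unit-homogeneous s ne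
  unit-homogeneous (inside ∷ s)  ne = refl

  wedge-homogeneous : ∀ {k n} (r : Fin k → Vector Carrier n) → Homogeneous k (wedge r)
  wedge-homogeneous {zero}  r = unit-homogeneous
  wedge-homogeneous {suc k} r = ∧-homogeneous (r zero) (wedge-homogeneous (tail r))

  combine : ∀ {k n} → Vector Carrier k → (Fin k → Vector Carrier n) → Vector Carrier n
  combine v B j = sum λ i → v i * B i j

  -- The algebra homomorphism that sends the basis vectors to the rows of B.
  Λ-map : ∀ {k n} → (Fin k → Vector Carrier n) → Λ k → Λ n
  Λ-map {zero}  B ω s = ω [] * unit s
  Λ-map {suc k} B ω s = Λ-map (tail B) (ω ∘ (outside ∷_)) s + (B zero ∧ Λ-map (tail B) (ω ∘ (inside ∷_))) s

  Λ-map-cong : ∀ {k n} (B : Fin k → Vector Carrier n) {ω η} → ω ≋ η → Λ-map B ω ≋ Λ-map B η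
  Λ-map-cong {zero}  B p s = *-congʳ (p [])
  Λ-map-cong {suc k} B p s = +-cong (Λ-map-cong (tail B) (p ∘ (outside ∷_)) s)
    (∧-cong (λ _ → refl) (Λ-map-cong (tail B) (p ∘ (inside ∷_))) s)

  Λ-map-minus : ∀ {k n} (B : Fin k → Vector Carrier n) x ω η s →
    Λ-map B (λ t → x * ω t - η t) s ≈ x * Λ-map B ω s - Λ-map B η s
  Λ-map-minus {zero}  B x ω η s =
    solve 4 (λ x a b u → (x :* a :- b) :* u := x :* (a :* u) :- b :* u) refl x _ _ _
  Λ-map-minus {suc k} B x ω η s = trans
    (+-cong (Λ-map-minus (tail B) x _ _ s)
      (trans (∧-cong (λ _ → refl) (Λ-map-minus (tail B) x _ _) s) (∧-minusʳ x (B zero) _ _ s)))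
    (solve 5 (λ x a b c d → (x :* a :- b) :+ (x :* c :- d) := x :* (a :+ c) :- (b :+ d)) refl x _ _ _ _)

  Λ-map-zero : ∀ {k n} (B : Fin k → Vector Carrier n) s → Λ-map B (λ _ → 0#) s ≈ 0#
  Λ-map-zero {zero}  B s = zeroˡ _
  Λ-map-zero {suc k} B s = trans
    (+-cong (Λ-map-zero (tail B) s) (∧-zeroʳ (B zero) (Λ-map-zero (tail B)) s)) (+-identityʳ _)

  Λ-map-unit : ∀ {k n} (B : Fin k → Vector Carrier n) → Λ-map B unit ≋ unit
  Λ-map-unit {zero}  B s = *-identityˡ _
  Λ-map-unit {suc k} B s = trans
    (+-cong (Λ-map-unit (tail B) s) (∧-zeroʳ (B zero) (Λ-map-zero (tail B)) s)) (+-identityʳ _)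

  -- After splitting off e₀, with image b, the left side contains b ∧ w ∧ η₁ with w the image of
  -- `tail v`; anticommutativity puts it in the order w ∧ b ∧ η₁. The right side has one further
  -- term, a multiple of b ∧ b ∧ η₁, which vanishes by alternation.
  Λ-map-∧ : ∀ {k n} (B : Fin k → Vector Carrier n) v ω s →
    Λ-map B (v ∧ ω) s ≈ (combine v B ∧ Λ-map B ω) s
  Λ-map-∧ {zero}  B v ω s = trans (zeroˡ _) (sym (∧-zeroˡ _ (λ _ → refl) s))
  Λ-map-∧ {suc k} B v ω s = begin
    Λ-map B′ (v′ ∧ ω₀) s + (b ∧ Λ-map B′ (λ t → a * ω₀ t - (v′ ∧ ω₁) t)) s
      ≈⟨ +-cong (Λ-map-∧ B′ v′ ω₀ s) (∧-cong (λ _ → refl)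
           (λ t → trans (Λ-map-minus B′ a ω₀ _ t) (minus-cong refl (Λ-map-∧ B′ v′ ω₁ t))) s) ⟩
    (w ∧ η₀) s + (b ∧ λ t → a * η₀ t - (w ∧ η₁) t) s
      ≈⟨ +-congˡ (trans (∧-minusʳ a b _ _ s) (minus-cong refl (∧-anticomm b w η₁ s))) ⟩
    (w ∧ η₀) s + (a * (b ∧ η₀) s - - (w ∧ b ∧ η₁) s)
      ≈⟨ solve 3 (λ x y z → x :+ (y :- :- z) := y :+ (x :+ z)) refl _ _ _ ⟩
    a * (b ∧ η₀) s + ((w ∧ η₀) s + (w ∧ b ∧ η₁) s)
      ≈⟨ +-cong (*-congˡ b∧η) (∧-distribˡ w η₀ (b ∧ η₁) s) ⟨
    a * (b ∧ Λ-map B ω) s + (w ∧ Λ-map B ω) s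
      ≈⟨ ∧-linearˡ a b w (Λ-map B ω) s ⟨
    (combine v B ∧ Λ-map B ω) s  ∎
    where
    a  = v zero
    v′ = tail v
    b  = B zero
    B′ = tail B
    w  = combine v′ B′
    ω₀ = ω ∘ (outside ∷_)
    ω₁ = ω ∘ (inside ∷_)
    η₀ = Λ-map B′ ω₀
    η₁ = Λ-map B′ ω₁
    b∧η : (b ∧ Λ-map B ω) s ≈ (b ∧ η₀) s
    b∧η = begin
      (b ∧ Λ-map B ω) s              ≈⟨ ∧-distribˡ b η₀ (b ∧ η₁) s ⟩
      (b ∧ η₀) s + (b ∧ b ∧ η₁) s    ≈⟨ +-congˡ (∧-alternating b η₁ s) ⟩
      (b ∧ η₀) s + 0#                ≈⟨ +-identityʳ _ ⟩
      (b ∧ η₀) s                     ∎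

  Λ-map-wedge : ∀ {m k n} (A : Fin m → Vector Carrier k) (B : Fin k → Vector Carrier n) →
    Λ-map B (wedge A) ≋ wedge λ i → combine (A i) B
  Λ-map-wedge {zero}  A B s = Λ-map-unit B s
  Λ-map-wedge {suc m} A B s = trans (Λ-map-∧ B (A zero) _ s)
    (∧-cong (λ _ → refl) (Λ-map-wedge (tail A) B) s)

  -- An element of degree k over k basis vectors is a multiple of their full wedge, whose image is
  -- the wedge of the rows of B. Homogeneity enters through the subsets that omit a basis vector:
  -- they have fewer than k elements, so their coordinates vanish.
  Λ-map-top : ∀ {k n} (B : Fin k → Vector Carrier n) x ω → Homogeneous k ω → ω ⊤ ≈ x →
    ∀ s → Λ-map B ω s ≈ x * wedge B s
  Λ-map-top {zero}  B x ω h eq s = *-congʳ eq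
  Λ-map-top {suc k} B x ω h eq s = begin
    Λ-map (tail B) (ω ∘ (outside ∷_)) s + (B zero ∧ Λ-map (tail B) (ω ∘ (inside ∷_))) s
      ≈⟨ +-cong
           (trans (Λ-map-cong (tail B) (λ t → h (outside ∷ t) (ℕ.<⇒≢ (ℕ.s≤s (∣p∣≤n t)))) s)
             (Λ-map-zero (tail B) s))
           (∧-cong (λ _ → refl) (Λ-map-top (tail B) x _ (λ t ne → h (inside ∷ t) (ne ∘ ℕ.suc-injective)) eq) s) ⟩
    0# + (B zero ∧ λ t → x * wedge (tail B) t) s
      ≈⟨ trans (+-identityˡ _) (∧-scaleʳ x (B zero) _ s) ⟩
    x * wedge B s  ∎

  infixl 7 _⊛_
  _⊛_ : ∀ {n} → Matrix n → Matrix n → Matrix n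
  (A ⊛ B) i = combine (A i) B

  -- The wedge of the rows of A is det A times the full wedge of the basis. The homomorphism of B
  -- sends it to the wedge of the rows of AB on the one hand, and to det A times the wedge of the
  -- rows of B on the other.
  det-⊛ : ∀ {n} (A B : Matrix n) → det (A ⊛ B) ≈ det A * det B
  det-⊛ A B = begin
    det (A ⊛ B)              ≈⟨ det≈wedge (A ⊛ B) ⟩
    wedge (A ⊛ B) ⊤          ≈⟨ Λ-map-wedge A B ⊤ ⟨
    Λ-map B (wedge A) ⊤      ≈⟨ Λ-map-top B (det A) _ (wedge-homogeneous A) (sym (det≈wedge A)) ⊤ ⟩
    det A * wedge B ⊤        ≈⟨ *-congˡ (det≈wedge B) ⟨
    det A * det B            ∎

  -- Block triangular determinants and the identity matrix

  wedge-outside : ∀ {k n} (r : Fin k → Vector Carrier (suc n)) → (∀ i → r i zero ≈ 0#) →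
    ∀ s → wedge r (outside ∷ s) ≈ wedge (λ i → tail (r i)) s × wedge r (inside ∷ s) ≈ 0#
  wedge-outside {zero}  r r≈0 s = refl , refl
  wedge-outside {suc k} r r≈0 s =
      ∧-cong (λ _ → refl) (λ t → proj₁ (wedge-outside (tail r) (r≈0 ∘ suc) t)) s
    , trans (minus-cong (trans (*-congʳ (r≈0 zero)) (zeroˡ _))
        (∧-zeroʳ (tail (r zero)) (λ t → proj₂ (wedge-outside (tail r) (r≈0 ∘ suc) t)) s))
        (-‿inverseʳ 0#)

  -- `det` expands along a row, but here a column is sparse. In the wedge of the rows only row 0
  -- involves e₀, so the coordinates of the other rows' wedge that contain e₀ are zero.
  det-column : ∀ {n} (M : Matrix (suc n)) → (∀ i → M (suc i) zero ≈ 0#) →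
    det M ≈ M zero zero * det (λ i j → M (suc i) (suc j))
  det-column M M≈0 = begin
    det M  ≈⟨ det≈wedge M ⟩
    M zero zero * wedge (tail M) (outside ∷ ⊤) - (tail (M zero) ∧ wedge (tail M) ∘ (inside ∷_)) ⊤
      ≈⟨ minus-cong (*-congˡ (trans (proj₁ (wedge-outside (tail M) M≈0 ⊤)) (sym (det≈wedge M′))))
           (∧-zeroʳ _ (λ t → proj₂ (wedge-outside (tail M) M≈0 t)) ⊤) ⟩
    M zero zero * det M′ - 0#  ≈⟨ trans (+-congˡ -0#≈0#) (+-identityʳ _) ⟩
    M zero zero * det M′       ∎
    where
    M′ : Matrix _
    M′ i j = M (suc i) (suc j)

  identity : ∀ {n} → Matrix n
  identity = scalar 1#

  scalar-suc : ∀ {n} x (i j : Fin n) → scalar x (suc i) (suc j) ≈ scalar x i j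
  scalar-suc x i j with i Fin.≟ j
  ... | yes _ = refl
  ... | no  _ = refl

  det-identity : ∀ n → det (identity {n}) ≈ 1#
  det-identity zero    = refl
  det-identity (suc n) = begin
    det (identity {suc n})                              ≈⟨ det-column (identity {suc n}) (λ _ → refl) ⟩
    1# * det (λ i j → identity {suc n} (suc i) (suc j))  ≈⟨ *-identityˡ _ ⟩
    det (λ i j → identity {suc n} (suc i) (suc j))       ≈⟨ det-cong {n} (scalar-suc 1#) ⟩
    det (identity {n})                                   ≈⟨ det-identity n ⟩
    1#                                                   ∎

  combine-identity : ∀ {k} (v : Vector Carrier k) j → combine v identity j ≈ v j
  combine-identity {suc k} v zero = begin
    v zero * 1# + sum (λ i → v (suc i) * 0#)
      ≈⟨ +-cong (*-identityʳ _) (trans (sum-cong k (λ i → zeroʳ (v (suc i)))) (sum-replicate-zero k)) ⟩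
    v zero + 0#  ≈⟨ +-identityʳ _ ⟩
    v zero       ∎
  combine-identity {suc k} v (suc j) = begin
    v zero * 0# + sum (λ i → v (suc i) * identity (suc i) (suc j))
      ≈⟨ +-cong (zeroʳ _) (sum-cong k (λ i → *-congˡ (scalar-suc 1# i j))) ⟩
    0# + combine (tail v) identity j  ≈⟨ trans (+-identityˡ _) (combine-identity (tail v) j) ⟩
    v (suc j)  ∎

  combine-∧ : ∀ {k n} (v : Vector Carrier k) (B : Fin k → Vector Carrier n) ω s →
    (combine v B ∧ ω) s ≈ sum λ i → v i * (B i ∧ ω) s
  combine-∧ {zero}  v B ω s = ∧-zeroˡ ω (λ _ → refl) s
  combine-∧ {suc k} v B ω s = trans
    (∧-linearˡ (v zero) (B zero) (combine (tail v) (tail B)) ω s) (+-congˡ (combine-∧ (tail v) (tail B) ω s))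

  ∧-expand : ∀ {n} (v : Vector Carrier n) ω s → (v ∧ ω) s ≈ sum λ i → v i * (identity i ∧ ω) s
  ∧-expand v ω s = trans
    (∧-cong (λ j → sym (combine-identity v j)) (λ _ → refl) s) (combine-∧ v identity ω s)

  -- Adjoining a missing basis vector loses no coordinate, up to sign.
  ∧-basis : ∀ {n} (ω : Λ n) s → s ≢ ⊤ →
    ∃ λ i → ∃ λ t → (identity i ∧ ω) t ≈ ω s ⊎ (identity i ∧ ω) t ≈ - ω s
  ∧-basis ω [] s≢⊤ = contradiction ≡.refl s≢⊤
  ∧-basis ω (outside ∷ s) _ = zero , inside ∷ s , inj₁ (trans
    (minus-cong (*-identityˡ _) (∧-zeroˡ _ (λ _ → refl) s)) (trans (+-congˡ -0#≈0#) (+-identityʳ _)))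
  ∧-basis ω (inside ∷ s) s≢⊤ with ∧-basis (ω ∘ (inside ∷_)) s (s≢⊤ ∘ ≡.cong (inside ∷_))
  ... | i , t , eq = suc i , inside ∷ t , flip-sign eq
    where
    x = (identity i ∧ ω ∘ (inside ∷_)) t
    step : (identity (suc i) ∧ ω) (inside ∷ t) ≈ - x
    step = trans
      (minus-cong (zeroˡ _) (∧-cong (scalar-suc 1# i) (λ _ → refl) t)) (+-identityˡ _)
    flip-sign : x ≈ ω (inside ∷ s) ⊎ x ≈ - ω (inside ∷ s) →
      (identity (suc i) ∧ ω) (inside ∷ t) ≈ ω (inside ∷ s) ⊎ (identity (suc i) ∧ ω) (inside ∷ t) ≈ - ω (inside ∷ s)
    flip-sign (inj₁ eq) = inj₂ (trans step (-‿cong eq))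
    flip-sign (inj₂ eq) = inj₁ (trans step (trans (-‿cong eq) (-‿involutive _)))

-- Star fields as an abstraction of ℂ

-- The features of ℂ that the argument uses.  NonNeg holds of the nonnegative
-- reals.  That every element is zero or invertible holds only up to double
-- negation, which suffices as NonNeg is stable.
record StarField c ℓ : Set (lsuc (c ⊔ ℓ)) where
  field
    commutativeRing : CommutativeRing c ℓ
  open CommutativeRing commutativeRing
  field
    conj            : Carrier → Carrier
    conj-cong       : ∀ {x y} → x ≈ y → conj x ≈ conj y
    conj-+          : ∀ x y → conj (x + y) ≈ conj x + conj y
    conj-*          : ∀ x y → conj (x * y) ≈ conj x * conj y
    conj-involutive : ∀ x → conj (conj x) ≈ x
    NonNeg          : Carrier → Set ℓ
    NonNeg-resp     : ∀ {x y} → x ≈ y → NonNeg x → NonNeg y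
    NonNeg-+        : ∀ {x y} → NonNeg x → NonNeg y → NonNeg (x + y)
    NonNeg-norm     : ∀ x → NonNeg (conj x * x)
    NonNeg-real     : ∀ {x} → NonNeg x → conj x ≈ x
    NonNeg-antisym  : ∀ {x y} → NonNeg x → NonNeg y → x + y ≈ 0# → x ≈ 0#
    NonNeg-stable   : ∀ {x} → ¬ ¬ NonNeg x → NonNeg x
    NonNeg-sqrt     : ∀ {x} → NonNeg x → ∃ λ s → conj s ≈ s × s * s ≈ x
    norm-zero       : ∀ {x} → conj x * x ≈ 0# → x ≈ 0#
    zero∨unit       : ∀ x → ¬ ¬ (x ≈ 0# ⊎ ∃ λ y → x * y ≈ 1#)
    1≉0             : ¬ 1# ≈ 0#

module StarFieldProperties {c ℓ} (K : StarField c ℓ) where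

  open StarField K
  open CommutativeRing commutativeRing hiding (zero)
  open RingProperties ring
  open SemiringSum semiring
  open RawSemiringDefs (Semiring.rawSemiring semiring) using (_^_; product)
  open IntegerSolver commutativeRing
  open Exterior commutativeRing
  open Matrices rawRing using (Matrix; det; scalar; charPoly; AreEigenvalues)
  open import Relation.Binary.Reasoning.Setoid setoid

  Unit : Carrier → Set (c ⊔ ℓ)
  Unit x = ∃ λ y → x * y ≈ 1#

  unit≉0 : ∀ {x} → Unit x → ¬ x ≈ 0#
  unit≉0 (y , xy≈1) x≈0 = 1≉0 (trans (sym xy≈1) (trans (*-congʳ x≈0) (zeroˡ y)))

  Unit-resp : ∀ {x y} → x ≈ y → Unit x → Unit y
  Unit-resp x≈y (z , xz≈1) = z , trans (*-congʳ (sym x≈y)) xz≈1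

  Unit-neg : ∀ {x} → Unit x → Unit (- x)
  Unit-neg {x} (y , xy≈1) = - y , trans (solve 2 (λ x y → :- x :* :- y := x :* y) refl x y) xy≈1

  Unit-* : ∀ {x y} → Unit x → Unit y → Unit (x * y)
  Unit-* {x} {y} (x′ , p) (y′ , q) = x′ * y′ , trans
    (solve 4 (λ x y u v → x :* y :* (u :* v) := (x :* u) :* (y :* v)) refl x y x′ y′)
    (trans (*-cong p q) (*-identityˡ 1#))

  unit-cancel : ∀ {x y} → Unit x → x * y ≈ 0# → y ≈ 0#
  unit-cancel {x} {y} (z , xz≈1) xy≈0 = begin
    y            ≈⟨ *-identityˡ y ⟨
    1# * y       ≈⟨ *-congʳ xz≈1 ⟨
    x * z * y    ≈⟨ solve 3 (λ x y z → x :* z :* y := z :* (x :* y)) refl x y z ⟩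
    z * (x * y)  ≈⟨ trans (*-congˡ xy≈0) (zeroʳ z) ⟩
    0#           ∎

  conj-0 : conj 0# ≈ 0#
  conj-0 = x+x≈x⇒x≈0 (conj 0#) (trans (sym (conj-+ 0# 0#)) (conj-cong (+-identityˡ 0#)))

  conj-neg : ∀ x → conj (- x) ≈ - conj x
  conj-neg x = +-inverseˡ-unique (conj (- x)) (conj x)
    (trans (sym (conj-+ (- x) x)) (trans (conj-cong (-‿inverseˡ x)) conj-0))

  conj-1 : conj 1# ≈ 1#
  conj-1 = begin
    conj 1#                 ≈⟨ *-identityʳ _ ⟨
    conj 1# * 1#            ≈⟨ *-congˡ (conj-involutive 1#) ⟨
    conj 1# * conj (conj 1#) ≈⟨ conj-* 1# (conj 1#) ⟨
    conj (1# * conj 1#)     ≈⟨ conj-cong (*-identityˡ _) ⟩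
    conj (conj 1#)          ≈⟨ conj-involutive 1# ⟩
    1#                      ∎

  Unit-conj : ∀ {x} → Unit x → Unit (conj x)
  Unit-conj (y , xy≈1) = conj y , trans (sym (conj-* _ y)) (trans (conj-cong xy≈1) conj-1)

  NonNeg-0 : NonNeg 0#
  NonNeg-0 = NonNeg-resp (zeroʳ _) (NonNeg-norm 0#)

  NonNeg-1 : NonNeg 1#
  NonNeg-1 = NonNeg-resp (trans (*-identityʳ _) conj-1) (NonNeg-norm 1#)

  NonNeg-sum : ∀ n {f : Vector Carrier n} → (∀ i → NonNeg (f i)) → NonNeg (sum f)
  NonNeg-sum zero    h = NonNeg-0
  NonNeg-sum (suc n) h = NonNeg-+ (h zero) (NonNeg-sum n (h ∘ suc))

  NonNeg-sum-zero : ∀ n {f : Vector Carrier n} → (∀ i → NonNeg (f i)) → sum f ≈ 0# → ∀ i → f i ≈ 0#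
  NonNeg-sum-zero (suc n) h eq zero    = NonNeg-antisym (h zero) (NonNeg-sum n (h ∘ suc)) eq
  NonNeg-sum-zero (suc n) h eq (suc i) = NonNeg-sum-zero n (h ∘ suc)
    (NonNeg-antisym (NonNeg-sum n (h ∘ suc)) (h zero) (trans (+-comm _ _) eq)) i

  -- This is characteristic zero in the form used below: it makes 2 invertible, as well as the
  -- differences y - z₁ at the points y where two polynomial functions are compared.
  1+NonNeg-unit : ∀ {x} → NonNeg x → ¬ ¬ Unit (1# + x)
  1+NonNeg-unit nn k = zero∨unit _ λ where
    (inj₁ eq) → 1≉0 (NonNeg-antisym NonNeg-1 nn eq)
    (inj₂ u)  → k u

  -- The norm of x - y is nonnegative, and if its negative is nonnegative as well, it is zero.
  -- Stability of equality is thus inherited from stability of `NonNeg`.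
  ≈-stable : ∀ {x y} → ¬ ¬ x ≈ y → x ≈ y
  ≈-stable {x} {y} ¬¬x≈y = x∙y⁻¹≈ε⇒x≈y x y (norm-zero
    (NonNeg-antisym (NonNeg-norm (x - y)) nonpos (-‿inverseʳ _)))
    where
    nonpos : NonNeg (- (conj (x - y) * (x - y)))
    nonpos = NonNeg-stable λ k → ¬¬x≈y λ x≈y → k (NonNeg-resp
      (sym (trans (-‿cong (trans (*-congˡ (x≈y⇒x∙y⁻¹≈ε x≈y)) (zeroʳ _))) -0#≈0#)) NonNeg-0)

  -- Kernel vectors of singular matrices

  Λ-zero∨unit : ∀ {n} (ω : Λ n) → ¬ ¬ ((∀ s → ω s ≈ 0#) ⊎ ∃ λ s → Unit (ω s))
  Λ-zero∨unit {zero} ω k = zero∨unit (ω []) λ where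
    (inj₁ eq) → k (inj₁ λ where [] → eq)
    (inj₂ u)  → k (inj₂ ([] , u))
  Λ-zero∨unit {suc n} ω k = Λ-zero∨unit (ω ∘ (outside ∷_)) λ where
    (inj₂ (s , u)) → k (inj₂ (outside ∷ s , u))
    (inj₁ eq₀)     → Λ-zero∨unit (ω ∘ (inside ∷_)) λ where
      (inj₂ (s , u)) → k (inj₂ (inside ∷ s , u))
      (inj₁ eq₁)     → k (inj₁ λ where
        (outside ∷ s) → eq₀ s
        (inside ∷ s)  → eq₁ s)

  unit-⊥ : ∀ n → unit (⊥ {n}) ≈ 1#
  unit-⊥ zero    = refl
  unit-⊥ (suc n) = unit-⊥ n

  -- ω is the wedge of a maximal independent subfamily of r.
  record Annihilated {k n} (r : Fin k → Vector Carrier n) : Set (c ⊔ ℓ) where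
    field
      degree      : ℕ
      ω           : Λ n
      homogeneous : Homogeneous degree ω
      nonzero     : ∃ λ s → Unit (ω s)
      annihilated : ∀ i → (r i ∧ ω) ≋ λ _ → 0#
      full        : degree ℕ.< k ⊎ degree ≡ k × ω ≋ wedge r

  -- Greedy choice from the last row upwards: a row joins the subfamily if its wedge with the
  -- current ω is nonzero, and otherwise already annihilates ω. Rows accepted earlier keep
  -- annihilating by anticommutativity. The only decision needed is a zero test, available under
  -- double negation.
  annihilator : ∀ {k n} (r : Fin k → Vector Carrier n) → ¬ ¬ Annihilated r
  annihilator {zero} {n} r ¬A = ¬A record
    { degree = 0
    ; ω = unit
    ; homogeneous = unit-homogeneous
    ; nonzero = ⊥ , 1# , trans (*-identityʳ _) (unit-⊥ n)
    ; annihilated = λ ()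
    ; full = inj₂ (≡.refl , λ _ → refl)
    }
  annihilator {suc k} r ¬A = annihilator (tail r) λ A → let open Annihilated A in
    Λ-zero∨unit (r zero ∧ ω) λ where
      (inj₁ eq) → ¬A record
        { degree = degree
        ; ω = ω
        ; homogeneous = homogeneous
        ; nonzero = nonzero
        ; annihilated = λ { zero → eq ; (suc i) → annihilated i }
        ; full = inj₁ (degree≤ full)
        }
      (inj₂ nz) → ¬A record
        { degree = suc degree
        ; ω = r zero ∧ ω
        ; homogeneous = ∧-homogeneous (r zero) homogeneous
        ; nonzero = nz
        ; annihilated = λ
            { zero    → ∧-alternating (r zero) ω
            ; (suc i) → λ s → trans (∧-anticomm (r (suc i)) (r zero) ω s)
                (trans (-‿cong (∧-zeroʳ (r zero) (annihilated i) s)) -0#≈0#) }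
        ; full = full-suc full
        }
    where
    degree≤ : ∀ {d} {P : Set ℓ} → d ℕ.< k ⊎ d ≡ k × P → d ℕ.< suc k
    degree≤ (inj₁ d<k)          = ℕ.m<n⇒m<1+n d<k
    degree≤ (inj₂ (≡.refl , _)) = ℕ.n<1+n k
    full-suc : ∀ {d η} → d ℕ.< k ⊎ d ≡ k × η ≋ wedge (tail r) →
      suc d ℕ.< suc k ⊎ suc d ≡ suc k × (r zero ∧ η) ≋ wedge r
    full-suc (inj₁ d<k)         = inj₁ (ℕ.s<s d<k)
    full-suc (inj₂ (d≡k , η≋)) = inj₂ (≡.cong suc d≡k , ∧-cong (λ _ → refl) η≋)

  -- With ω_s invertible and t = s ∪ {i}, the linear form v ↦ (v ∧ ω)_t vanishes on
  -- the rows but not at the basis vector eᵢ; x lists its coefficients.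
  det-zero⇒kernel : ∀ {n} (M : Matrix n) → det M ≈ 0# →
    ¬ ¬ ∃ λ x → (∃ λ i → Unit (x i)) × ∀ i → sum (λ j → M i j * x j) ≈ 0#
  det-zero⇒kernel {n} M det≈0 ¬∃ = annihilator M λ A → let open Annihilated A in
    let s , u     = nonzero
        i , t , e = ∧-basis ω s λ { ≡.refl → unit≉0 u (top≈0 homogeneous full) }
    in ¬∃ ( (λ j → (identity j ∧ ω) t)
          , (i , ± u e)
          , λ k → trans (sym (∧-expand (M k) ω t)) (annihilated k t))
    where
    -- This is where singularity enters: a proper subfamily gives a degree below n and hence no top
    -- coordinate, while for the whole family the top coordinate is det M. So the invertible
    -- coordinate s omits a basis vector.
    top≈0 : ∀ {d ω} → Homogeneous d ω → d ℕ.< n ⊎ d ≡ n × ω ≋ wedge M → ω ⊤ ≈ 0#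
    top≈0 h (inj₁ d<n) = h ⊤ λ eq → ℕ.<⇒≢ d<n (≡.trans (≡.sym eq) (∣⊤∣≡n n))
    top≈0 h (inj₂ (_ , ω≋)) = trans (ω≋ ⊤) (trans (sym (det≈wedge M)) det≈0)
    ± : ∀ {x y} → Unit y → x ≈ y ⊎ x ≈ - y → Unit x
    ± u (inj₁ eq) = Unit-resp (sym eq) u
    ± u (inj₂ eq) = Unit-resp (sym eq) (Unit-neg u)

  -- Polynomial functions through iterated differences

  Δ : (Carrier → Carrier) → Carrier → Carrier
  Δ f x = f (x + 1#) - f x

  -- The d-th iterated difference of f vanishes, as it does for polynomials of
  -- degree less than d.
  Degree< : ℕ → (Carrier → Carrier) → Set (c ⊔ ℓ)
  Degree< zero    f = ∀ x → f x ≈ 0#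
  Degree< (suc d) f = Degree< d (Δ f)

  Degree<-resp : ∀ d {f g} → (∀ x → f x ≈ g x) → Degree< d f → Degree< d g
  Degree<-resp zero    p h x = trans (sym (p x)) (h x)
  Degree<-resp (suc d) p h   = Degree<-resp d (λ x → minus-cong (p (x + 1#)) (p x)) h

  Degree<-suc : ∀ d {f} → Degree< d f → Degree< (suc d) f
  Degree<-suc zero    h x = trans (minus-cong (h _) (h x)) (-‿inverseʳ 0#)
  Degree<-suc (suc d) h   = Degree<-suc d h

  Degree<-mono : ∀ d e {f} → Degree< d f → Degree< (e ℕ.+ d) f
  Degree<-mono d zero    h = h
  Degree<-mono d (suc e) h = Degree<-suc (e ℕ.+ d) (Degree<-mono d e h)

  Degree<-shift : ∀ d {f} → Degree< d f → Degree< d (λ x → f (x + 1#))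
  Degree<-shift zero    h x = h _
  Degree<-shift (suc d) h   = Degree<-shift d h

  Degree<-+ : ∀ d {f g} → Degree< d f → Degree< d g → Degree< d (λ x → f x + g x)
  Degree<-+ zero    hf hg x = trans (+-cong (hf x) (hg x)) (+-identityˡ 0#)
  Degree<-+ (suc d) hf hg   = Degree<-resp d
    (λ x → solve 4 (λ a b c d → (a :- b) :+ (c :- d) := (a :+ c) :- (b :+ d)) refl _ _ _ _)
    (Degree<-+ d hf hg)

  Degree<-zero : ∀ d {f} → (∀ x → f x ≈ 0#) → Degree< d f
  Degree<-zero zero    h = h
  Degree<-zero (suc d) h = Degree<-suc d (Degree<-zero d h)

  -- Induction by the discrete Leibniz rule Δ(fg)(x) = Δf(x) g(x + 1) + f(x) Δg(x). The bound is not
  -- sharp, but only the existence of some bound matters.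
  Degree<-* : ∀ d e {f g} → Degree< d f → Degree< e g → Degree< (d ℕ.+ e) (λ x → f x * g x)
  Degree<-* zero e hf hg = Degree<-zero e λ x → trans (*-congʳ (hf x)) (zeroˡ _)
  Degree<-* (suc d) zero hf hg = Degree<-zero (suc d ℕ.+ 0) λ x → trans (*-congˡ (hg x)) (zeroʳ _)
  Degree<-* (suc d) (suc e) {f} {g} hf hg = Degree<-resp (d ℕ.+ suc e)
    (λ x → solve 4 (λ a b c d → (a :- b) :* c :+ b :* (c :- d) := a :* c :- b :* d) refl
      (f (x + 1#)) (f x) (g (x + 1#)) (g x))
    (Degree<-+ (d ℕ.+ suc e)
      (Degree<-* d (suc e) hf (Degree<-shift (suc e) hg))
      (≡.subst (λ m → Degree< m (λ x → f x * Δ g x)) (≡.sym (ℕ.+-suc d e)) (Degree<-* (suc d) e hf hg)))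

  -- Differences are preferred to coefficients because closure under sums and products is then
  -- enough to cover determinants, and because `vanish` can use them directly.
  Polynomial : (Carrier → Carrier) → Set (c ⊔ ℓ)
  Polynomial f = ∃ λ d → Degree< d f

  poly-const : ∀ a → Polynomial (λ _ → a)
  poly-const a = 1 , λ _ → -‿inverseʳ a

  poly-id : Polynomial (λ x → x)
  poly-id = 2 , λ x → trans (solve 2 (λ x o → ((x :+ o) :+ o :- (x :+ o)) :- ((x :+ o) :- x) := o :- o) refl x 1#)
    (-‿inverseʳ 1#)

  poly-+ : ∀ {f g} → Polynomial f → Polynomial g → Polynomial (λ x → f x + g x)
  poly-+ {g = g} (d , hf) (e , hg) = e ℕ.+ d , Degree<-+ (e ℕ.+ d)
    (Degree<-mono d e hf)
    (≡.subst (λ m → Degree< m g) (ℕ.+-comm d e) (Degree<-mono e d hg))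

  poly-* : ∀ {f g} → Polynomial f → Polynomial g → Polynomial (λ x → f x * g x)
  poly-* (d , hf) (e , hg) = d ℕ.+ e , Degree<-* d e hf hg

  poly-minus : ∀ {f g} → Polynomial f → Polynomial g → Polynomial (λ x → f x - g x)
  poly-minus pf pg with poly-+ pf (poly-* (poly-const (- 1#)) pg)
  ... | d , h = d , Degree<-resp d (λ x → +-congˡ (-1*x≈-x _)) h

  poly-sum : ∀ n {f : Carrier → Vector Carrier n} → (∀ i → Polynomial (λ x → f x i)) →
    Polynomial (λ x → sum (f x))
  poly-sum zero    h = poly-const 0#
  poly-sum (suc n) h = poly-+ (h zero) (poly-sum n (h ∘ suc))

  poly-product : ∀ n {f : Carrier → Vector Carrier n} → (∀ i → Polynomial (λ x → f x i)) →
    Polynomial (λ x → product (f x))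
  poly-product zero    h = poly-const 1#
  poly-product (suc n) h = poly-* (h zero) (poly-product n (h ∘ suc))

  poly-det : ∀ n {M : Carrier → Matrix n} → (∀ i j → Polynomial (λ x → M x i j)) →
    Polynomial (λ x → det (M x))
  poly-det zero    h = poly-const 1#
  poly-det (suc n) h = poly-sum (suc n) λ j →
    poly-* (poly-const ((- 1#) ^ toℕ j)) (poly-* (h zero j) (poly-det n λ i k → h (suc i) (punchIn j k)))

  poly-charPoly : ∀ {n} (M : Matrix n) → Polynomial (charPoly M)
  poly-charPoly {n} M = poly-det n λ i j → poly-+ (poly-scalar i j) (poly-const (- M i j))
    where
    poly-scalar : ∀ (i j : Fin n) → Polynomial (λ x → scalar x i j)
    poly-scalar i j with i Fin.≟ j
    ... | yes _ = poly-id
    ... | no  _ = poly-const 0#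

  -- Extrapolation one step backwards: the zeros in P are closed under adding 1, so Δf vanishes on P
  -- too; by induction it vanishes at x, whence f x = f (x + 1) = 0. The point x itself may lie
  -- outside P.
  vanish : ∀ d {f} → Degree< d f → (P : Carrier → Set ℓ) → (∀ {x} → P x → P (x + 1#)) →
    (∀ {x} → P x → f x ≈ 0#) → ∀ x → P (x + 1#) → f x ≈ 0#
  vanish zero    h P step f≈0 x px = h x
  vanish (suc d) {f} h P step f≈0 x px = begin
    f x             ≈⟨ x∙y⁻¹≈ε⇒x≈y (f (x + 1#)) (f x) Δf≈0 ⟨
    f (x + 1#)      ≈⟨ f≈0 px ⟩
    0#              ∎
    where
    Δf≈0 : Δ f x ≈ 0#
    Δf≈0 = vanish d h P step (λ py → trans (minus-cong (f≈0 (step py)) (f≈0 py)) (-‿inverseʳ 0#)) x px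

  -- Away from z the factor x - z is invertible and can be cancelled. At z the difference f - g is
  -- zero by extrapolation from points further along, where cancellation is possible.
  cancel-root : ∀ {f g} z → Polynomial f → Polynomial g →
    (∀ x → (x - z) * f x ≈ (x - z) * g x) → ∀ x → f x ≈ g x
  cancel-root {f} {g} z pf pg eq x = ≈-stable λ k → zero∨unit (x - z) λ where
      (inj₂ u)   → k (x∙y⁻¹≈ε⇒x≈y _ _ (unit-cancel u (root x)))
      (inj₁ x≈z) → k (x∙y⁻¹≈ε⇒x≈y _ _ (at-root x≈z (poly-minus pf pg)))
    where
    root : ∀ y → (y - z) * (f y - g y) ≈ 0#
    root y = trans (x[y-z]≈xy-xz _ _ _) (x≈y⇒x∙y⁻¹≈ε (eq y))
    -- The difference vanishes at x + 1, x + 2, ….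
    at-root : x - z ≈ 0# → Polynomial (λ y → f y - g y) → f x - g x ≈ 0#
    -- Nonnegativity of y - (x + 1) describes a set that contains x + 1, is closed under adding 1,
    -- and makes y - z = 1 + (y - (x + 1)) invertible when x = z.
    at-root x≈z (d , h) = vanish d h (λ y → NonNeg (y - (x + 1#)))
      (λ {y} p → NonNeg-resp (solve 3 (λ y x o → o :+ (y :- (x :+ o)) := y :+ o :- (x :+ o)) refl y x 1#)
        (NonNeg-+ NonNeg-1 p))
      (λ {y} p → ≈-stable λ k → 1+NonNeg-unit p λ u → k (unit-cancel (Unit-resp (shift y) u) (root y)))
      x (NonNeg-resp (sym (-‿inverseʳ _)) NonNeg-0)
      where
      shift : ∀ y → 1# + (y - (x + 1#)) ≈ y - z
      shift y = begin
        1# + (y - (x + 1#))          ≈⟨ +-identityʳ _ ⟨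
        1# + (y - (x + 1#)) + 0#     ≈⟨ +-congˡ x≈z ⟨
        1# + (y - (x + 1#)) + (x - z)
          ≈⟨ solve 4 (λ o y x z → o :+ (y :- (x :+ o)) :+ (x :- z) := y :- z) refl 1# y x z ⟩
        y - z  ∎

-- Matrix algebra over a star field

module Schur {c ℓ} (K : StarField c ℓ) where

  open StarField K
  open StarFieldProperties K
  open CommutativeRing commutativeRing hiding (zero)
  open RingProperties ring
  open SemiringSum semiring
  open RawSemiringDefs (Semiring.rawSemiring semiring) using (product)
  open IntegerSolver commutativeRing
  open Exterior commutativeRing
  open Matrices rawRing using (Matrix; det; scalar; charPoly; AreEigenvalues)
  open SetoidReasoning setoid

  infix 4 _≐_
  _≐_ : ∀ {n} → Matrix n → Matrix n → Set ℓ
  A ≐ B = ∀ i j → A i j ≈ B i j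

  matrixSetoid : ℕ → Setoid c ℓ
  matrixSetoid n = record
    { Carrier = Matrix n
    ; _≈_ = _≐_
    ; isEquivalence = record
      { refl = λ i j → refl
      ; sym = λ p i j → sym (p i j)
      ; trans = λ p q i j → trans (p i j) (q i j)
      }
    }

  infixl 6 _⊞_
  _⊞_ : ∀ {n} → Matrix n → Matrix n → Matrix n
  (A ⊞ B) i j = A i j + B i j

  adjoint : ∀ {n} → Matrix n → Matrix n
  adjoint A i j = conj (A j i)

  trace : ∀ {n} → Matrix n → Carrier
  trace A = sum λ i → A i i

  ⊛-cong : ∀ {n} {A B C D : Matrix n} → A ≐ B → C ≐ D → A ⊛ C ≐ B ⊛ D
  ⊛-cong {n} p q i j = sum-cong n λ k → *-cong (p i k) (q k j)

  ⊛-assoc : ∀ {n} (A B C : Matrix n) → (A ⊛ B) ⊛ C ≐ A ⊛ (B ⊛ C)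
  ⊛-assoc {n} A B C i j = begin
    sum (λ k → sum (λ l → A i l * B l k) * C k j)
      ≈⟨ sum-cong n (λ k → *-distribʳ-sum {n} (C k j) (λ l → A i l * B l k)) ⟩
    sum (λ k → sum λ l → A i l * B l k * C k j)
      ≈⟨ ∑-comm {n} {n} (λ k l → A i l * B l k * C k j) ⟩
    sum (λ l → sum λ k → A i l * B l k * C k j)
      ≈⟨ sum-cong n (λ l → trans (sum-cong n λ k → *-assoc (A i l) (B l k) (C k j))
           (sym (*-distribˡ-sum {n} (A i l) λ k → B l k * C k j))) ⟩
    sum (λ l → A i l * sum λ k → B l k * C k j)  ∎

  ⊛-identityʳ : ∀ {n} (A : Matrix n) → A ⊛ identity ≐ A
  ⊛-identityʳ A i = combine-identity (A i)

  identity-sym : ∀ {n} (i j : Fin n) → identity i j ≈ identity j i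
  identity-sym i j with i Fin.≟ j | j Fin.≟ i
  ... | yes _   | yes _   = refl
  ... | no  _   | no  _   = refl
  ... | yes i≡j | no j≢i  = contradiction (≡.sym i≡j) j≢i
  ... | no i≢j  | yes j≡i = contradiction (≡.sym j≡i) i≢j

  conj-identity : ∀ {n} (i j : Fin n) → conj (identity i j) ≈ identity i j
  conj-identity i j with i Fin.≟ j
  ... | yes _ = conj-1
  ... | no  _ = conj-0

  identity-apply : ∀ {n} (v : Vector Carrier n) i → sum (λ k → identity i k * v k) ≈ v i
  identity-apply {n} v i = trans
    (sum-cong n λ k → trans (*-comm _ _) (*-congˡ (identity-sym i k))) (combine-identity v i)

  ⊛-identityˡ : ∀ {n} (A : Matrix n) → identity ⊛ A ≐ A
  ⊛-identityˡ A i j = identity-apply (λ k → A k j) i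

  scalar-identity : ∀ {n} x (i j : Fin n) → scalar x i j ≈ x * identity i j
  scalar-identity x i j with i Fin.≟ j
  ... | yes _ = sym (*-identityʳ x)
  ... | no  _ = sym (zeroʳ x)

  trace-cong : ∀ {n} {A B : Matrix n} → A ≐ B → trace A ≈ trace B
  trace-cong {n} p = sum-cong n λ i → p i i

  trace-⊛ : ∀ {n} (A B : Matrix n) → trace (A ⊛ B) ≈ trace (B ⊛ A)
  trace-⊛ {n} A B = trans (∑-comm {n} {n} (λ i k → A i k * B k i))
    (sum-cong n λ k → sum-cong n λ i → *-comm (A i k) (B k i))

  conj-sum : ∀ n (f : Vector Carrier n) → conj (sum f) ≈ sum (conj ∘ f)
  conj-sum zero    f = conj-0
  conj-sum (suc n) f = trans (conj-+ _ _) (+-congˡ (conj-sum n (tail f)))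

  adjoint-⊛ : ∀ {n} (A B : Matrix n) → adjoint (A ⊛ B) ≐ adjoint B ⊛ adjoint A
  adjoint-⊛ {n} A B i j = trans (conj-sum n _)
    (sum-cong n λ k → trans (conj-* (A j k) (B k i)) (*-comm _ _))

  sum-minus-scale : ∀ n x (f g : Vector Carrier n) → sum (λ i → f i - x * g i) ≈ sum f - x * sum g
  sum-minus-scale zero    x f g = sym (trans (minus-cong refl (zeroʳ x)) (-‿inverseʳ 0#))
  sum-minus-scale (suc n) x f g = trans (+-congˡ (sum-minus-scale n x (tail f) (tail g)))
    (solve 5 (λ x a b p q → (a :- x :* b) :+ (p :- x :* q) := (a :+ p) :- x :* (b :+ q)) refl x _ _ _ _)

  -- Similarity by unitary reflections

  -- The two conditions make H unitary with H itself as adjoint and inverse, so HAH is a unitary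
  -- similarity of A.
  record Reflection {n} (H : Matrix n) : Set ℓ where
    field
      hermitian  : adjoint H ≐ H
      involutive : H ⊛ H ≐ identity

  conjugate : ∀ {n} → Matrix n → Matrix n → Matrix n
  conjugate H A = (H ⊛ A) ⊛ H

  -- The squared Frobenius norm of A + A*, that is 4‖H‖² for the Hermitian part H.
  hermitianNorm : ∀ {n} → Matrix n → Carrier
  hermitianNorm A = trace ((A ⊞ adjoint A) ⊛ (A ⊞ adjoint A))

  module _ {n} {H : Matrix n} (R : Reflection H) where

    open Reflection R

    cancelˡ : ∀ A → H ⊛ (H ⊛ A) ≐ A
    cancelˡ A = M.begin
      H ⊛ (H ⊛ A)       M.≈⟨ ⊛-assoc H H A ⟨
      (H ⊛ H) ⊛ A       M.≈⟨ ⊛-cong {A = H ⊛ H} involutive (λ _ _ → refl) ⟩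
      identity ⊛ A      M.≈⟨ ⊛-identityˡ A ⟩
      A                 M.∎
      where module M = SetoidReasoning (matrixSetoid n)

    adjoint-conjugate : ∀ A → adjoint (conjugate H A) ≐ conjugate H (adjoint A)
    adjoint-conjugate A = M.begin
      adjoint ((H ⊛ A) ⊛ H)                M.≈⟨ adjoint-⊛ (H ⊛ A) H ⟩
      adjoint H ⊛ adjoint (H ⊛ A)          M.≈⟨ ⊛-cong hermitian (adjoint-⊛ H A) ⟩
      H ⊛ (adjoint A ⊛ adjoint H)          M.≈⟨ ⊛-cong {A = H} (λ _ _ → refl)
                                                  (⊛-cong {A = adjoint A} (λ _ _ → refl) hermitian) ⟩
      H ⊛ (adjoint A ⊛ H)                  M.≈⟨ ⊛-assoc H (adjoint A) H ⟨
      conjugate H (adjoint A)              M.∎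
      where module M = SetoidReasoning (matrixSetoid n)

    conjugate-⊞ : ∀ A B → conjugate H (A ⊞ B) ≐ conjugate H A ⊞ conjugate H B
    conjugate-⊞ A B i j = trans
      (sum-cong n λ k → trans
        (*-congʳ {H k j} (trans (sum-cong n λ l → distribˡ (H i l) (A l k) (B l k)) (∑-distrib-+ {n} _ _)))
        (distribʳ (H k j) ((H ⊛ A) i k) ((H ⊛ B) i k)))
      (∑-distrib-+ {n} (λ k → (H ⊛ A) i k * H k j) (λ k → (H ⊛ B) i k * H k j))

    conjugate-⊛ : ∀ A B → conjugate H A ⊛ conjugate H B ≐ conjugate H (A ⊛ B)
    conjugate-⊛ A B = M.begin
      ((H ⊛ A) ⊛ H) ⊛ ((H ⊛ B) ⊛ H)     M.≈⟨ ⊛-assoc (H ⊛ A) H _ ⟩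
      (H ⊛ A) ⊛ (H ⊛ ((H ⊛ B) ⊛ H))     M.≈⟨ ⊛-cong {A = H ⊛ A} (λ _ _ → refl)
                                              (⊛-cong {A = H} (λ _ _ → refl) (⊛-assoc H B H)) ⟩
      (H ⊛ A) ⊛ (H ⊛ (H ⊛ (B ⊛ H)))     M.≈⟨ ⊛-cong {A = H ⊛ A} (λ _ _ → refl) (cancelˡ (B ⊛ H)) ⟩
      (H ⊛ A) ⊛ (B ⊛ H)                 M.≈⟨ ⊛-assoc (H ⊛ A) B H ⟨
      ((H ⊛ A) ⊛ B) ⊛ H                 M.≈⟨ ⊛-cong {C = H} (⊛-assoc H A B) (λ _ _ → refl) ⟩
      conjugate H (A ⊛ B)               M.∎
      where module M = SetoidReasoning (matrixSetoid n)

    trace-conjugate : ∀ A → trace (conjugate H A) ≈ trace A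
    trace-conjugate A = trans (trace-⊛ (H ⊛ A) H) (trace-cong {n} (cancelˡ A))

    hermitianNorm-conjugate : ∀ A → hermitianNorm (conjugate H A) ≈ hermitianNorm A
    hermitianNorm-conjugate A = trans
      (trace-cong {n} (M.begin
        T ⊛ T                                          M.≈⟨ ⊛-cong {A = T} T≐ T≐ ⟩
        conjugate H (A ⊞ adjoint A) ⊛ conjugate H (A ⊞ adjoint A)
          M.≈⟨ conjugate-⊛ (A ⊞ adjoint A) (A ⊞ adjoint A) ⟩
        conjugate H ((A ⊞ adjoint A) ⊛ (A ⊞ adjoint A))  M.∎))
      (trace-conjugate _)
      where
      module M = SetoidReasoning (matrixSetoid n)
      T : Matrix n
      T = conjugate H A ⊞ adjoint (conjugate H A)
      T≐ : T ≐ conjugate H (A ⊞ adjoint A)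
      T≐ i j = trans (+-congˡ (adjoint-conjugate A i j)) (sym (conjugate-⊞ A (adjoint A) i j))

    characteristic : Matrix n → Carrier → Matrix n
    characteristic A x i j = scalar x i j + - A i j

    conjugate-scalar : ∀ x → conjugate H (scalar x) ≐ scalar x
    conjugate-scalar x i j = begin
      conjugate H (scalar x) i j
        ≈⟨ sum-cong n (λ k → *-congʳ (trans
             (sum-cong n λ l → trans (*-congˡ (scalar-identity x l k))
               (solve 3 (λ h x e → h :* (x :* e) := x :* (h :* e)) refl (H i l) x (identity l k)))
             (trans (sym (*-distribˡ-sum {n} x (λ l → H i l * identity l k)))
               (*-congˡ (⊛-identityʳ H i k))))) ⟩
      sum (λ k → x * H i k * H k j)
        ≈⟨ trans (sum-cong n λ k → *-assoc x (H i k) (H k j)) (sym (*-distribˡ-sum {n} x (λ k → H i k * H k j))) ⟩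
      x * (H ⊛ H) i j   ≈⟨ *-congˡ (involutive i j) ⟩
      x * identity i j  ≈⟨ scalar-identity x i j ⟨
      scalar x i j      ∎

    conjugate-neg : ∀ A → conjugate H (λ i j → - A i j) ≐ λ i j → - conjugate H A i j
    conjugate-neg A i j = trans
      (sum-cong n λ k → trans
        (*-congʳ {H k j} (trans (sum-cong n λ l → sym (-‿distribʳ-* (H i l) (A l k))) (sum-neg n _)))
        (sym (-‿distribˡ-* ((H ⊛ A) i k) (H k j))))
      (sum-neg n λ k → (H ⊛ A) i k * H k j)

    -- Since H² = I, the matrix x I - HAH equals H (x I - A) H, and the two outer factors contribute
    -- (det H)² = det (H²) = 1.
    charPoly-conjugate : ∀ A x → charPoly (conjugate H A) x ≈ charPoly A x
    charPoly-conjugate A x = begin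
      det (characteristic (conjugate H A) x)
        ≈⟨ det-cong {n} (λ i j → sym (trans (conjugate-⊞ (scalar x) (λ i j → - A i j) i j)
             (+-cong (conjugate-scalar x i j) (conjugate-neg A i j)))) ⟩
      det (conjugate H X)
        ≈⟨ trans (det-⊛ (H ⊛ X) H) (*-congʳ (det-⊛ H X)) ⟩
      det H * det X * det H
        ≈⟨ solve 2 (λ h x → h :* x :* h := h :* h :* x) refl (det H) (det X) ⟩
      det H * det H * det X
        ≈⟨ *-congʳ (trans (sym (det-⊛ H H)) (trans (det-cong {n} involutive) (det-identity n))) ⟩
      1# * det X  ≈⟨ *-identityˡ _ ⟩
      det X       ∎
      where
      X : Matrix n
      X = characteristic A x

  -- Householder reflections and normalisation of vectors

  -- The Householder reflection exchanging the unit vector u and e₀; that it does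
  -- so requires u₀ to be real.
  module Householder {n} (u : Vector Carrier (suc n)) (norm1 : sum (λ i → conj (u i) * u i) ≈ 1#)
    (real : conj (u zero) ≈ u zero) (γ : Carrier) (inv : (1# - u zero) * γ ≈ 1#) where

    w : Vector Carrier (suc n)
    w zero    = u zero - 1#
    w (suc i) = u (suc i)

    w₀-real : conj (w zero) ≈ w zero
    w₀-real = trans (conj-+ _ _) (+-cong real (trans (conj-neg 1#) (-‿cong conj-1)))

    -- The usual form is I - (2/‖w‖²) w w* with w = u - e₀. For a unit vector with real u₀ one has
    -- ‖w‖² = 2 (1 - u₀), so the coefficient is γ = 1/(1 - u₀).
    H : Matrix (suc n)
    H i j = identity i j - γ * (w i * conj (w j))

    γ-real : conj γ ≈ γ
    γ-real = x∙y⁻¹≈ε⇒x≈y _ _ (unit-cancel (γ , inv) (trans (x[y-z]≈xy-xz _ _ _) (x≈y⇒x∙y⁻¹≈ε (trans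
      (trans (*-congʳ (sym 1-u₀-real)) (trans (sym (conj-* _ γ)) (trans (conj-cong inv) conj-1)))
      (sym inv)))))
      where
      1-u₀-real : conj (1# - u zero) ≈ 1# - u zero
      1-u₀-real = trans (conj-+ _ _) (+-cong conj-1 (trans (conj-neg _) (-‿cong real)))

    γ-inv : γ * w zero ≈ - 1#
    γ-inv = trans (solve 3 (λ g u o → g :* (u :- o) := :- ((o :- u) :* g)) refl γ (u zero) 1#) (-‿cong inv)

    W : Carrier
    W = sum λ k → conj (w k) * w k

    γW : γ * W ≈ 1# + 1#
    γW = begin
      γ * (conj (w zero) * w zero + r)
        ≈⟨ *-congˡ (+-cong (*-congʳ w₀-real) r≈) ⟩
      γ * (w zero * w zero + (1# - u zero * u zero))
        ≈⟨ solve 3 (λ g u o → g :* ((u :- o) :* (u :- o) :+ (o :- u :* u))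
             := g :* (u :- o) :* (:- o) :+ (g :* (o :- u :* o))) refl γ (u zero) 1# ⟩
      γ * w zero * (- 1#) + γ * (1# - u zero * 1#)
        ≈⟨ +-cong (trans (*-congʳ γ-inv) (trans (-1*x≈-x _) (-‿involutive 1#)))
             (trans (*-comm _ _) (trans (*-congʳ (minus-cong refl (*-identityʳ _))) inv)) ⟩
      1# + 1#  ∎
      where
      r : Carrier
      r = sum λ k → conj (u (suc k)) * u (suc k)
      r≈ : r ≈ 1# - u zero * u zero
      r≈ = trans (solve 2 (λ r a → r := (a :+ r) :- a) refl r (u zero * u zero))
        (minus-cong (trans (+-congʳ (*-congʳ (sym real))) norm1) refl)

    -- Because γ w₀ = -1 and w₀ is real, H e₀ = e₀ - γ w₀ w = e₀ + w = u.
    column₀ : ∀ i → H i zero ≈ u i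
    column₀ zero    = trans (minus-cong refl (trans (*-congˡ (*-congˡ w₀-real)) (trans (sym (*-assoc _ _ _))
      (trans (*-congʳ γ-inv) (-1*x≈-x _)))))
      (trans (+-congˡ (-‿involutive _)) (solve 2 (λ u o → o :+ (u :- o) := u) refl (u zero) 1#))
    column₀ (suc i) = begin
      0# - γ * (u (suc i) * conj (w zero))  ≈⟨ +-identityˡ _ ⟩
      - (γ * (u (suc i) * conj (w zero)))   ≈⟨ -‿cong (*-congˡ (*-congˡ w₀-real)) ⟩
      - (γ * (u (suc i) * w zero))
        ≈⟨ solve 3 (λ g x w → :- (g :* (x :* w)) := g :* w :* :- x) refl γ (u (suc i)) (w zero) ⟩
      γ * w zero * - u (suc i)              ≈⟨ *-congʳ γ-inv ⟩
      - 1# * - u (suc i)                    ≈⟨ trans (-1*x≈-x _) (-‿involutive _) ⟩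
      u (suc i)                             ∎

    -- From γ ‖w‖² = 2 follows H w = w - 2w = -w, and then H² = H - γ (H w) w* = H + γ w w* = I.
    reflection : Reflection H
    reflection = record { hermitian = herm ; involutive = inv′ }
      where
      herm : adjoint H ≐ H
      herm i j = begin
        conj (identity j i - γ * (w j * conj (w i)))
          ≈⟨ trans (conj-+ _ _) (+-congˡ (conj-neg _)) ⟩
        conj (identity j i) - conj (γ * (w j * conj (w i)))
          ≈⟨ minus-cong (trans (conj-identity j i) (identity-sym j i))
               (trans (conj-* _ _) (*-cong γ-real (trans (conj-* _ _)
                 (trans (*-congˡ (conj-involutive _)) (*-comm _ _))))) ⟩
        H i j  ∎
      row-w : ∀ i → sum (λ k → H i k * w k) ≈ - w i
      row-w i = begin
        sum (λ k → H i k * w k)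
          ≈⟨ sum-cong (suc n) (λ k → solve 5 (λ e g a b v → (e :- g :* (a :* b)) :* v := e :* v :- (g :* a) :* (b :* v))
               refl (identity i k) γ (w i) (conj (w k)) (w k)) ⟩
        sum (λ k → identity i k * w k - (γ * w i) * (conj (w k) * w k))
          ≈⟨ sum-minus-scale (suc n) (γ * w i) (λ k → identity i k * w k) (λ k → conj (w k) * w k) ⟩
        sum (λ k → identity i k * w k) - (γ * w i) * W
          ≈⟨ minus-cong (identity-apply w i) (solve 3 (λ g a v → (g :* a) :* v := g :* v :* a) refl γ (w i) W) ⟩
        w i - γ * W * w i
          ≈⟨ minus-cong refl (trans (*-congʳ γW) (trans (distribʳ _ _ _) (+-cong (*-identityˡ _) (*-identityˡ _)))) ⟩
        w i - (w i + w i)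
          ≈⟨ solve 1 (λ x → x :- (x :+ x) := :- x) refl (w i) ⟩
        - w i  ∎
      inv′ : H ⊛ H ≐ identity
      inv′ i j = begin
        sum (λ k → H i k * H k j)
          ≈⟨ sum-cong (suc n) (λ k → solve 5 (λ h e g a b → h :* (e :- g :* (a :* b)) := h :* e :- (g :* b) :* (h :* a))
               refl (H i k) (identity k j) γ (w k) (conj (w j))) ⟩
        sum (λ k → H i k * identity k j - (γ * conj (w j)) * (H i k * w k))
          ≈⟨ sum-minus-scale (suc n) (γ * conj (w j)) (λ k → H i k * identity k j) (λ k → H i k * w k) ⟩
        sum (λ k → H i k * identity k j) - (γ * conj (w j)) * sum (λ k → H i k * w k)
          ≈⟨ minus-cong (⊛-identityʳ H i j) (*-congˡ (row-w i)) ⟩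
        (identity i j - γ * (w i * conj (w j))) - (γ * conj (w j)) * - w i
          ≈⟨ solve 4 (λ e g a b → (e :- g :* (a :* b)) :- (g :* b) :* :- a := e) refl (identity i j) γ (w i) (conj (w j)) ⟩
        identity i j  ∎

  -- These are the inputs of the Householder construction. A unit vector with u₀ = 1 is e₀ itself,
  -- for which w would be zero; `distinct` excludes it and supplies γ.
  record Normalised {n} (u : Vector Carrier (suc n)) : Set (c ⊔ ℓ) where
    field
      norm1    : sum (λ i → conj (u i) * u i) ≈ 1#
      real     : conj (u zero) ≈ u zero
      distinct : Unit (1# - u zero)

  norm-scale : ∀ n t (x : Vector Carrier n) → conj t ≈ t →
    sum (λ i → conj (t * x i) * (t * x i)) ≈ t * t * sum (λ i → conj (x i) * x i)
  norm-scale n t x t-real = trans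
    (sum-cong n λ i → trans (*-congʳ (trans (conj-* t (x i)) (*-congʳ t-real)))
      (solve 3 (λ t a b → t :* a :* (t :* b) := t :* t :* (a :* b)) refl t (conj (x i)) (x i)))
    (sym (*-distribˡ-sum {n} (t * t) (λ i → conj (x i) * x i)))

  1+1-unit : ¬ ¬ Unit (1# + 1#)
  1+1-unit = 1+NonNeg-unit NonNeg-1

  -- The factor t is ±1/‖x‖, with the sign chosen to keep t x₀ away from 1: if the positive sign
  -- makes t x₀ equal to 1, the negative one makes it -1, and its distance from 1 is the unit 2.
  normalise-real : ∀ {n} (x : Vector Carrier (suc n)) → conj (x zero) ≈ x zero → (∃ λ i → Unit (x i)) →
    ¬ ¬ ∃ λ t → Normalised (λ i → t * x i)
  normalise-real {n} x x₀-real (i , xᵢ-unit) ¬∃ = zero∨unit N λ where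
      (inj₁ N≈0)      → unit≉0 xᵢ-unit (norm-zero (NonNeg-sum-zero (suc n) (λ k → NonNeg-norm (x k)) N≈0 i))
      (inj₂ (q , Nq≈1)) → unit-length q Nq≈1
    where
    N : Carrier
    N = sum λ k → conj (x k) * x k
    N≥0 : NonNeg N
    N≥0 = NonNeg-sum (suc n) λ k → NonNeg-norm (x k)
    s : Carrier
    s = proj₁ (NonNeg-sqrt N≥0)
    s-real : conj s ≈ s
    s-real = proj₁ (proj₂ (NonNeg-sqrt N≥0))
    s² : s * s ≈ N
    s² = proj₂ (proj₂ (NonNeg-sqrt N≥0))
    unit-length : ∀ q → N * q ≈ 1# → Empty.⊥
    unit-length q Nq≈1 = zero∨unit (1# - t * x zero) λ where
        (inj₂ d) → ¬∃ (t , record { norm1 = norm1 t t-real t² ; real = real t t-real ; distinct = d })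
        (inj₁ e) → 1+1-unit λ two → ¬∃ (- t , record
          { norm1    = norm1 (- t) -t-real (trans (*-congʳ (solve 1 (λ t → :- t :* :- t := t :* t) refl t)) t²)
          ; real     = real (- t) -t-real
          ; distinct = Unit-resp (opposite e) two })
      where
      t : Carrier
      -- Here q = 1/N and s = √N, so t is 1/√N without inverting the square root.
      t = s * q
      q-real : conj q ≈ q
      q-real = x∙y⁻¹≈ε⇒x≈y _ _ (unit-cancel (q , Nq≈1) (trans (x[y-z]≈xy-xz _ _ _) (x≈y⇒x∙y⁻¹≈ε (trans
        (trans (*-congʳ (sym (NonNeg-real N≥0))) (trans (sym (conj-* N q)) (trans (conj-cong Nq≈1) conj-1)))
        (sym Nq≈1)))))
      t-real : conj t ≈ t
      t-real = trans (conj-* s q) (*-cong s-real q-real)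
      -t-real : conj (- t) ≈ - t
      -t-real = trans (conj-neg t) (-‿cong t-real)
      t² : t * t * N ≈ 1#
      t² = begin
        s * q * (s * q) * N      ≈⟨ solve 3 (λ s q n → s :* q :* (s :* q) :* n := s :* s :* q :* (n :* q)) refl s q N ⟩
        s * s * q * (N * q)      ≈⟨ *-cong (*-congʳ s²) Nq≈1 ⟩
        N * q * 1#               ≈⟨ trans (*-identityʳ _) Nq≈1 ⟩
        1#                       ∎
      norm1 : ∀ t → conj t ≈ t → t * t * N ≈ 1# → sum (λ i → conj (t * x i) * (t * x i)) ≈ 1#
      norm1 t t-real t² = trans (norm-scale (suc n) t x t-real) t²
      real : ∀ t → conj t ≈ t → conj (t * x zero) ≈ t * x zero
      real t t-real = trans (conj-* _ _) (*-cong t-real x₀-real)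
      opposite : 1# - t * x zero ≈ 0# → 1# + 1# ≈ 1# - (- t * x zero)
      opposite e = begin
        1# + 1#                            ≈⟨ trans (minus-cong refl e) (trans (+-congˡ -0#≈0#) (+-identityʳ _)) ⟨
        (1# + 1#) - (1# - t * x zero)      ≈⟨ solve 3 (λ o t a → (o :+ o) :- (o :- t :* a) := o :- (:- t :* a)) refl 1# t (x zero) ⟩
        1# - (- t * x zero)                ∎

  -- Multiplying by the conjugate of x₀ turns the first coordinate into |x₀|², which is real. This
  -- would destroy x if x₀ were zero, but in that case the coordinate is real already.
  normalise : ∀ {n} (x : Vector Carrier (suc n)) → (∃ λ i → Unit (x i)) →
    ¬ ¬ ∃ λ t → Normalised (λ i → t * x i)
  normalise {n} x (i , xᵢ-unit) ¬∃ = zero∨unit (x zero) λ where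
      (inj₁ x₀≈0) → normalise-real x (trans (trans (conj-cong x₀≈0) conj-0) (sym x₀≈0)) (i , xᵢ-unit) ¬∃
      (inj₂ u)    → normalise-real (λ k → conj (x zero) * x k) (NonNeg-real (NonNeg-norm (x zero)))
        (i , Unit-* (Unit-conj u) xᵢ-unit)
        λ (t , h) → ¬∃ (t * conj (x zero) , resp (λ k → sym (*-assoc t (conj (x zero)) (x k))) h)
    where
    resp : ∀ {u v : Vector Carrier (suc n)} → (∀ k → u k ≈ v k) → Normalised u → Normalised v
    resp {u} {v} p h = record
      { norm1    = trans (sum-cong (suc n) λ k → *-cong (conj-cong (sym (p k))) (sym (p k))) norm1
      ; real     = trans (conj-cong (sym (p zero))) (trans real (p zero))
      ; distinct = Unit-resp (minus-cong refl (p zero)) distinct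
      }
      where open Normalised h

  -- Deflation and the inequality for the Hermitian part

  -- The reflection is built so that H e₀ = t x. Hence HAH e₀ = H A (t x) = z H (t x) = z H² e₀ = z
  -- e₀.
  deflate : ∀ {n} (A : Matrix (suc n)) z x → (∃ λ i → Unit (x i)) →
    (∀ i → sum (λ j → A i j * x j) ≈ z * x i) →
    ¬ ¬ ∃ λ H → Reflection H × ∀ i → conjugate H A i zero ≈ z * identity i zero
  deflate {n} A z x nz Ax≈zx ¬∃ = normalise x nz λ (t , h) →
    let open Normalised h
        open Householder (λ i → t * x i) norm1 real (proj₁ distinct) (proj₂ distinct)
    in ¬∃ (H , reflection , λ i → begin
      conjugate H A i zero                       ≈⟨ ⊛-assoc H A H i zero ⟩
      sum (λ l → H i l * (A ⊛ H) l zero)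
        ≈⟨ sum-cong (suc n) (λ l → *-congˡ {H i l} (trans
             (sum-cong (suc n) λ k → trans (*-congˡ (column₀ k))
               (solve 3 (λ a t x → a :* (t :* x) := t :* (a :* x)) refl (A l k) t (x k)))
             (trans (sym (*-distribˡ-sum {suc n} t (λ k → A l k * x k)))
             (trans (*-congˡ (Ax≈zx l))
             (trans (solve 3 (λ a t x → t :* (a :* x) := a :* (t :* x)) refl z t (x l))
               (*-congˡ (sym (column₀ l)))))))) ⟩
      sum (λ l → H i l * (z * H l zero))
        ≈⟨ trans (sum-cong (suc n) λ l → solve 3 (λ h z g → h :* (z :* g) := z :* (h :* g)) refl (H i l) z (H l zero))
             (sym (*-distribˡ-sum {suc n} z (λ l → H i l * H l zero))) ⟩
      z * (H ⊛ H) i zero                         ≈⟨ *-congˡ (Reflection.involutive reflection i zero) ⟩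
      z * identity i zero                        ∎)

  minor : ∀ {n} → Matrix (suc n) → Matrix n
  minor A i j = A (suc i) (suc j)

  charPoly-minor : ∀ {n} (A : Matrix (suc n)) z → (∀ i → A i zero ≈ z * identity i zero) → ∀ x →
    charPoly A x ≈ (x - z) * charPoly (minor A) x
  charPoly-minor {n} A z A₀ x = trans
    (det-column (λ i j → scalar x i j + - A i j) (λ i → trans
      (minus-cong refl (trans (A₀ (suc i)) (zeroʳ z))) (-‿inverseʳ 0#)))
    (*-cong (minus-cong refl (trans (A₀ zero) (*-identityʳ z)))
      (det-cong {n} λ i j → +-congʳ (scalar-suc x i j)))

  -- For the self-adjoint T = A + A*, what is left after removing the corner and the minor is the
  -- rest of row 0 and of column 0; each contributes p, the sum of the |T₀ₖ|² with k > 0.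
  hermitianNorm-minor : ∀ {n} (A : Matrix (suc n)) →
    let a = A zero zero + conj (A zero zero) in NonNeg (hermitianNorm A - (a * a + hermitianNorm (minor A)))
  hermitianNorm-minor {n} A = NonNeg-resp (sym eq) (NonNeg-+ p≥0 p≥0)
    where
    T : Matrix (suc n)
    T = A ⊞ adjoint A
    p : Carrier
    p = sum λ k → T zero (suc k) * T (suc k) zero
    p≥0 : NonNeg p
    p≥0 = NonNeg-sum n λ k → NonNeg-resp (*-congʳ (trans (conj-+ _ _)
      (trans (+-comm _ _) (+-congʳ (conj-involutive _))))) (NonNeg-norm (T (suc k) zero))
    eq : hermitianNorm A - (T zero zero * T zero zero + hermitianNorm (minor A)) ≈ p + p
    eq = trans
      (minus-cong (+-congˡ (trans
        (∑-distrib-+ {n} (λ i → T (suc i) zero * T zero (suc i)) (λ i → sum λ k → T (suc i) (suc k) * T (suc k) (suc i)))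
        (+-congʳ (sum-cong n λ k → *-comm (T (suc k) zero) (T zero (suc k)))))) refl)
      (solve 3 (λ t p q → ((t :+ p) :+ (p :+ q)) :- (t :+ q) := p :+ p) refl (T zero zero * T zero zero) p (hermitianNorm (minor A)))

  -- As z + z̄ = 2 Re z, each summand is 4 (Re z)², which matches the factor 4 in `hermitianNorm`.
  schur : ∀ n (A : Matrix n) z → AreEigenvalues A z →
    NonNeg (hermitianNorm A - sum (λ j → (z j + conj (z j)) * (z j + conj (z j))))
  schur zero    A z eig = NonNeg-resp (sym (-‿inverseʳ 0#)) NonNeg-0
  schur (suc n) A z eig = NonNeg-stable λ ¬nn →
    det-zero⇒kernel (λ i j → scalar z₀ i j + - A i j) singular λ (x , nz , kernel) →
    deflate A z₀ x nz (λ i → eigenvector x i (kernel i)) λ (H , R , B₀) → ¬nn (step H R B₀)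
    where
    z₀ : Carrier
    z₀ = z zero
    singular : charPoly A z₀ ≈ 0#
    singular = trans (eig z₀) (trans (*-congʳ (-‿inverseʳ z₀)) (zeroˡ _))
    eigenvector : ∀ x i → sum (λ j → (scalar z₀ i j + - A i j) * x j) ≈ 0# → sum (λ j → A i j * x j) ≈ z₀ * x i
    eigenvector x i eq = sym (x∙y⁻¹≈ε⇒x≈y _ _ (begin
      z₀ * x i - sum (λ j → A i j * x j)
        ≈⟨ minus-cong (trans (*-congˡ (sym (identity-apply x i))) (*-distribˡ-sum {suc n} z₀ (λ j → identity i j * x j)))
             (sym (*-identityˡ _)) ⟩
      sum (λ j → z₀ * (identity i j * x j)) - 1# * sum (λ j → A i j * x j)
        ≈⟨ sum-minus-scale (suc n) 1# (λ j → z₀ * (identity i j * x j)) (λ j → A i j * x j) ⟨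
      sum (λ j → z₀ * (identity i j * x j) - 1# * (A i j * x j))
        ≈⟨ sum-cong (suc n) (λ j → trans
             (minus-cong (trans (sym (*-assoc _ _ _)) (*-congʳ (sym (scalar-identity z₀ i j)))) (*-identityˡ _))
             (sym ([y-z]x≈yx-zx (x j) (scalar z₀ i j) (A i j)))) ⟩
      sum (λ j → (scalar z₀ i j + - A i j) * x j)  ≈⟨ eq ⟩
      0#  ∎))
    step : ∀ H → Reflection H → (∀ i → conjugate H A i zero ≈ z₀ * identity i zero) →
      NonNeg (hermitianNorm A - sum (λ j → (z j + conj (z j)) * (z j + conj (z j))))
    step H R B₀ = NonNeg-resp eq (NonNeg-+ (hermitianNorm-minor B) (schur n (minor B) (tail z) eigB))
      where
      B : Matrix (suc n)
      B = conjugate H A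
      eigB : AreEigenvalues (minor B) (tail z)
      -- Both sides times x - z₀ agree: one is the characteristic polynomial of B expanded along its
      -- first column, the other the given factorisation for A.
      eigB = cancel-root z₀ (poly-charPoly (minor B))
        (poly-product n λ j → poly-minus poly-id (poly-const (z (suc j))))
        λ x → trans (sym (charPoly-minor B z₀ B₀ x)) (trans (charPoly-conjugate R A x) (eig x))
      b y : Carrier
      b = B zero zero + conj (B zero zero)
      y = sum λ j → (z (suc j) + conj (z (suc j))) * (z (suc j) + conj (z (suc j)))
      b≈ : b ≈ z₀ + conj z₀
      b≈ = +-cong B₀₀ (conj-cong B₀₀)
        where B₀₀ = trans (B₀ zero) (*-identityʳ z₀)
      eq : (hermitianNorm B - (b * b + hermitianNorm (minor B))) + (hermitianNorm (minor B) - y)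
         ≈ hermitianNorm A - ((z₀ + conj z₀) * (z₀ + conj z₀) + y)
      eq = trans
        (solve 4 (λ f b g y → (f :- (b :+ g)) :+ (g :- y) := f :- (b :+ y)) refl _ (b * b) _ y)
        (minus-cong (hermitianNorm-conjugate R A) (+-congʳ (*-cong b≈ b≈)))

-- Independence of determinants from the equality relation

-- The rings ℂ-rawRing and ℂ-commutativeRing below have the same operations but
-- different equality relations.
module EqualityIndependence {c ℓ ℓ′} (R : RawRing c ℓ) (_≈′_ : RawRing.Carrier R → RawRing.Carrier R → Set ℓ′) where

  open RawRing R

  R′ : RawRing c ℓ′
  R′ = record { Carrier = Carrier ; _≈_ = _≈′_ ; _+_ = _+_ ; _*_ = _*_ ; -_ = -_ ; 0# = 0# ; 1# = 1# }

  open Matrices R using (Matrix; det; scalar; charPoly)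
  open RawSemiringDefs rawSemiring using (sum; product; _^_)
  private
    module M = Matrices R′
    module D = RawSemiringDefs (RawRing.rawSemiring R′)

  sum-independent : ∀ n {f g : Vector Carrier n} → (∀ i → f i ≡ g i) → sum f ≡ D.sum g
  sum-independent zero    h = ≡.refl
  sum-independent (suc n) h = ≡.cong₂ _+_ (h zero) (sum-independent n (h ∘ suc))

  product-independent : ∀ n (f : Vector Carrier n) → product f ≡ D.product f
  product-independent zero    f = ≡.refl
  product-independent (suc n) f = ≡.cong (f zero *_) (product-independent n (tail f))

  ^-independent : ∀ x k → x ^ k ≡ x D.^ k
  ^-independent x zero    = ≡.refl
  ^-independent x (suc k) = ≡.cong (x *_) (^-independent x k)

  -- Two entrywise equal matrices are compared instead of one matrix with itself, because the two
  -- versions of `scalar` agree only entry by entry.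
  det-independent : ∀ n {M N : Matrix n} → (∀ i j → M i j ≡ N i j) → det M ≡ M.det N
  det-independent zero    h = ≡.refl
  det-independent (suc n) h = sum-independent (suc n) λ j → ≡.cong₂ _*_
    (^-independent (- 1#) (toℕ j)) (≡.cong₂ _*_ (h zero j) (det-independent n λ i k → h (suc i) (punchIn j k)))

  scalar-independent : ∀ {n} x (i j : Fin n) → scalar x i j ≡ M.scalar x i j
  scalar-independent x i j with i Fin.≟ j
  ... | yes _ = ≡.refl
  ... | no  _ = ≡.refl

  charPoly-independent : ∀ n (M : Matrix n) x → charPoly M x ≡ M.charPoly M x
  charPoly-independent n M x = det-independent n λ i j → ≡.cong (_+ (- M i j)) (scalar-independent x i j)

open import Defs

-- The commutative ring of Cauchy reals

module Reals where

  Eventually : (ℕ → Set) → Set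
  Eventually P = ∃ λ N → ∀ n → N ℕ.≤ n → P n

  always : ∀ {P : ℕ → Set} → (∀ n → P n) → Eventually P
  always h = 0 , λ n _ → h n

  eventually₁ : ∀ {P Q : ℕ → Set} → (∀ n → P n → Q n) → Eventually P → Eventually Q
  eventually₁ f (N , h) = N , λ n N≤n → f n (h n N≤n)

  eventually₂ : ∀ {P Q R : ℕ → Set} → (∀ n → P n → Q n → R n) → Eventually P → Eventually Q → Eventually R
  eventually₂ f (N , h) (M , k) = N ℕ.⊔ M , λ n le →
    f n (h n (ℕ.m⊔n≤o⇒m≤o N M le)) (k n (ℕ.m⊔n≤o⇒n≤o N M le))

  eventually-meet : ∀ {P Q : ℕ → Set} {A : Set} → Eventually P → Eventually Q → (∀ n → P n → Q n → A) → A
  eventually-meet (N , h) (M , k) f = f (N ℕ.⊔ M) (h _ (ℕ.m≤m⊔n N M)) (k _ (ℕ.m≤n⊔m N M))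

  open +-*-Solver using (_:=_; _:+_; _:*_; _:-_; :-_; con) renaming (solve to ℚ-solve)

  -- Reduces a linear estimate to one identity between differences, which the ring solver can check.
  shift-< : ∀ {p q p′ q′} → p ℚ.< q → q ℚ.- p ≡ q′ ℚ.- p′ → p′ ℚ.< q′
  shift-< {p} {q} {p′} {q′} p<q eq = ≡.subst₂ ℚ._<_
    (ℚ.+-identityˡ p′)
    (ℚ-solve 2 (λ q p → (q :- p) :+ p := q) ≡.refl q′ p′)
    (ℚ.+-monoˡ-< p′ (≡.subst (0ℚ ℚ.<_) eq
      (≡.subst (ℚ._< q ℚ.- p) (ℚ.+-inverseʳ p) (ℚ.+-monoˡ-< (ℚ.- p) p<q))))

  shift-≤ : ∀ {p q p′ q′} → p ℚ.≤ q → q ℚ.- p ≡ q′ ℚ.- p′ → p′ ℚ.≤ q′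
  shift-≤ {p} {q} {p′} {q′} p≤q eq = ≡.subst₂ ℚ._≤_
    (ℚ.+-identityˡ p′)
    (ℚ-solve 2 (λ q p → (q :- p) :+ p := q) ≡.refl q′ p′)
    (ℚ.+-monoˡ-≤ p′ (≡.subst (0ℚ ℚ.≤_) eq
      (≡.subst (ℚ._≤ q ℚ.- p) (ℚ.+-inverseʳ p) (ℚ.+-monoˡ-≤ (ℚ.- p) p≤q))))

  ∣p∣<⇒p< : ∀ {p ε} → ℚ.∣ p ∣ ℚ.< ε → p ℚ.< ε
  ∣p∣<⇒p< = ℚ.≤-<-trans (p≤∣p∣ _)

  ∣p∣<⇒-p< : ∀ {p ε} → ℚ.∣ p ∣ ℚ.< ε → ℚ.- p ℚ.< ε
  ∣p∣<⇒-p< {p} = ∣p∣<⇒p< ∘ ≡.subst (ℚ._< _) (≡.sym (ℚ.∣-p∣≡∣p∣ p))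

  0≤* : ∀ {p q} → 0ℚ ℚ.≤ p → 0ℚ ℚ.≤ q → 0ℚ ℚ.≤ p ℚ.* q
  0≤* {p} {q} 0≤p 0≤q = ≡.subst (ℚ._≤ p ℚ.* q) (ℚ.*-zeroˡ q) (ℚ.*-monoʳ-≤-nonNeg q {{ℚ.nonNegative 0≤q}} 0≤p)

  0≤square : ∀ p → 0ℚ ℚ.≤ p ℚ.* p
  0≤square p with ℚ.≤-total 0ℚ p
  ... | inj₁ 0≤p = 0≤* 0≤p 0≤p
  ... | inj₂ p≤0 = ≡.subst (0ℚ ℚ.≤_) (ℚ-solve 1 (λ p → (:- p) :* (:- p) := p :* p) ≡.refl p)
    (0≤* (ℚ.neg-antimono-≤ p≤0) (ℚ.neg-antimono-≤ p≤0))

  ∣p∣²≡p² : ∀ p → ℚ.∣ p ∣ ℚ.* ℚ.∣ p ∣ ≡ p ℚ.* p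
  ∣p∣²≡p² p with ℚ.∣p∣≡p∨∣p∣≡-p p
  ... | inj₁ eq = ≡.cong₂ ℚ._*_ eq eq
  ... | inj₂ eq = ≡.trans (≡.cong₂ ℚ._*_ eq eq) (ℚ-solve 1 (λ p → (:- p) :* (:- p) := p :* p) ≡.refl p)

  -- _≈_ unfolds to a function type, which hides its arguments from unification.
  infix 4 _≃_
  record _≃_ (x y : ℝ) : Set where
    constructor equal
    field
      ≃⇒≈ : x ≈ y

  pointwise : ∀ {x y} → (∀ n → seq x n ≡ seq y n) → x ≃ y
  pointwise {x} {y} h = equal λ ε 0<ε → always λ n → ≡.subst (ℚ._< ε)
    (≡.cong ℚ.∣_∣ (≡.sym (≡.trans (≡.cong (ℚ._- seq y n) (h n)) (ℚ.+-inverseʳ (seq y n))))) 0<ε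

  ≃-sym : ∀ {x y} → x ≃ y → y ≃ x
  ≃-sym {x} {y} (equal h) = equal λ ε 0<ε → eventually₁ (λ n → ≡.subst (ℚ._< ε) (≡.trans (≡.sym (ℚ.∣-p∣≡∣p∣ _))
    (≡.cong ℚ.∣_∣ (ℚ-solve 2 (λ a b → :- (a :- b) := b :- a) ≡.refl (seq x n) (seq y n))))) (h ε 0<ε)

  ∣∣-triangle : ∀ p q {r ε} → p ℚ.+ q ≡ r → ℚ.∣ p ∣ ℚ.< ½ ℚ.* ε → ℚ.∣ q ∣ ℚ.< ½ ℚ.* ε → ℚ.∣ r ∣ ℚ.< ε
  ∣∣-triangle p q {ε = ε} ≡.refl hp hq = ℚ.≤-<-trans (ℚ.∣p+q∣≤∣p∣+∣q∣ p q) (<-halves ε hp hq)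

  ≃-trans : ∀ {x y z} → x ≃ y → y ≃ z → x ≃ z
  ≃-trans {x} {y} {z} (equal h) (equal k) = equal λ ε 0<ε → eventually₂
    (λ n → ∣∣-triangle (seq x n ℚ.- seq y n) (seq y n ℚ.- seq z n)
      (ℚ-solve 3 (λ a b c → (a :- b) :+ (b :- c) := a :- c) ≡.refl (seq x n) (seq y n) (seq z n)))
    (h _ (half-pos 0<ε)) (k _ (half-pos 0<ε))

  +-cong : ∀ {x x′ y y′} → x ≃ x′ → y ≃ y′ → x + y ≃ x′ + y′
  +-cong {x} {x′} {y} {y′} (equal h) (equal k) = equal λ ε 0<ε → eventually₂
    (λ n → ∣∣-triangle (seq x n ℚ.- seq x′ n) (seq y n ℚ.- seq y′ n)
      (ℚ-solve 4 (λ a b c d → (a :- b) :+ (c :- d) := (a :+ c) :- (b :+ d)) ≡.refl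
        (seq x n) (seq x′ n) (seq y n) (seq y′ n)))
    (h _ (half-pos 0<ε)) (k _ (half-pos 0<ε))

  neg-cong : ∀ {x y} → x ≃ y → - x ≃ - y
  neg-cong {x} {y} (equal h) = equal λ ε 0<ε → eventually₁ (λ n → ≡.subst (ℚ._< ε) (≡.trans (≡.sym (ℚ.∣-p∣≡∣p∣ _))
    (≡.cong ℚ.∣_∣ (ℚ-solve 2 (λ a b → :- (a :- b) := (:- a) :- (:- b)) ≡.refl (seq x n) (seq y n))))) (h ε 0<ε)

  *-cong : ∀ {x x′ y y′} → x ≃ x′ → y ≃ y′ → x * y ≃ x′ * y′
  *-cong {x} {x′} {y} {y′} (equal h) (equal k) = equal λ ε 0<ε →
    let B , 0<B , hB = eventually-bounded x
        C , 0<C , hC = eventually-bounded y′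
        δ , 0<δ , Bδ = scaled B (½ ℚ.* ε) 0<B (half-pos 0<ε)
        η , 0<η , Cη = scaled C (½ ℚ.* ε) 0<C (half-pos 0<ε)
    in eventually₂ (λ n (a≤B , d≤C) (c-d , a-b) →
         ∣*-difference∣ (seq x n) (seq x′ n) (seq y n) (seq y′ n) 0<B 0<C Bδ Cη a≤B d≤C c-d a-b)
       (eventually₂ (λ n → _,_) hB hC) (eventually₂ (λ n → _,_) (k δ 0<δ) (h η 0<η))

  ℝ-commutativeRing : CommutativeRing 0ℓ 0ℓ
  ℝ-commutativeRing = record
    { Carrier = ℝ ; _≈_ = _≃_ ; _+_ = _+_ ; _*_ = _*_ ; -_ = -_ ; 0# = fromℚ 0ℚ ; 1# = fromℚ 1ℚ
    ; isCommutativeRing = record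
      { isRing = record
        { +-isAbelianGroup = record
          { isGroup = record
            { isMonoid = record
              { isSemigroup = record
                { isMagma = record
                  { isEquivalence = record { refl = pointwise λ _ → ≡.refl ; sym = ≃-sym ; trans = ≃-trans }
                  ; ∙-cong = +-cong }
                ; assoc = λ x y z → pointwise λ n → ℚ.+-assoc (seq x n) (seq y n) (seq z n) }
              ; identity = (λ x → pointwise λ n → ℚ.+-identityˡ (seq x n))
                         , (λ x → pointwise λ n → ℚ.+-identityʳ (seq x n)) }
            ; inverse = (λ x → pointwise λ n → ℚ.+-inverseˡ (seq x n))
                      , (λ x → pointwise λ n → ℚ.+-inverseʳ (seq x n))
            ; ⁻¹-cong = neg-cong }
          ; comm = λ x y → pointwise λ n → ℚ.+-comm (seq x n) (seq y n) }
        ; *-cong = *-cong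
        ; *-assoc = λ x y z → pointwise λ n → ℚ.*-assoc (seq x n) (seq y n) (seq z n)
        ; *-identity = (λ x → pointwise λ n → ℚ.*-identityˡ (seq x n))
                     , (λ x → pointwise λ n → ℚ.*-identityʳ (seq x n))
        ; distrib = (λ x y z → pointwise λ n → ℚ.*-distribˡ-+ (seq x n) (seq y n) (seq z n))
                  , (λ x y z → pointwise λ n → ℚ.*-distribʳ-+ (seq x n) (seq y n) (seq z n)) }
      ; *-comm = λ x y → pointwise λ n → ℚ.*-comm (seq x n) (seq y n) } }

  -- Order on the reals and its stability

  infix 4 0≤_
  -- This is `fromℚ 0ℚ ≤ x`, wrapped in a record for the same reason as `_≃_`.
  record 0≤_ (x : ℝ) : Set where
    constructor nonneg
    field
      0<+ : ∀ ε → 0ℚ ℚ.< ε → Eventually λ n → 0ℚ ℚ.< seq x n ℚ.+ ε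
  open 0≤_

  0≤-resp : ∀ {x y} → x ≃ y → 0≤ x → 0≤ y
  0≤-resp {x} {y} (equal x≈y) (nonneg 0≤x) = nonneg λ ε 0<ε → eventually₂
    (λ n near pos → shift-< (ℚ.+-mono-< pos (∣p∣<⇒p< near))
      (≡.trans (ℚ-solve 3 (λ x y h → ((x :+ h) :+ h) :- (con 0ℚ :+ (x :- y)) := (y :+ (h :+ h)) :- con 0ℚ) ≡.refl
        (seq x n) (seq y n) (½ ℚ.* ε)) (≡.cong (λ e → (seq y n ℚ.+ e) ℚ.- 0ℚ) (half+half ε))))
    (x≈y (½ ℚ.* ε) (half-pos 0<ε)) (0≤x (½ ℚ.* ε) (half-pos 0<ε))

  0≤-+ : ∀ {x y} → 0≤ x → 0≤ y → 0≤ x + y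
  0≤-+ {x} {y} (nonneg 0≤x) (nonneg 0≤y) = nonneg λ ε 0<ε → eventually₂
    (λ n p q → ≡.subst (0ℚ ℚ.<_)
      (≡.trans (ℚ-solve 3 (λ x y h → (x :+ h) :+ (y :+ h) := (x :+ y) :+ (h :+ h)) ≡.refl (seq x n) (seq y n) (½ ℚ.* ε))
        (≡.cong (seq x n ℚ.+ seq y n ℚ.+_) (half+half ε)))
      (ℚ.+-mono-< p q))
    (0≤x (½ ℚ.* ε) (half-pos 0<ε)) (0≤y (½ ℚ.* ε) (half-pos 0<ε))

  0≤-pointwise : ∀ {x} → (∀ n → 0ℚ ℚ.≤ seq x n) → 0≤ x
  0≤-pointwise h = nonneg λ ε 0<ε → always λ n → ℚ.+-mono-≤-< (h n) 0<ε

  0≤-scale : ∀ q {x} → 0ℚ ℚ.≤ q → 0≤ x → 0≤ fromℚ q * x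
  0≤-scale q {x} 0≤q (nonneg 0≤x) = nonneg λ ε 0<ε →
    -- Dividing by q + 1 instead of q stays legitimate for q = 0; the additional δ is added back in
    -- the identity below.
    let δ , 0<δ , eq = scaled (q ℚ.+ 1ℚ) ε (ℚ.+-mono-≤-< 0≤q (ℚ.positive⁻¹ 1ℚ)) 0<ε
    in eventually₁ (λ n pos → ≡.subst (0ℚ ℚ.<_)
         (≡.trans (ℚ-solve 3 (λ q x d → q :* (x :+ d) :+ d := q :* x :+ (q :+ con 1ℚ) :* d) ≡.refl q (seq x n) δ)
           (≡.cong (q ℚ.* seq x n ℚ.+_) eq))
         (ℚ.+-mono-≤-< (0≤* 0≤q (ℚ.<⇒≤ pos)) 0<δ))
       (0≤x δ 0<δ)

  0≤-antisym : ∀ {x y} → 0≤ x → 0≤ y → x + y ≃ fromℚ 0ℚ → x ≃ fromℚ 0ℚ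
  0≤-antisym {x} {y} (nonneg 0≤x) (nonneg 0≤y) (equal x+y≈0) = equal λ ε 0<ε → eventually₂
    (λ n (px , py) near → ∣-∣-bound (seq x n) 0ℚ
      (shift-< (ℚ.+-mono-< py (∣p∣<⇒p< near))
        (≡.trans (ℚ-solve 3 (λ x y h → ((y :+ h) :+ h) :- (con 0ℚ :+ ((x :+ y) :- con 0ℚ)) := (h :+ h) :- (x :- con 0ℚ))
           ≡.refl (seq x n) (seq y n) (½ ℚ.* ε)) (≡.cong (ℚ._- (seq x n ℚ.- 0ℚ)) (half+half ε))))
      (shift-< px (ℚ-solve 2 (λ x e → (x :+ e) :- con 0ℚ := e :- (con 0ℚ :- x)) ≡.refl (seq x n) ε)))
    (eventually₂ (λ n → _,_) (0≤x ε 0<ε) (0≤y (½ ℚ.* ε) (half-pos 0<ε)))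
    (x+y≈0 (½ ℚ.* ε) (half-pos 0<ε))

  -- A rational approximation, on which comparisons are decidable; the case distinctions on reals
  -- below go through it.
  settles : ∀ x η → 0ℚ ℚ.< η → ∃ λ q → Eventually λ n → ℚ.∣ seq x n ℚ.- q ∣ ℚ.< η
  settles x η 0<η = let N , h = cauchy x η 0<η in seq x N , N , λ n N≤n → h n N N≤n ℕ.≤-refl

  quarters : ∀ ε → ½ ℚ.* ε ≡ ½ ℚ.* (½ ℚ.* ε) ℚ.+ ½ ℚ.* (½ ℚ.* ε)
  quarters ε = ≡.sym (half+half (½ ℚ.* ε))

  quarter<half : ∀ {ε} → 0ℚ ℚ.< ε → ½ ℚ.* (½ ℚ.* ε) ℚ.< ½ ℚ.* ε
  quarter<half {ε} 0<ε = ≡.subst₂ ℚ._<_ (ℚ.+-identityʳ _) (≡.sym (quarters ε))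
    (ℚ.+-monoʳ-< (½ ℚ.* (½ ℚ.* ε)) (half-pos (half-pos 0<ε)))

  -- For given ε, let q approximate x to within ε/4. If q > -ε/2, then x is eventually above -ε.
  -- Otherwise x stays below -ε/4, which refutes x ≥ 0 and so contradicts the double negation. The
  -- decision concerns q only.
  0≤-stable : ∀ {x} → ¬ ¬ 0≤ x → 0≤ x
  0≤-stable {x} ¬¬0≤x = nonneg above
    where
    above : ∀ ε → 0ℚ ℚ.< ε → Eventually λ n → 0ℚ ℚ.< seq x n ℚ.+ ε
    above ε 0<ε with settles x (½ ℚ.* (½ ℚ.* ε)) (half-pos (half-pos 0<ε))
    ... | q , near with 0ℚ ℚ.<? q ℚ.+ ½ ℚ.* ε
    ...   | yes pos = eventually₁ (λ n h → shift-<
              (ℚ.+-mono-< pos (ℚ.<-trans (∣p∣<⇒-p< h) (quarter<half 0<ε)))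
              (≡.trans (ℚ-solve 3 (λ x q h → ((q :+ h) :+ h) :- (con 0ℚ :+ :- (x :- q)) := (x :+ (h :+ h)) :- con 0ℚ)
                ≡.refl (seq x n) q (½ ℚ.* ε)) (≡.cong (λ e → (seq x n ℚ.+ e) ℚ.- 0ℚ) (half+half ε)))) near
    ...   | no ¬pos = contradiction
              (λ 0≤x → eventually-meet near (0<+ 0≤x _ (half-pos (half-pos 0<ε))) λ n h pos →
                ℚ.<-irrefl ≡.refl (ℚ.<-≤-trans
                  (shift-< (ℚ.+-mono-< pos (∣p∣<⇒p< h))
                    (≡.trans (ℚ-solve 3 (λ x q h → ((x :+ h) :+ h) :- (con 0ℚ :+ (x :- q)) := (q :+ (h :+ h)) :- con 0ℚ)
                      ≡.refl (seq x n) q (½ ℚ.* (½ ℚ.* ε)))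
                      (≡.cong (λ e → (q ℚ.+ e) ℚ.- 0ℚ) (half+half (½ ℚ.* ε)))))
                  (ℚ.≮⇒≥ ¬pos)))
              ¬¬0≤x

  -- Inverses of real numbers

  -- The value at 0 is a filler that keeps the sequence of reciprocals total: an invertible real may
  -- have finitely many zero terms.
  reciprocal : ℚ → ℚ
  reciprocal q with q ℚ.≟ 0ℚ
  ... | yes _  = 0ℚ
  ... | no q≢0 = ℚ.1/_ q {{ℚ.≢-nonZero q≢0}}

  reciprocal-inverse : ∀ {q} → q ≢ 0ℚ → q ℚ.* reciprocal q ≡ 1ℚ
  reciprocal-inverse {q} q≢0 with q ℚ.≟ 0ℚ
  ... | yes q≡0 = contradiction q≡0 q≢0
  ... | no q≢0  = ℚ.*-inverseʳ q {{ℚ.≢-nonZero q≢0}}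

  apart⇒≢0 : ∀ {δ q} → 0ℚ ℚ.< δ → δ ℚ.≤ ℚ.∣ q ∣ → q ≢ 0ℚ
  apart⇒≢0 0<δ δ≤∣q∣ ≡.refl = ℚ.<-irrefl ≡.refl (ℚ.<-≤-trans 0<δ δ≤∣q∣)

  ∣reciprocal∣≤ : ∀ {δ C q} → 0ℚ ℚ.< δ → δ ℚ.* C ≡ 1ℚ → δ ℚ.≤ ℚ.∣ q ∣ → ℚ.∣ reciprocal q ∣ ℚ.≤ C
  ∣reciprocal∣≤ {δ} {C} {q} 0<δ δC≡1 δ≤∣q∣ = ℚ.*-cancelˡ-≤-pos δ {{ℚ.positive 0<δ}} (≡.subst
    (δ ℚ.* ℚ.∣ reciprocal q ∣ ℚ.≤_)
    (≡.trans (≡.sym (ℚ.∣p*q∣≡∣p∣*∣q∣ q (reciprocal q)))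
      (≡.trans (≡.cong ℚ.∣_∣ (reciprocal-inverse (apart⇒≢0 0<δ δ≤∣q∣))) (≡.sym δC≡1)))
    (ℚ.*-monoʳ-≤-nonNeg ℚ.∣ reciprocal q ∣ {{ℚ.∣-∣-nonNeg (reciprocal q)}} δ≤∣q∣))

  -- The reciprocals are bounded by C = 1/δ and 1/a - 1/b = (b - a)/(ab), so their sequence is
  -- Cauchy with the tolerance divided twice by C.
  apart⇒unit : ∀ x {δ} → 0ℚ ℚ.< δ → (Eventually λ n → δ ℚ.≤ ℚ.∣ seq x n ∣) → ∃ λ y → x * y ≃ fromℚ 1ℚ
  apart⇒unit x {δ} 0<δ (N , far) = mkℝ r r-cauchy , equal λ ε 0<ε → N , λ n N≤n →
    ≡.subst (ℚ._< ε) (≡.cong ℚ.∣_∣ (≡.sym (≡.trans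
      (≡.cong (ℚ._- 1ℚ) (reciprocal-inverse (apart⇒≢0 0<δ (far n N≤n)))) (ℚ.+-inverseʳ 1ℚ)))) 0<ε
    where
    r : ℕ → ℚ
    r n = reciprocal (seq x n)
    difference : ∀ {a b} → a ≢ 0ℚ → b ≢ 0ℚ →
      reciprocal a ℚ.* (reciprocal b ℚ.* (b ℚ.- a)) ≡ reciprocal a ℚ.- reciprocal b
    difference {a} {b} a≢0 b≢0 = ≡.trans
      (ℚ-solve 4 (λ a b s t → s :* (t :* (b :- a)) := s :* (b :* t) :- t :* (a :* s)) ≡.refl a b (reciprocal a) (reciprocal b))
      (≡.cong₂ ℚ._-_
        (≡.trans (≡.cong (reciprocal a ℚ.*_) (reciprocal-inverse b≢0)) (ℚ.*-identityʳ (reciprocal a)))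
        (≡.trans (≡.cong (reciprocal b ℚ.*_) (reciprocal-inverse a≢0)) (ℚ.*-identityʳ (reciprocal b))))
    r-cauchy : IsCauchy r
    r-cauchy ε 0<ε =
      let C , 0<C , δC≡1 = scaled δ 1ℚ 0<δ (ℚ.positive⁻¹ 1ℚ)
          η , 0<η , Cη≡ε = scaled C ε 0<C 0<ε
          θ , 0<θ , Cθ≡η = scaled C η 0<C 0<η
          M , close      = cauchy x θ 0<θ
      in N ℕ.⊔ M , λ m n ≤m ≤n →
      let farₘ = far m (ℕ.m⊔n≤o⇒m≤o N M ≤m)
          farₙ = far n (ℕ.m⊔n≤o⇒m≤o N M ≤n)
      in ≡.subst₂ ℚ._<_ (≡.cong ℚ.∣_∣ (difference (apart⇒≢0 0<δ farₘ) (apart⇒≢0 0<δ farₙ))) Cη≡ε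
        (product-bound (r m) (r n ℚ.* (seq x n ℚ.- seq x m)) 0<C (∣reciprocal∣≤ 0<δ δC≡1 farₘ)
          (≡.subst (ℚ.∣ r n ℚ.* (seq x n ℚ.- seq x m) ∣ ℚ.<_) Cθ≡η
            (product-bound (r n) (seq x n ℚ.- seq x m) 0<C (∣reciprocal∣≤ 0<δ δC≡1 farₙ)
              (close n m (ℕ.m⊔n≤o⇒n≤o N M ≤n) (ℕ.m⊔n≤o⇒n≤o N M ≤m)))))

  small∨unit : ∀ x ε → 0ℚ ℚ.< ε →
    (Eventually λ n → ℚ.∣ seq x n ℚ.- 0ℚ ∣ ℚ.< ε) ⊎ ∃ λ y → x * y ≃ fromℚ 1ℚ
  small∨unit x ε 0<ε with settles x (½ ℚ.* (½ ℚ.* ε)) (half-pos (half-pos 0<ε))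
  ... | q , near with ℚ.∣ q ∣ ℚ.<? ½ ℚ.* ε
  ...   | yes small = inj₁ (eventually₁ (λ n h → ∣∣-triangle (seq x n ℚ.- q) q
            (ℚ-solve 2 (λ x q → (x :- q) :+ q := x :- con 0ℚ) ≡.refl (seq x n) q)
            (ℚ.<-trans h (quarter<half 0<ε)) small) near)
  ...   | no ¬small = inj₂ (apart⇒unit x (half-pos (half-pos 0<ε)) (eventually₁ (λ n h →
            shift-≤ (ℚ.≤-trans (ℚ.≮⇒≥ ¬small)
              (ℚ.≤-trans (∣∣-shift q (seq x n))
                (ℚ.+-monoʳ-≤ ℚ.∣ seq x n ∣ (ℚ.<⇒≤ (≡.subst (ℚ._< _) (≡.trans (≡.sym (ℚ.∣-p∣≡∣p∣ _))
                  (≡.cong ℚ.∣_∣ (ℚ-solve 2 (λ a b → :- (a :- b) := b :- a) ≡.refl (seq x n) q))) h)))))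
            (≡.trans (≡.cong (λ e → (ℚ.∣ seq x n ∣ ℚ.+ ½ ℚ.* (½ ℚ.* ε)) ℚ.- e) (quarters ε))
              (ℚ-solve 2 (λ a h → (a :+ h) :- (h :+ h) := a :- h) ≡.refl ℚ.∣ seq x n ∣ (½ ℚ.* (½ ℚ.* ε))))) near))

  -- `small∨unit` decides the alternative at each single precision. If x has no inverse, it is small
  -- at every precision and therefore zero.
  ℝ-zero∨unit : ∀ x → ¬ ¬ (x ≃ fromℚ 0ℚ ⊎ ∃ λ y → x * y ≃ fromℚ 1ℚ)
  ℝ-zero∨unit x k = k (inj₁ (equal small))
    where
    small : x ≈ fromℚ 0ℚ
    small ε 0<ε with small∨unit x ε 0<ε
    ... | inj₁ s = s
    ... | inj₂ u = contradiction (inj₂ u) k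

  -- Square roots of reals

  1/suc : ℕ → ℚ
  1/suc n = + 1 ℚ./ suc n

  square-mono-≤ : ∀ {p q} → 0ℚ ℚ.≤ p → p ℚ.≤ q → p ℚ.* p ℚ.≤ q ℚ.* q
  square-mono-≤ {p} {q} 0≤p p≤q = ℚ.≤-trans
    (ℚ.*-monoʳ-≤-nonNeg p {{ℚ.nonNegative 0≤p}} p≤q)
    (ℚ.*-monoˡ-≤-nonNeg q {{ℚ.nonNegative (ℚ.≤-trans 0≤p p≤q)}} p≤q)

  positivePart< : ∀ {p ε} → 0ℚ ℚ.< ε → 0ℚ ℚ.< p ℚ.+ ε → p ℚ.⊔ 0ℚ ℚ.< p ℚ.+ ε
  positivePart< {p} {ε} 0<ε pos with ℚ.⊔-sel p 0ℚ
  ... | inj₁ eq = ≡.subst (ℚ._< p ℚ.+ ε) (≡.trans (ℚ.+-identityʳ p) (≡.sym eq)) (ℚ.+-monoʳ-< p 0<ε)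
  ... | inj₂ eq = ≡.subst (ℚ._< p ℚ.+ ε) (≡.sym eq) pos

  -- With e = 1/(n + 1) and p the positive part of the n-th term, the approximant s satisfies s² ≤ p
  -- < (s + e)². So s² misses p by at most e (2s + e), which is at most (2B + 1) e once e ≤ 1 and s
  -- ≤ B.
  √-square : ∀ {x} → 0≤ x → √ x * √ x ≃ x
  √-square {x} (nonneg 0≤x) = equal λ ε 0<ε →
    let B , 0<B , bounded = eventually-bounded (√ x)
        0<2B+1            = ℚ.+-mono-< (ℚ.+-mono-< 0<B 0<B) (ℚ.positive⁻¹ 1ℚ)
        δ , 0<δ , eq      = scaled (B ℚ.+ B ℚ.+ 1ℚ) ε 0<2B+1 0<ε
    in eventually₂ (λ n (s≤B , pos) (e≤δ , e≤1) →
         let s = seq (√ x) n ; e = 1/suc n ; p = seq x n ℚ.⊔ 0ℚ ; 0≤p = ℚ.p≤q⊔p (seq x n) 0ℚ in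
         ∣-∣-bound (s ℚ.* s) (seq x n)
           (<-move (s ℚ.* s) (seq x n) ε (ℚ.≤-<-trans (sqrtApprox-lower n p 0≤p) (positivePart< {seq x n} 0<ε pos)))
           (shift-< (ℚ.+-mono-<-≤ (ℚ.≤-<-trans (ℚ.p≤p⊔q (seq x n) 0ℚ) (sqrtApprox-upper n p 0≤p))
               (slack s e (nonNeg-/ 1 n) (p≤∣p∣ s) s≤B e≤δ e≤1 0<2B+1 eq))
             (ℚ-solve 4 (λ x s e t → ((s :+ e) :* (s :+ e) :+ t) :- (x :+ e :* ((s :+ s) :+ e)) := t :- (x :- s :* s)) ≡.refl
               (seq x n) s e ε)))
       (eventually₂ (λ n → _,_) bounded (0≤x ε 0<ε))
       (eventually₂ (λ n → _,_) (archimedean δ 0<δ) (archimedean 1ℚ (ℚ.positive⁻¹ 1ℚ)))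
    where
    slack : ∀ {B δ ε} s e → 0ℚ ℚ.≤ e → s ℚ.≤ ℚ.∣ s ∣ → ℚ.∣ s ∣ ℚ.≤ B → e ℚ.≤ δ → e ℚ.≤ 1ℚ →
      0ℚ ℚ.< B ℚ.+ B ℚ.+ 1ℚ → (B ℚ.+ B ℚ.+ 1ℚ) ℚ.* δ ≡ ε → e ℚ.* ((s ℚ.+ s) ℚ.+ e) ℚ.≤ ε
    slack {B} {δ} s e 0≤e s≤∣s∣ ∣s∣≤B e≤δ e≤1 0<C eq = ≡.subst (e ℚ.* ((s ℚ.+ s) ℚ.+ e) ℚ.≤_) eq (ℚ.≤-trans
      (ℚ.*-monoˡ-≤-nonNeg e {{ℚ.nonNegative 0≤e}}
        (ℚ.+-mono-≤ (ℚ.+-mono-≤ (ℚ.≤-trans s≤∣s∣ ∣s∣≤B) (ℚ.≤-trans s≤∣s∣ ∣s∣≤B)) e≤1))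
      (ℚ.≤-trans (ℚ.≤-reflexive (ℚ.*-comm e _))
        (ℚ.*-monoˡ-≤-nonNeg (B ℚ.+ B ℚ.+ 1ℚ) {{ℚ.nonNegative (ℚ.<⇒≤ 0<C)}} e≤δ)))

  -- With δ = ε/2 and e ≤ δ one has eventually x² < y + δ² < (s + e)² + δ² ≤ (s + δ)² + δ² ≤ (s +
  -- 2δ)², and s + 2δ = s + ε is nonnegative.
  square≤⇒≤√ : ∀ {x y} → 0≤ y - x * x → x ≤ √ y
  square≤⇒≤√ {x} {y} (nonneg h) ε 0<ε = eventually₂ (λ n pos e≤δ →
      let s = seq (√ y) n ; e = 1/suc n ; p = seq y n ℚ.⊔ 0ℚ ; 0≤p = ℚ.p≤q⊔p (seq y n) 0ℚ
          0≤s = sqrtApprox-nonNeg n p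
          0≤s+e = ℚ.+-mono-≤ 0≤s (nonNeg-/ 1 n)
          0≤s+δ = ℚ.+-mono-≤ 0≤s (ℚ.<⇒≤ 0<δ)
      in ≡.subst (seq x n ℚ.<_) (≡.trans (ℚ.+-assoc s δ δ) (≡.cong (s ℚ.+_) (half+half ε)))
        (square-cancel-< (ℚ.+-mono-≤ 0≤s+δ (ℚ.<⇒≤ 0<δ))
          (ℚ.<-≤-trans
            (ℚ.<-≤-trans
              (shift-< (ℚ.+-mono-< pos (ℚ.≤-<-trans (ℚ.p≤p⊔q (seq y n) 0ℚ) (sqrtApprox-upper n p 0≤p)))
                (ℚ-solve 4 (λ x y d t → ((y :+ :- (x :* x) :+ d) :+ t) :- (con 0ℚ :+ y) := (t :+ d) :- x :* x) ≡.refl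
                  (seq x n) (seq y n) (δ ℚ.* δ) ((s ℚ.+ e) ℚ.* (s ℚ.+ e))))
              (ℚ.+-monoˡ-≤ (δ ℚ.* δ) (square-mono-≤ 0≤s+e (ℚ.+-monoʳ-≤ s e≤δ))))
            (shift-≤ (ℚ.+-mono-≤ (0≤* 0≤s+δ (ℚ.<⇒≤ 0<δ)) (0≤* 0≤s+δ (ℚ.<⇒≤ 0<δ)))
              (ℚ-solve 2 (λ t d → (t :* d :+ t :* d) :- (con 0ℚ :+ con 0ℚ)
                  := ((t :+ d) :* (t :+ d)) :- (t :* t :+ d :* d)) ≡.refl (s ℚ.+ δ) δ)))))
    (h (δ ℚ.* δ) (square-pos δ 0<δ)) (archimedean δ 0<δ)
    where
    δ : ℚ
    δ = ½ ℚ.* ε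
    0<δ : 0ℚ ℚ.< δ
    0<δ = half-pos 0<ε

  ℝ-norm-zero : ∀ {x y} → x * x + y * y ≃ fromℚ 0ℚ → x ≃ fromℚ 0ℚ
  ℝ-norm-zero {x} {y} (equal h) = equal λ ε 0<ε → eventually₁ (λ n near → square-cancel-< (ℚ.<⇒≤ 0<ε)
      (ℚ.≤-<-trans (ℚ.≤-reflexive (≡.trans (∣p∣²≡p² (seq x n ℚ.- 0ℚ)) (ℚ-solve 1 (λ x → (x :- con 0ℚ) :* (x :- con 0ℚ) := x :* x) ≡.refl (seq x n))))
      (ℚ.≤-<-trans (shift-≤ (0≤square (seq y n))
          (ℚ-solve 2 (λ x y → y :* y :- con 0ℚ := (x :* x :+ y :* y :- con 0ℚ) :- x :* x) ≡.refl (seq x n) (seq y n)))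
        (∣p∣<⇒p< near))))
    (h (ε ℚ.* ε) (square-pos ε 0<ε))

  ℝ-1≉0 : ¬ fromℚ 1ℚ ≃ fromℚ 0ℚ
  ℝ-1≉0 (equal h) = let N , k = h 1ℚ (ℚ.positive⁻¹ 1ℚ) in ℚ.<-irrefl ≡.refl (k N ℕ.≤-refl)

open Reals

module Real where
  open CommutativeRing ℝ-commutativeRing public hiding (zero; _≈_; _+_; _*_; -_; _-_)
  open RingProperties ring public
  open IntegerSolver ℝ-commutativeRing public
  open SemiringSum semiring public

-- The complex numbers as a star field

infix 4 _≅_
record _≅_ (z w : ℂ) : Set where
  constructor equalᶜ
  field
    Re≃ : Re z ≃ Re w
    Im≃ : Im z ≃ Im w

open RawRing ℂ-rawRing using () renaming (_+_ to _+ᶜ_; _*_ to _*ᶜ_; -_ to -ᶜ_; 0# to 0ᶜ; 1# to 1ᶜ)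

ℂ-commutativeRing : CommutativeRing 0ℓ 0ℓ
ℂ-commutativeRing = record
  { Carrier = ℂ ; _≈_ = _≅_ ; _+_ = _+ᶜ_ ; _*_ = _*ᶜ_ ; -_ = -ᶜ_ ; 0# = 0ᶜ ; 1# = 1ᶜ
  ; isCommutativeRing = record
    { isRing = record
      { +-isAbelianGroup = record
        { isGroup = record
          { isMonoid = record
            { isSemigroup = record
              { isMagma = record
                { isEquivalence = record
                  { refl = equalᶜ Real.refl Real.refl
                  ; sym = λ (equalᶜ p q) → equalᶜ (Real.sym p) (Real.sym q)
                  ; trans = λ (equalᶜ p q) (equalᶜ p′ q′) → equalᶜ (Real.trans p p′) (Real.trans q q′) }
                ; ∙-cong = λ (equalᶜ p q) (equalᶜ p′ q′) → equalᶜ (Real.+-cong p p′) (Real.+-cong q q′) }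
              ; assoc = λ x y z → equalᶜ (Real.+-assoc _ _ _) (Real.+-assoc _ _ _) }
            ; identity = (λ x → equalᶜ (Real.+-identityˡ _) (Real.+-identityˡ _))
                       , (λ x → equalᶜ (Real.+-identityʳ _) (Real.+-identityʳ _)) }
          ; inverse = (λ x → equalᶜ (Real.-‿inverseˡ _) (Real.-‿inverseˡ _))
                    , (λ x → equalᶜ (Real.-‿inverseʳ _) (Real.-‿inverseʳ _))
          ; ⁻¹-cong = λ (equalᶜ p q) → equalᶜ (Real.-‿cong p) (Real.-‿cong q) }
        ; comm = λ x y → equalᶜ (Real.+-comm _ _) (Real.+-comm _ _) }
      ; *-cong = λ (equalᶜ p q) (equalᶜ p′ q′) → equalᶜ
          (Real.+-cong (Real.*-cong p p′) (Real.-‿cong (Real.*-cong q q′)))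
          (Real.+-cong (Real.*-cong p q′) (Real.*-cong q p′))
      ; *-assoc = λ x y z → equalᶜ
          (Real.solve 6 (λ a b c d e f → (a :* c :- b :* d) :* e :- (a :* d :+ b :* c) :* f
                                   := a :* (c :* e :- d :* f) :- b :* (c :* f :+ d :* e)) Real.refl
            (Re x) (Im x) (Re y) (Im y) (Re z) (Im z))
          (Real.solve 6 (λ a b c d e f → (a :* c :- b :* d) :* f :+ (a :* d :+ b :* c) :* e
                                   := a :* (c :* f :+ d :* e) :+ b :* (c :* e :- d :* f)) Real.refl
            (Re x) (Im x) (Re y) (Im y) (Re z) (Im z))
      ; *-identity = identityˡ , λ x → ≅-trans (*ᶜ-comm x 1ᶜ) (identityˡ x)
      ; distrib = distribˡ , λ x y z → ≅-trans (*ᶜ-comm (y +ᶜ z) x) (≅-trans (distribˡ x y z)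
          (+ᶜ-cong (*ᶜ-comm x y) (*ᶜ-comm x z)))
      }
    ; *-comm = *ᶜ-comm } }
  where
  open Real using (_:=_; _:+_; _:*_; _:-_; :-_)
  ≅-trans : ∀ {x y z} → x ≅ y → y ≅ z → x ≅ z
  ≅-trans (equalᶜ p q) (equalᶜ p′ q′) = equalᶜ (Real.trans p p′) (Real.trans q q′)
  +ᶜ-cong : ∀ {x y z w} → x ≅ y → z ≅ w → x +ᶜ z ≅ y +ᶜ w
  +ᶜ-cong (equalᶜ p q) (equalᶜ p′ q′) = equalᶜ (Real.+-cong p p′) (Real.+-cong q q′)
  *ᶜ-comm : ∀ x y → x *ᶜ y ≅ y *ᶜ x
  *ᶜ-comm x y = equalᶜ
    (Real.solve 4 (λ a b c d → a :* c :- b :* d := c :* a :- d :* b) Real.refl (Re x) (Im x) (Re y) (Im y))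
    (Real.solve 4 (λ a b c d → a :* d :+ b :* c := c :* b :+ d :* a) Real.refl (Re x) (Im x) (Re y) (Im y))
  identityˡ : ∀ x → 1ᶜ *ᶜ x ≅ x
  identityˡ x = equalᶜ
    (Real.trans (Real.+-cong (Real.*-identityˡ _) (Real.trans (Real.-‿cong (Real.zeroˡ _)) Real.-0#≈0#)) (Real.+-identityʳ _))
    (Real.trans (Real.+-cong (Real.*-identityˡ _) (Real.zeroˡ _)) (Real.+-identityʳ _))
  distribˡ : ∀ x y z → x *ᶜ (y +ᶜ z) ≅ x *ᶜ y +ᶜ x *ᶜ z
  distribˡ x y z = equalᶜ
    (Real.solve 6 (λ a b c d e f → a :* (c :+ e) :- b :* (d :+ f) := (a :* c :- b :* d) :+ (a :* e :- b :* f)) Real.refl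
      (Re x) (Im x) (Re y) (Im y) (Re z) (Im z))
    (Real.solve 6 (λ a b c d e f → a :* (d :+ f) :+ b :* (c :+ e) := (a :* d :+ b :* c) :+ (a :* f :+ b :* e)) Real.refl
      (Re x) (Im x) (Re y) (Im y) (Re z) (Im z))

ℂ-starField : StarField 0ℓ 0ℓ
ℂ-starField = record
  { commutativeRing = ℂ-commutativeRing
  ; conj            = conjᶜ
  ; conj-cong       = λ (equalᶜ p q) → equalᶜ p (Real.-‿cong q)
  ; conj-+          = λ x y → equalᶜ Real.refl (Real.sym (Real.-‿+-comm _ _))
  ; conj-*          = λ x y → equalᶜ
      (Real.solve 4 (λ a b c d → a :* c :- b :* d := a :* c :- (:- b) :* (:- d)) Real.refl (Re x) (Im x) (Re y) (Im y))
      (Real.solve 4 (λ a b c d → :- (a :* d :+ b :* c) := a :* (:- d) :+ (:- b) :* c) Real.refl (Re x) (Im x) (Re y) (Im y))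
  ; conj-involutive = λ x → equalᶜ Real.refl (Real.-‿involutive _)
  ; NonNeg          = λ z → 0≤ Re z × Im z ≃ fromℚ 0ℚ
  ; NonNeg-resp     = λ (equalᶜ p q) (r , i) → 0≤-resp p r , Real.trans (Real.sym q) i
  ; NonNeg-+        = λ (r , i) (r′ , i′) → 0≤-+ r r′ , Real.trans (Real.+-cong i i′) (Real.+-identityˡ _)
  ; NonNeg-norm     = λ z → 0≤-resp (Real.sym (Re-norm z)) (0≤-norm z)
                          , Im-norm z
  ; NonNeg-real     = λ (_ , i) → equalᶜ Real.refl (Real.trans (Real.-‿cong i) (Real.trans Real.-0#≈0# (Real.sym i)))
  ; NonNeg-antisym  = λ (r , i) (r′ , _) (equalᶜ p _) → equalᶜ (0≤-antisym r r′ p) i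
  ; NonNeg-stable   = λ ¬¬nn → 0≤-stable (λ k → ¬¬nn (k ∘ proj₁)) , ≃-stable (λ k → ¬¬nn (k ∘ proj₂))
  ; NonNeg-sqrt     = λ {z} (r , i) → (√ Re z) +i fromℚ 0ℚ
      , equalᶜ Real.refl Real.-0#≈0#
      , equalᶜ
          (Real.trans (Real.+-cong (√-square r) (Real.trans (Real.-‿cong (Real.zeroˡ _)) Real.-0#≈0#)) (Real.+-identityʳ _))
          (Real.trans (Real.+-cong (Real.zeroʳ _) (Real.zeroˡ _)) (Real.trans (Real.+-identityʳ _) (Real.sym i)))
  ; norm-zero       = λ {z} (equalᶜ p _) → equalᶜ
      (ℝ-norm-zero (Real.trans (Real.sym (Re-norm z)) p))
      (ℝ-norm-zero (Real.trans (Real.+-comm _ _) (Real.trans (Real.sym (Re-norm z)) p)))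
  ; zero∨unit       = zero∨unit
  ; 1≉0             = λ (equalᶜ p _) → ℝ-1≉0 p
  }
  where
  open Real using (_:=_; _:+_; _:*_; _:-_; :-_)
  conjᶜ : ℂ → ℂ
  conjᶜ z = Re z +i (- Im z)
  Re-norm : ∀ z → Re (conjᶜ z *ᶜ z) ≃ Re z * Re z + Im z * Im z
  Re-norm z = Real.solve 2 (λ a b → a :* a :- (:- b) :* b := a :* a :+ b :* b) Real.refl (Re z) (Im z)
  Im-norm : ∀ z → Im (conjᶜ z *ᶜ z) ≃ fromℚ 0ℚ
  Im-norm z = Real.trans
    (Real.solve 2 (λ a b → a :* b :+ (:- b) :* a := a :* b :- a :* b) Real.refl (Re z) (Im z)) (Real.-‿inverseʳ _)
  0≤-norm : ∀ z → 0≤ Re z * Re z + Im z * Im z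
  0≤-norm z = 0≤-+ (0≤-pointwise λ n → 0≤square (seq (Re z) n)) (0≤-pointwise λ n → 0≤square (seq (Im z) n))
  -- Being zero means that x and -x are both nonnegative, and each of these is stable.
  ≃-stable : ∀ {x} → ¬ ¬ x ≃ fromℚ 0ℚ → x ≃ fromℚ 0ℚ
  ≃-stable {x} ¬¬x≃0 = 0≤-antisym
    (0≤-stable λ k → ¬¬x≃0 λ x≃0 → k (0≤-resp (Real.sym x≃0) 0≤0))
    (0≤-stable λ k → ¬¬x≃0 λ x≃0 → k (0≤-resp (Real.sym (Real.trans (Real.-‿cong x≃0) Real.-0#≈0#)) 0≤0))
    (Real.-‿inverseʳ x)
    where
    0≤0 : 0≤ fromℚ 0ℚ
    0≤0 = 0≤-pointwise λ _ → ℚ.≤-refl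
  zero∨unit : ∀ z → ¬ ¬ (z ≅ 0ᶜ ⊎ ∃ λ w → z *ᶜ w ≅ 1ᶜ)
  zero∨unit z k = ℝ-zero∨unit (Re z * Re z + Im z * Im z) λ where
    (inj₁ N≃0) → k (inj₁ (equalᶜ (ℝ-norm-zero N≃0) (ℝ-norm-zero (Real.trans (Real.+-comm _ _) N≃0))))
    -- The inverse is z̄/|z|², with q = 1/|z|².
    (inj₂ (q , Nq≃1)) → k (inj₂ ((Re z * q) +i (- (Im z * q)) , equalᶜ
      (Real.trans (Real.solve 3 (λ a b q → a :* (a :* q) :- b :* (:- (b :* q)) := (a :* a :+ b :* b) :* q) Real.refl (Re z) (Im z) q) Nq≃1)
      (Real.trans (Real.solve 3 (λ a b q → a :* (:- (b :* q)) :+ b :* (a :* q) := a :* (b :* q) :- a :* (b :* q)) Real.refl (Re z) (Im z) q)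
        (Real.-‿inverseʳ _))))

-- Signed counts of walks as traces

module Integers where
  open CommutativeRing ℤ.+-*-commutativeRing public using (semiring; rawRing)
  open SemiringSum semiring public
  open Exterior ℤ.+-*-commutativeRing public using (identity; combine-identity; sum-cong)

open Integers using () renaming (sum to ∑ℤ; sum-cong to ∑ℤ-cong)

-- Positive minus negative elements in a single number. Unlike the two separate counts it is
-- multiplicative when an arc is prepended, so it obeys the recursion of matrix powers.
signSum : {X : Set} → (X → Sign) → List X → ℤ
signSum f []       = 0ℤ
signSum f (x ∷ xs) = (f x ◃ 1) ℤ.+ signSum f xs

#_with-sign_ : {X : Set} → List X → Sign → (X → Sign) → ℕ
(# xs with-sign s) f = length (filter (λ x → f x Sign.≟ s) xs)

count-difference : {X : Set} (f : X → Sign) (xs : List X) →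
  + (# xs with-sign Sign.+) f ℤ.- + (# xs with-sign Sign.-) f ≡ signSum f xs
count-difference f [] = ≡.refl
count-difference f (x ∷ xs) with f x | count-difference f xs
... | Sign.+ | eq = ≡.trans (ℤ-solve 3 (λ p q o → (o :+ p) :- q := o :+ (p :- q)) ≡.refl
                      (+ (# xs with-sign Sign.+) f) (+ (# xs with-sign Sign.-) f) 1ℤ)
                      (≡.cong (ℤ._+_ 1ℤ) eq)
  where open ℤ.+-*-Solver using (_:+_; _:-_; _:=_) renaming (solve to ℤ-solve)
... | Sign.- | eq = ≡.trans (ℤ-solve 3 (λ p q o → p :- (o :+ q) := :- o :+ (p :- q)) ≡.refl
                      (+ (# xs with-sign Sign.+) f) (+ (# xs with-sign Sign.-) f) 1ℤ)
                      (≡.cong (ℤ._+_ (ℤ.- 1ℤ)) eq)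
  where open ℤ.+-*-Solver using (_:+_; _:-_; :-_; _:=_) renaming (solve to ℤ-solve)

signSum-++ : {X : Set} (f : X → Sign) (xs ys : List X) → signSum f (xs ++ ys) ≡ signSum f xs ℤ.+ signSum f ys
signSum-++ f []       ys = ≡.sym (ℤ.+-identityˡ _)
signSum-++ f (x ∷ xs) ys = ≡.trans (≡.cong (ℤ._+_ (f x ◃ 1)) (signSum-++ f xs ys))
  (≡.sym (ℤ.+-assoc (f x ◃ 1) (signSum f xs) (signSum f ys)))

signSum-concatMap : {X Y : Set} (f : X → Sign) (g : Y → List X) → ∀ n (h : Fin n → Y) →
  signSum f (concatMap g (tabulate h)) ≡ ∑ℤ λ i → signSum f (g (h i))
signSum-concatMap f g zero    h = ≡.refl
signSum-concatMap f g (suc n) h = ≡.trans (signSum-++ f (g (h zero)) _)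
  (≡.cong (ℤ._+_ (signSum f (g (h zero)))) (signSum-concatMap f g n (h ∘ suc)))

◃-* : ∀ s t → (s Sign.* t) ◃ 1 ≡ (s ◃ 1) ℤ.* (t ◃ 1)
◃-* Sign.+ Sign.+ = ≡.refl
◃-* Sign.+ Sign.- = ≡.refl
◃-* Sign.- Sign.+ = ≡.refl
◃-* Sign.- Sign.- = ≡.refl

signSum-map : {X Y : Set} (f : X → Sign) (h : Y → X) (g : Y → Sign) (s : Sign) → (∀ y → f (h y) ≡ s Sign.* g y) →
  ∀ ys → signSum f (map h ys) ≡ (s ◃ 1) ℤ.* signSum g ys
signSum-map f h g s eq []       = ≡.sym (ℤ.*-zeroʳ (s ◃ 1))
signSum-map f h g s eq (y ∷ ys) = ≡.trans
  (≡.cong₂ ℤ._+_ (≡.trans (≡.cong (_◃ 1) (eq y)) (◃-* s (g y))) (signSum-map f h g s eq ys))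
  (≡.sym (ℤ.*-distribˡ-+ (s ◃ 1) (g y ◃ 1) (signSum g ys)))

module _ {n} (S : Sidigraph n) where

  open Sidigraph S

  -- The recursion of matrix powers: the signed number of walks of length k from u to w is the
  -- corresponding entry of the k-th power of the adjacency matrix. A missing arc gives a zero entry
  -- and an empty list of continuations.
  signSum-walks-suc : ∀ k u w → signSum (sign S) (walks S (suc k) u w) ≡
    ∑ℤ λ v → adjacency S u v ℤ.* signSum (sign S) (walks S k v w)
  signSum-walks-suc k u w = ≡.trans
    (signSum-concatMap (sign S) (λ v → concatMap (λ e → map (e ∷_) (walks S k v w)) (arcs S u v)) n id)
    (∑ℤ-cong n first-arc)
    where
    first-arc : ∀ v → signSum (sign S) (concatMap (λ e → map (e ∷_) (walks S k v w)) (arcs S u v)) ≡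
      adjacency S u v ℤ.* signSum (sign S) (walks S k v w)
    first-arc v with T? (isArc u v)
    ... | no  _ = ≡.refl
    ... | yes e = ≡.trans (signSum-++ (sign S) (map (e ∷_) (walks S k v w)) []) (≡.trans (ℤ.+-identityʳ _)
      (signSum-map (sign S) (e ∷_) (sign S) (σ e) (λ _ → ≡.refl) (walks S k v w)))

  signSum-walks-0 : ∀ u w → signSum (sign S) (walks S 0 u w) ≡ Integers.identity u w
  signSum-walks-0 u w with u Fin.≟ w
  ... | yes ≡.refl = ≡.refl
  ... | no  _      = ≡.refl

  signSum-walks-2 : ∀ u w → signSum (sign S) (walks S 2 u w) ≡ ∑ℤ λ v → adjacency S u v ℤ.* adjacency S v w
  signSum-walks-2 u w = ≡.trans (signSum-walks-suc 1 u w) (∑ℤ-cong n λ v →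
    ≡.cong (adjacency S u v ℤ.*_) (≡.trans (signSum-walks-suc 0 v w)
      (≡.trans (∑ℤ-cong n λ x → ≡.cong (adjacency S v x ℤ.*_) (signSum-walks-0 x w))
        (Integers.combine-identity (adjacency S v) w))))

  -- Squaring forgets the sign of an arc, so the sum of all squared entries, tr AAᵀ, counts positive
  -- and negative arcs alike.
  arcs-square : ∀ u v →
    + (# arcs S u v with-sign Sign.+) σ ℤ.+ + (# arcs S u v with-sign Sign.-) σ ≡ adjacency S u v ℤ.* adjacency S u v
  arcs-square u v with T? (isArc u v)
  ... | no  _ = ≡.refl
  ... | yes e with σ e
  ...   | Sign.+ = ≡.refl
  ...   | Sign.- = ≡.refl

∑ℕ : ∀ {n} → Vector ℕ n → ℕ
∑ℕ = RawMonoidDefs.sum ℕ.+-0-rawMonoid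

pos-∑ : ∀ n (f : Vector ℕ n) → + ∑ℕ f ≡ ∑ℤ (+_ ∘ f)
pos-∑ zero    f = ≡.refl
pos-∑ (suc n) f = ≡.trans (ℤ.pos-+ (f zero) _) (≡.cong (ℤ._+_ (+ f zero)) (pos-∑ n (tail f)))

∑ℤ-minus : ∀ n (f g : Vector ℤ n) → ∑ℤ f ℤ.- ∑ℤ g ≡ ∑ℤ λ i → f i ℤ.- g i
∑ℤ-minus zero    f g = ≡.refl
∑ℤ-minus (suc n) f g = ≡.trans
  (ℤ-solve 4 (λ a b p q → (a :+ p) :- (b :+ q) := (a :- b) :+ (p :- q)) ≡.refl (f zero) (g zero) (∑ℤ (tail f)) (∑ℤ (tail g)))
  (≡.cong (ℤ._+_ (f zero ℤ.- g zero)) (∑ℤ-minus n (tail f) (tail g)))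
  where open ℤ.+-*-Solver using (_:+_; _:-_; _:=_) renaming (solve to ℤ-solve)

module _ {n} (S : Sidigraph n) where

  open Sidigraph S

  arc-count : + a S ≡ ∑ℤ λ u → ∑ℤ λ v → adjacency S u v ℤ.* adjacency S u v
  arc-count = ≡.trans (ℤ.pos-+ (a⁺ S) (a⁻ S)) (≡.trans (≡.cong₂ ℤ._+_ (pos-#arcs Sign.+) (pos-#arcs Sign.-))
    (≡.trans (≡.sym (Integers.∑-distrib-+ {n} (λ u → ∑ℤ (λ v → + # u v Sign.+)) (λ u → ∑ℤ (λ v → + # u v Sign.-))))
      (∑ℤ-cong n λ u → ≡.trans (≡.sym (Integers.∑-distrib-+ {n} (λ v → + # u v Sign.+) (λ v → + # u v Sign.-)))
        (∑ℤ-cong n λ v → arcs-square S u v))))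
    where
    # : Fin n → Fin n → Sign → ℕ
    # u v s = (# arcs S u v with-sign s) σ
    pos-#arcs : ∀ s → + #arcs S s ≡ ∑ℤ λ u → ∑ℤ λ v → + # u v s
    pos-#arcs s = ≡.trans (pos-∑ n (λ u → ∑ℕ λ v → # u v s)) (∑ℤ-cong n λ u → pos-∑ n λ v → # u v s)

  closed-walk-count : + c₂⁺ S ℤ.- + c₂⁻ S ≡ ∑ℤ λ u → ∑ℤ λ v → adjacency S u v ℤ.* adjacency S v u
  closed-walk-count = ≡.trans
    (≡.cong₂ ℤ._-_ (pos-∑ n (λ v → # v Sign.+)) (pos-∑ n (λ v → # v Sign.-)))
    (≡.trans (∑ℤ-minus n (λ v → + # v Sign.+) (λ v → + # v Sign.-))
      (∑ℤ-cong n λ v → ≡.trans (count-difference (sign S) (walks S 2 v v)) (signSum-walks-2 S v v)))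
    where
    # : Fin n → Sign → ℕ
    # v s = (# walks S 2 v v with-sign s) (sign S)

  -- The summand is kept in the order in which the diagonal of (A + Aᵀ)² delivers it. It equals p u
  -- v + p v u, and after exchanging the two sums each half is tr AAᵀ + tr A².
  symmetric-square : let A = adjacency S ; m = + a S ℤ.+ + c₂⁺ S ℤ.- + c₂⁻ S in
    ∑ℤ (λ u → ∑ℤ λ v → (A u v ℤ.+ A v u) ℤ.* (A v u ℤ.+ A u v)) ≡ m ℤ.+ m
  symmetric-square = ≡.trans
    (∑ℤ-cong n λ u → ≡.trans
      (∑ℤ-cong n λ v → ℤ-solve 2 (λ x y → (x :+ y) :* (y :+ x) := (x :* x :+ x :* y) :+ (y :* y :+ y :* x)) ≡.refl (A u v) (A v u))
      (Integers.∑-distrib-+ {n} (λ v → p u v) (λ v → p v u)))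
    (≡.trans (Integers.∑-distrib-+ {n} (λ u → ∑ℤ (λ v → p u v)) (λ u → ∑ℤ (λ v → p v u)))
    (≡.trans (≡.cong (ℤ._+_ P) (Integers.∑-comm {n} {n} (λ u v → p v u)))
      (≡.cong₂ ℤ._+_ P≡m P≡m)))
    where
    open ℤ.+-*-Solver using (_:+_; _:-_; _:*_; _:=_) renaming (solve to ℤ-solve)
    A : Fin n → Fin n → ℤ
    A = adjacency S
    p : Fin n → Fin n → ℤ
    p u v = A u v ℤ.* A u v ℤ.+ A u v ℤ.* A v u
    P : ℤ
    P = ∑ℤ λ u → ∑ℤ λ v → p u v
    P≡m : P ≡ + a S ℤ.+ + c₂⁺ S ℤ.- + c₂⁻ S
    P≡m = ≡.trans (∑ℤ-cong n λ u → Integers.∑-distrib-+ {n} (λ v → A u v ℤ.* A u v) (λ v → A u v ℤ.* A v u))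
      (≡.trans (Integers.∑-distrib-+ {n} (λ u → ∑ℤ (λ v → A u v ℤ.* A u v)) (λ u → ∑ℤ (λ v → A u v ℤ.* A v u)))
      (≡.trans (≡.sym (≡.cong₂ ℤ._+_ arc-count closed-walk-count))
        (≡.sym (ℤ.+-assoc (+ a S) (+ c₂⁺ S) (ℤ.- + c₂⁻ S)))))

-- From integers to reals

fromℤ-+ : ∀ i j → fromℤ (i ℤ.+ j) ≃ fromℤ i + fromℤ j
fromℤ-+ i j = pointwise λ _ → ℚ.toℚᵘ-injective
  (ℚᵘ.≃-trans (ℚ.toℚᵘ-fromℚᵘ (ℚᵘ.mkℚᵘ (i ℤ.+ j) 0))
  (ℚᵘ.≃-trans (ℚᵘ.*≡* (≡.cong (ℤ._* + 1) (≡.sym (≡.cong₂ ℤ._+_ (ℤ.*-identityʳ i) (ℤ.*-identityʳ j)))))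
  (ℚᵘ.≃-sym (ℚᵘ.≃-trans (ℚ.toℚᵘ-homo-+ (i ℚ./ 1) (j ℚ./ 1))
    (ℚᵘ.+-cong (ℚ.toℚᵘ-fromℚᵘ (ℚᵘ.mkℚᵘ i 0)) (ℚ.toℚᵘ-fromℚᵘ (ℚᵘ.mkℚᵘ j 0)))))))

fromℤ-* : ∀ i j → fromℤ (i ℤ.* j) ≃ fromℤ i * fromℤ j
fromℤ-* i j = pointwise λ _ → ℚ.toℚᵘ-injective
  (ℚᵘ.≃-trans (ℚ.toℚᵘ-fromℚᵘ (ℚᵘ.mkℚᵘ (i ℤ.* j) 0))
  (ℚᵘ.≃-sym (ℚᵘ.≃-trans (ℚ.toℚᵘ-homo-* (i ℚ./ 1) (j ℚ./ 1))
    (ℚᵘ.*-cong (ℚ.toℚᵘ-fromℚᵘ (ℚᵘ.mkℚᵘ i 0)) (ℚ.toℚᵘ-fromℚᵘ (ℚᵘ.mkℚᵘ j 0))))))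

fromℤ-neg : ∀ i → fromℤ (ℤ.- i) ≃ - fromℤ i
fromℤ-neg i = Real.+-inverseˡ-unique (fromℤ (ℤ.- i)) (fromℤ i)
  (Real.trans (Real.sym (fromℤ-+ (ℤ.- i) i)) (pointwise λ _ → ≡.cong (ℚ._/ 1) (ℤ.+-inverseˡ i)))

fromℤ-∑ : ∀ n (f : Vector ℤ n) → fromℤ (∑ℤ f) ≃ Real.sum (fromℤ ∘ f)
fromℤ-∑ zero    f = pointwise λ _ → ≡.refl
fromℤ-∑ (suc n) f = Real.trans (fromℤ-+ (f zero) _) (Real.+-congˡ (fromℤ-∑ n (tail f)))

fromℕ-suc : ∀ n → fromℕ (suc n) ≃ fromℚ 1ℚ + fromℕ n
fromℕ-suc n = fromℤ-+ 1ℤ (+ n)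

Re-sum : ∀ n (f : Vector ℂ n) → Re (RawSemiringDefs.sum (RawRing.rawSemiring ℂ-rawRing) f) ≡ Real.sum (Re ∘ f)
Re-sum zero    f = ≡.refl
Re-sum (suc n) f = ≡.cong (_+_ (Re (f zero))) (Re-sum n (tail f))

ℂ-eigenvalues : ∀ n (A : Fin n → Fin n → ℂ) z → Matrices.AreEigenvalues ℂ-rawRing A z →
  Matrices.AreEigenvalues (CommutativeRing.rawRing ℂ-commutativeRing) A z
ℂ-eigenvalues n A z eig x = ≡.subst₂ _≅_
  (charPoly-independent n A x) (product-independent n (λ j → x +ᶜ (-ᶜ z j)))
  (equalᶜ (equal (proj₁ (eig x))) (equal (proj₂ (eig x))))
  where open EqualityIndependence ℂ-rawRing _≅_ using (charPoly-independent; product-independent)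

-- Sums of squares and the Cauchy-Schwarz inequality

0≤-square : ∀ x → 0≤ x * x
0≤-square x = 0≤-pointwise λ n → 0≤square (seq x n)

0≤-sum : ∀ n (f : Vector ℝ n) → (∀ i → 0≤ f i) → 0≤ Real.sum f
0≤-sum zero    f h = 0≤-pointwise λ _ → ℚ.≤-refl
0≤-sum (suc n) f h = 0≤-+ (h zero) (0≤-sum n (tail f) (h ∘ suc))

open Real using (_:=_; _:+_; _:*_; _:-_; :-_)

∑² : ∀ {n} → Vector ℝ n → ℝ
∑² e = Real.sum λ i → e i * e i

sum-square-differences : ∀ n x (e : Vector ℝ n) →
  Real.sum (λ i → (x - e i) * (x - e i)) ≃ fromℕ n * (x * x) - (x * Real.sum e + x * Real.sum e) + ∑² e
sum-square-differences zero x e = Real.sym (Real.trans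
  (Real.+-identityʳ _) (Real.trans (Real.+-cong (Real.zeroˡ _)
    (Real.trans (Real.-‿cong (Real.trans (Real.+-cong (Real.zeroʳ x) (Real.zeroʳ x)) (Real.+-identityʳ _))) Real.-0#≈0#))
    (Real.+-identityʳ _)))
sum-square-differences (suc n) x e = Real.trans
  (Real.+-congˡ (sum-square-differences n x (tail e)))
  (Real.trans
    (Real.trans (Real.+-congʳ (Real.sym (Real.*-identityˡ _)))
      (Real.solve 6 (λ x y n s q o → o :* ((x :- y) :* (x :- y)) :+ (n :* (x :* x) :- (x :* s :+ x :* s) :+ q)
         := (o :+ n) :* (x :* x) :- (x :* (o :* y :+ s) :+ x :* (o :* y :+ s)) :+ (o :* (y :* y) :+ q)) Real.refl
       x (e zero) (fromℕ n) (Real.sum (tail e)) (∑² (tail e)) (fromℚ 1ℚ)))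
    (Real.+-cong
      (Real.+-cong (Real.*-congʳ (Real.sym (fromℕ-suc n)))
        (Real.-‿cong (Real.+-cong (Real.*-congˡ (Real.+-congʳ (Real.*-identityˡ _)))
          (Real.*-congˡ (Real.+-congʳ (Real.*-identityˡ _))))))
      (Real.+-congʳ (Real.*-identityˡ _))))

-- Lagrange's identity, one entry at a time: (n + 1)(x² + Q) - (x + s)² = (nQ - s²) + Σ (x - eᵢ)²,
-- where s and Q are the sum and the sum of squares of the remaining entries.
cauchy-schwarz : ∀ n (e : Vector ℝ n) → 0≤ fromℕ n * ∑² e - Real.sum e * Real.sum e
cauchy-schwarz zero e = 0≤-pointwise λ _ → ℚ.≤-refl
cauchy-schwarz (suc n) e = 0≤-resp
  (Real.trans
    (Real.+-congˡ (sum-square-differences n x (tail e)))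
    (Real.trans
      (Real.trans (Real.+-congˡ (Real.+-congˡ (Real.sym (Real.*-identityˡ _))))
        (Real.trans
          -- The real number 1 enters as the variable o. The correction x² - o x² makes the identity
          -- valid for every o, and it vanishes for o = 1.
          (Real.solve 5 (λ x n s q o → (n :* q :- s :* s) :+ (n :* (x :* x) :- (x :* s :+ x :* s) :+ o :* q)
            := ((o :+ n) :* (x :* x :+ q) :- (x :+ s) :* (x :+ s)) :+ (x :* x :- o :* (x :* x))) Real.refl
            x (fromℕ n) (Real.sum (tail e)) (∑² (tail e)) (fromℚ 1ℚ))
          (Real.trans (Real.+-congˡ (Real.trans (Real.+-congˡ (Real.-‿cong (Real.*-identityˡ _))) (Real.-‿inverseʳ _)))
            (Real.+-identityʳ _))))
      (Real.+-congʳ (Real.*-congʳ (Real.sym (fromℕ-suc n))))))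
  (0≤-+ (cauchy-schwarz n (tail e)) (0≤-sum n _ λ i → 0≤-square (x - e (suc i))))
  where
  x : ℝ
  x = e zero

-- The energy bound

module _ {n} (S : Sidigraph n) where

  private
    A : Fin n → Fin n → ℤ
    A = adjacency S
    Aᶜ : Fin n → Fin n → ℂ
    Aᶜ u v = ℤ→ℂ (A u v)
    module K = Schur ℂ-starField

  Re-hermitianNorm : Re (K.hermitianNorm Aᶜ) ≃ fromℤ (∑ℤ λ u → ∑ℤ λ v → (A u v ℤ.+ A v u) ℤ.* (A v u ℤ.+ A u v))
  Re-hermitianNorm = Real.trans (Real.reflexive (Re-sum n _)) (Real.trans
    (Real.sum-cong-≋ {n} λ u → Real.trans (Real.reflexive (Re-sum n _)) (Real.trans
      (Real.sum-cong-≋ {n} λ v → entry (A u v) (A v u))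
      (Real.sym (fromℤ-∑ n λ v → (A u v ℤ.+ A v u) ℤ.* (A v u ℤ.+ A u v)))))
    (Real.sym (fromℤ-∑ n λ u → ∑ℤ λ v → (A u v ℤ.+ A v u) ℤ.* (A v u ℤ.+ A u v))))
    where
    0-0 : fromℚ 0ℚ - fromℚ 0ℚ ≃ fromℚ 0ℚ
    0-0 = Real.-‿inverseʳ _
    entry : ∀ i j → (fromℤ i + fromℤ j) * (fromℤ j + fromℤ i) - (fromℚ 0ℚ - fromℚ 0ℚ) * (fromℚ 0ℚ - fromℚ 0ℚ)
      ≃ fromℤ ((i ℤ.+ j) ℤ.* (j ℤ.+ i))
    entry i j = Real.trans
      (Real.+-cong (Real.*-cong (Real.sym (fromℤ-+ i j)) (Real.sym (fromℤ-+ j i)))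
        (Real.trans (Real.-‿cong (Real.trans (Real.*-congʳ 0-0) (Real.zeroˡ _))) Real.-0#≈0#))
      (Real.trans (Real.+-identityʳ _) (Real.sym (fromℤ-* (i ℤ.+ j) (j ℤ.+ i))))

  excess : ℝ
  excess = fromℕ (a S) + fromℕ (c₂⁺ S) - fromℕ (c₂⁻ S)

  Re-hermitianNorm≃excess : Re (K.hermitianNorm Aᶜ) ≃ excess + excess
  Re-hermitianNorm≃excess = Real.trans Re-hermitianNorm (Real.trans
    (Real.reflexive (≡.cong fromℤ (symmetric-square S)))
    (Real.trans (fromℤ-+ m m) (Real.+-cong m≃ m≃)))
    where
    m : ℤ
    m = + a S ℤ.+ + c₂⁺ S ℤ.- + c₂⁻ S
    m≃ : fromℤ m ≃ excess
    m≃ = Real.trans (fromℤ-+ (+ a S ℤ.+ + c₂⁺ S) (ℤ.- + c₂⁻ S))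
      (Real.+-cong (fromℤ-+ (+ a S) (+ c₂⁺ S)) (fromℤ-neg (+ c₂⁻ S)))

  -- Four times ΣRe² is bounded by twice the excess because ‖A + A*‖² = 2 (tr AAᵀ + tr A²). The
  -- common factor is divided out only in `∑∣∣-bound`.
  ∑Re²-bound : ∀ z → Eigenvalues S z →
    let q = ∑² (Re ∘ z) in 0≤ (excess + excess) - ((q + q) + (q + q))
  ∑Re²-bound z eig = 0≤-resp
    (Real.+-cong Re-hermitianNorm≃excess (Real.-‿cong (Real.trans (Real.reflexive (Re-sum n _)) (quadruple n z))))
    (proj₁ (K.schur n Aᶜ z (ℂ-eigenvalues n Aᶜ z eig)))
    where
    quadruple : ∀ n (z : Vector ℂ n) → let q = ∑² (Re ∘ z) in
      Real.sum (λ j → (Re (z j) + Re (z j)) * (Re (z j) + Re (z j)) - (Im (z j) - Im (z j)) * (Im (z j) - Im (z j)))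
        ≃ (q + q) + (q + q)
    quadruple zero    z = pointwise λ _ → ≡.refl
    quadruple (suc n) z = Real.trans (Real.+-congˡ (quadruple n (tail z)))
      (Real.solve 3 (λ r y q → ((r :+ r) :* (r :+ r) :- (y :- y) :* (y :- y)) :+ ((q :+ q) :+ (q :+ q))
        := (((r :* r) :+ q) :+ ((r :* r) :+ q)) :+ (((r :* r) :+ q) :+ ((r :* r) :+ q))) Real.refl
        (Re (z zero)) (Im (z zero)) (∑² (Re ∘ tail z)))

∑∣∣-bound : ∀ n (r : Vector ℝ n) m → let q = ∑² r ; E = Real.sum λ j → ∣ r j ∣ in
  0≤ (m + m) - ((q + q) + (q + q)) → 0≤ fromℚ ½ * fromℕ n * m - E * E
∑∣∣-bound n r m bound = 0≤-resp combine (0≤-+ (cauchy-schwarz n λ j → ∣ r j ∣)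
  (0≤-resp (Real.*-congʳ (pointwise λ _ → ≡.refl))
    -- The factor n/4 turns 2m - 4q into nm/2 - nq, and the term nq then cancels against the one
    -- from Cauchy-Schwarz.
    (0≤-scale (½ ℚ.* ½ ℚ.* (+ n ℚ./ 1)) (0≤* (0≤* 0≤½ 0≤½) (nonNeg-/ n 0)) bound)))
  where
  0≤½ : 0ℚ ℚ.≤ ½
  0≤½ = ℚ.<⇒≤ (ℚ.positive⁻¹ ½)
  q h E N : ℝ
  q = ∑² r
  h = fromℚ ½
  E = Real.sum λ j → ∣ r j ∣
  N = fromℕ n
  h+h : h + h ≃ fromℚ 1ℚ
  h+h = pointwise λ _ → ≡.refl
  squares : ∑² (λ j → ∣ r j ∣) ≃ q
  squares = Real.sum-cong-≋ {n} λ j → pointwise λ k → ∣p∣²≡p² (seq (r j) k)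
  combine : (N * ∑² (λ j → ∣ r j ∣) - E * E) + h * h * N * ((m + m) - ((q + q) + (q + q)))
    ≃ h * N * m - E * E
  combine = Real.trans
    (Real.+-congʳ (Real.+-congʳ (Real.*-congˡ squares)))
    (Real.trans
      (Real.solve 5 (λ n q e h m → (n :* q :- e :* e) :+ h :* h :* n :* ((m :+ m) :- ((q :+ q) :+ (q :+ q)))
        := (n :* q :- e :* e) :+ ((h :+ h) :* (h :* n :* m) :- (h :+ h) :* (h :+ h) :* (n :* q))) Real.refl N q E h m)
      (Real.trans
        (Real.+-congˡ (Real.+-cong
          (Real.trans (Real.*-congʳ h+h) (Real.*-identityˡ _))
          (Real.-‿cong (Real.trans (Real.*-congʳ (Real.trans (Real.*-cong h+h h+h) (Real.*-identityˡ _))) (Real.*-identityˡ _)))))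
        (Real.solve 3 (λ p e r → (p :- e) :+ (r :- p) := r :- e) Real.refl (N * q) (E * E) (h * N * m))))

theorem5p4 : ∀ (n : ℕ) (S : Sidigraph n) (z : Vector ℂ n) → Eigenvalues S z →
    energy z ≤ √ (fromℚ ½ * fromℕ n * (fromℕ (a S) + fromℕ (c₂⁺ S) - fromℕ (c₂⁻ S)))
theorem5p4 n S z eig = square≤⇒≤√ {energy z} {fromℚ ½ * fromℕ n * excess S}
  (∑∣∣-bound n (Re ∘ z) (excess S) (∑Re²-bound S z eig))
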